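{- Let $\Xi$ be an ordered strict associative clan, let $q\in\mathbb R$, let $\delta=((C_1:\mathbf H_1,\dots,C_p:\mathbf H_p),\mathbf H)$ be a $\Xi$-delegation, and let $\emptyset\neq B\subseteq\{1,\dots,p\}$. Then the following equalities hold in the real vector space spanned by the constructs of $\mathbf H$: $$\ast(\delta)=\ast^{\lceil}(\delta)=\ast^{\leq}(\delta)\qquad\text{and}\qquad \ast_B(\delta)=\ast_B^{\lceil}(\delta)=\ast_B^{\leq}(\delta).$$
   Context: **Hypergraphs and constructs.** A (finite) hypergraph $\mathbf H$ with finite vertex set $H$ is a set of non-empty subsets of $H$ (hyperedges) with $\bigcup\mathbf H=H$ and $\{x\}\in\mathbf H$ for all $x\in H$. For $X\subseteq H$, $\mathbf H_X:=\{Z\in\mathbf H: Z\subseteq X\}$ and $\mathbf H\setminus X:=\mathbf H_{H\setminus X}$. $\mathbf H$ is connected if there is no partition $H=X_1\cup X_2$ into two non-empty parts with $\mathbf H=\mathbf H_{X_1}\cup\mathbf H_{X_2}$; $X\subseteq H$ is connected in $\mathbf H$ if $\mathbf H_X$ is connected. $\mathbf H,X\leadsto H_1,\dots,H_n$ means that $\mathbf H_{H_1},\dots,\mathbf H_{H_n}$ are the connected components of $\mathbf H\setminus X$. Constructs of a connected hypergraph $\mathbf H$ are non-planar rooted trees with nodes labelled by non-empty subsets of $H$: the one-node tree $H$ is a construct; if $\emptyset\neq Y\subsetneq H$, $\mathbf H,Y\leadsto H_1,\dots,H_n$ and $T_i$ is a construct of $\mathbf H_{H_i}$, then $Y(T_1,\dots,T_n)$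 (root $Y$, immediate subtrees $T_i$) is a construct. $T:\mathbf H$ means $T$ is a construct of $\mathbf H$. **Order.** All vertex sets are finite subsets of $\mathbb Z$ with the induced order; $Y<Z$ means $\max Y<\min Z$. $\mathbf H$ is hereditarily ordered if for every non-empty $X\subseteq H$ the components of $\mathbf H\setminus X$ can be indexed so that $H_1<\cdots<H_n$. If in $S$ the node $X$ is the parent of $Y$, contracting this edge (merged label $X\cup Y$) yields a construct $T$; write $S\subset_{X,Y}T$. $S\lessdot S'$ iff there are $U>V$ with $S\subset_{U,V}S'$ or $S'\subset_{V,U}S$. The generalised flip order $\leq$ is the reflexive transitive closure of $\lessdot$. **Restriction.** Let $\mathbf K$ be a connected hypergraph with $K\subseteq H$, each hyperedge of $\mathbf K$ being connected in $\mathbf H$, and $C:\mathbf H$. The restriction $C_{\lceil\mathbf K}:\mathbf K$ is: $K$ if $C=H$; if $C=X(C_1,\dots,C_n)$ with $\mathbf H,X\leadsto H_1,\dots,H_n$ and $X\cap K=\emptyset$, then $K\subseteq H_i$ for some $i$ and $C_{\lceil\mathbf K}=(C_i)_{\lceil\mathbf K}$; if $X\cap K\ne\emptyset$ and $\mathbf K,X\cap K\leadsto K_1,\dots,K_r$, then each $K_j$ lies in some $H_{\psi(j)}$ and $C_{\lceil\mathbf K}=(X\cap K)((C_{\psi(1)})_{\lceil\mathbf K_{K_1}},\dots,(C_{\psi(r)})_{\lceil\mathbf K_{K_r}})$. **Teams and clans.** Fix a $\mathbb Z$-ordered universe $\mathfrak U$: a collection of connected hypergraphs with vertices in $\mathbb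 Z$, each hereditarily ordered. An ordered strict team is $\tau=((\mathbf H_1,\dots,\mathbf H_p),\mathbf H)$ with all $\mathbf H_a,\mathbf H\in\mathfrak U$, the $H_a$ pairwise disjoint, $H=\bigcup_aH_a$, $H_1<\cdots<H_p$, and such that every non-empty $K\subseteq H_a$ connected in $\mathbf H_a$ is connected in $\mathbf H$. Put $A=\{1,\dots,p\}$. For $\emptyset\neq B\subseteq A$ and $\emptyset\neq X_b\subseteq H_b$ ($b\in B$), let $\mathbf H_b,X_b\leadsto H_{(b,1)},\dots,H_{(b,n_b)}$, $X_B=\bigcup_{b\in B}X_b$, $\mathbf H,X_B\leadsto H_1^B,\dots,H_{n_B}^B$, and $\tilde A=(A\setminus B)\cup\{(b,i):b\in B,1\le i\le n_b\}$. Each $H_{\tilde a}$ ($\tilde a\in\tilde A$) is contained in exactly one $H_i^B$. The induced (ordered) teams are $\tau_i^B$, with coordinating hypergraph $\mathbf H_i^B=\mathbf H_{H_i^B}$ and participating hypergraphs those $\mathbf H_{\tilde a}$ with $H_{\tilde a}\subseteq H_i^B$ (listed increasingly), where $\mathbf H_{(b,i)}=(\mathbf H_b)_{H_{(b,i)}}$. An ordered strict clan $\Xi$ is a set of ordered strict teams such that $\tau\in\Xi$ implies all $\tau_i^B\in\Xi$ for all choices of $B$ and $(X_b)$. It is associative if whenever $\tau=(\{\mathbf H_a\}_{a\in A},\mathbf H)\in\Xi$, $a_0\in A$, and $\tau'=(\{\mathbf H_{(a_0,a')}\}_{a'\in A'},\mathbf H_{a_0})\in\Xi$, the team obtained from $\tau$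 by replacing $\mathbf H_{a_0}$ with all the $\mathbf H_{(a_0,a')}$ is in $\Xi$. **Delegations.** A $\Xi$-delegation is $\delta=((C_1:\mathbf H_1,\dots,C_p:\mathbf H_p),\mathbf H)$ with $\tau=((\mathbf H_1,\dots,\mathbf H_p),\mathbf H)\in\Xi$. Put $X_a=\mathrm{root}(C_a)$. For $\emptyset\ne B\subseteq A$, writing $C_b=X_b(C_{(b,1)},\dots,C_{(b,n_b)})$ for $b\in B$ with $C_{(b,i)}:\mathbf H_{(b,i)}$, the induced delegations $\delta_i^B$ ($1\le i\le n_B$) consist of the $C_{\tilde a}:\mathbf H_{\tilde a}$ with $H_{\tilde a}\subseteq H_i^B$, and coordinating hypergraph $\mathbf H_i^B$. **Products.** Recursively (extending grafting multilinearly), $\ast(\delta)=\sum_{\emptyset\ne B\subseteq A}q^{|B|-1}\ast_B(\delta)$, where $\ast_B(\delta)=X_B(\ast(\delta_1^B),\dots,\ast(\delta_{n_B}^B))$. Recursively define constructs of $\mathbf H$: $\backslash(\delta)=X_1(\backslash(\delta_1^{\{1\}}),\dots,\backslash(\delta^{\{1\}}_{n_{\{1\}}}))$ and $/(\delta)=X_p(/(\delta_1^{\{p\}}),\dots,/(\delta^{\{p\}}_{n_{\{p\}}}))$; and for $B$: $/^B(\delta)=X_B(/(\delta_1^B),\dots,/(\delta_{n_B}^B))$, $\backslash_B(\delta)=X_B(\backslash(\delta_1^B),\dots,\backslash(\delta_{n_B}^B))$. For $U=X(U_1,\dots,U_n):\mathbf H$, let $B'=\{b\in A:X\cap H_b\neq\emptyset\}$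 and use the subsets $X\cap H_b$, $b\in B'$, to form the induced teams $\tau_1,\dots,\tau_n$ (so $U_i$ is a construct of the coordinating hypergraph of $\tau_i$); define $\mu^\tau(U)=(|B'|-1)+\sum_{i=1}^n\mu^{\tau_i}(U_i)$. Then (with $q^0=1$): $\ast^{\lceil}(\delta)=\sum q^{\mu^\tau(U)}U$ over $U:\mathbf H$ with $U_{\lceil\mathbf H_i}=C_i$ for all $1\le i\le p$; $\ast_B^{\lceil}(\delta)=\sum q^{\mu^\tau(U)-|B|+1}U$ over $U:\mathbf H$ with $\mathrm{root}(U)=X_B$ and $U_{\lceil\mathbf H_i}=C_i$ for all $i$; $\ast^{\le}(\delta)=\sum q^{\mu^\tau(U)}U$ over $U:\mathbf H$ with $/(\delta)\le U\le\backslash(\delta)$; $\ast_B^{\le}(\delta)=\sum q^{\mu^\tau(U)-|B|+1}U$ over $U:\mathbf H$ with $/^B(\delta)\le U\le\backslash_B(\delta)$. -}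

module Defs where

open import Level using (_⊔_)
open import Algebra.Bundles using (CommutativeRing)
open import Data.Bool using (if_then_else_; not)
open import Data.Fin using (Fin; zero; suc; fromℕ)
import Data.Fin.Subset as Sub
open Sub using (Subset; inside; outside; ⁅_⁆; ∣_∣)
open import Data.Fin.Subset.Properties using (nonempty?)
open import Data.Integer as ℤ using (ℤ)
import Data.Integer.Properties as ℤ
open import Data.List using (List; []; _∷_; [_]; _++_; map; filter; length;
  merge; null; concatMap; cartesianProductWith; zip)
open import Data.List.Membership.DecPropositional ℤ._≟_ using (_∈?_)
open import Data.List.Membership.Propositional using (_∈_)
open import Data.List.Properties using (≡-dec)
open import Data.List.Relation.Binary.Disjoint.Propositional using (Disjoint)
open import Data.List.Relation.Binary.Pointwise using (Pointwise)
import Data.List.Relation.Binary.Sublist.Propositional as Sublist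
open import Data.List.Relation.Binary.Subset.DecPropositional ℤ._≟_ using (_⊆_; _⊆?_)
open import Data.List.Relation.Unary.All using (All; all?)
open import Data.List.Relation.Unary.AllPairs using (AllPairs)
open import Data.List.Relation.Unary.Any using (Any; any?)
open import Data.List.Relation.Unary.Unique.Propositional using (Unique)
open import Data.Nat using (ℕ; zero; suc; _+_; _∸_)
open import Data.Product using (_×_; _,_; proj₁; proj₂; ∃₂)
open import Data.Sum using (_⊎_)
open import Data.Vec as Vec using (Vec; []; _∷_; fromList; toList; lookup)
import Data.Vec.Relation.Unary.All as Vec using (All)
import Data.Vec.Relation.Unary.AllPairs as Vec using (AllPairs)
import Data.Vec.Relation.Unary.Any as Vec using (Any)
open import Function using (_∘_)
open import Function.Bundles using (_⇔_)
open import Relation.Binary.Construct.Closure.ReflexiveTransitive using (Star)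
open import Relation.Binary.Definitions using (DecidableEquality)
open import Relation.Binary.PropositionalEquality using (_≡_; _≢_; refl; cong₂)
open import Relation.Nullary using (¬_; Dec; yes; no; does; ¬?; _×-dec_; _⊎-dec_; _→-dec_)
open import Relation.Nullary.Decidable using (map′)
open import Relation.Unary using (Pred)

------------------------------------------------------------------------
-- Finite sets of integers

-- A finite subset of ℤ is represented by its strictly increasing
-- enumeration, so that _≡_ is equality of sets.
VSet : Set
VSet = List ℤ

Increasing : VSet → Set
Increasing = AllPairs ℤ._<_

_≟ˢ_ : DecidableEquality VSet
_≟ˢ_ = ≡-dec ℤ._≟_

-- All subsets, each increasing if the argument is; "X ∈ subsets H" says
-- that X is a subset of H.  In this listing, of two disjoint non-empty
-- sets the one with the smaller minimum comes first.
subsets : VSet → List VSet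
subsets []       = [ [] ]
subsets (x ∷ xs) = map (x ∷_) (subsets xs) ++ subsets xs

infixr 7 _∩_
infixr 6 _∪_ _∖_

_∩_ : VSet → VSet → VSet
X ∩ K = filter (_∈? X) K

_∖_ : VSet → VSet → VSet
H ∖ X = filter (λ x → ¬? (x ∈? X)) H

-- Only applied to disjoint sets, for which the result has no repetition.
_∪_ : VSet → VSet → VSet
_∪_ = merge ℤ._≤?_

-- max Y < min Z
_≺_ : VSet → VSet → Set
Y ≺ Z = All (λ y → All (y ℤ.<_) Z) Y

------------------------------------------------------------------------
-- Hypergraphs

record Hypergraph : Set where
  constructor hypergraph
  field
    vertices : VSet
    edges    : List VSet

open Hypergraph public

-- The hyperedges are listed without repetition in the order of "subsets",
-- so that _≡_ is equality of hypergraphs.  Together, the second and fourth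
-- fields say that the union of the hyperedges is the vertex set.
record IsHypergraph (𝐇 : Hypergraph) : Set where
  field
    increasing : Increasing (vertices 𝐇)
    canonical  : edges 𝐇 Sublist.⊆ subsets (vertices 𝐇)
    nonempty   : All (_≢ []) (edges 𝐇)
    singletons : All (λ x → [ x ] ∈ edges 𝐇) (vertices 𝐇)

infix 8 _∣_ _∖ᴴ_

-- 𝐇_X, for X a subset of the vertices.
_∣_ : Hypergraph → VSet → Hypergraph
𝐇 ∣ X = hypergraph X (filter (_⊆? X) (edges 𝐇))

_∖ᴴ_ : Hypergraph → VSet → Hypergraph
𝐇 ∖ᴴ X = 𝐇 ∣ (vertices 𝐇 ∖ X)

-- The partition into X₁ and its complement disconnects 𝐇.
Disconnects : Hypergraph → VSet → Set
Disconnects 𝐇 X₁ = X₁ ≢ [] × X₂ ≢ [] × All (λ Z → Z ⊆ X₁ ⊎ Z ⊆ X₂) (edges 𝐇)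
  where X₂ = vertices 𝐇 ∖ X₁

disconnects? : ∀ 𝐇 X → Dec (Disconnects 𝐇 X)
disconnects? 𝐇 X₁ =
  ¬? (X₁ ≟ˢ []) ×-dec ¬? (X₂ ≟ˢ []) ×-dec
  all? (λ Z → (Z ⊆? X₁) ⊎-dec (Z ⊆? X₂)) (edges 𝐇)
  where X₂ = vertices 𝐇 ∖ X₁

Connected : Hypergraph → Set
Connected 𝐇 = ¬ Any (Disconnects 𝐇) (subsets (vertices 𝐇))

connected? : ∀ 𝐇 → Dec (Connected 𝐇)
connected? 𝐇 = ¬? (any? (disconnects? 𝐇) (subsets (vertices 𝐇)))

ConnectedIn : Hypergraph → VSet → Set
ConnectedIn 𝐇 X = Connected (𝐇 ∣ X)

-- Non-empty and maximal among the connected sets of vertices.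
IsComponent : Hypergraph → VSet → Set
IsComponent 𝐇 X =
  X ≢ [] × ConnectedIn 𝐇 X ×
  All (λ Y → ConnectedIn 𝐇 Y → X ⊆ Y → Y ⊆ X) (subsets (vertices 𝐇))

isComponent? : ∀ 𝐇 X → Dec (IsComponent 𝐇 X)
isComponent? 𝐇 X =
  ¬? (X ≟ˢ []) ×-dec connected? (𝐇 ∣ X) ×-dec
  all? (λ Y → connected? (𝐇 ∣ Y) →-dec (X ⊆? Y) →-dec (Y ⊆? X))
       (subsets (vertices 𝐇))

-- Vertex sets of the connected components, by increasing minimum.
components : Hypergraph → List VSet
components 𝐇 = filter (isComponent? 𝐇) (subsets (vertices 𝐇))

-- 𝐇 , X ⤳ H₁ , … , Hₙ, returned as the hypergraphs 𝐇_{H₁} , … , 𝐇_{Hₙ}.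
_⤳_ : Hypergraph → VSet → List Hypergraph
𝐇 ⤳ X = map (𝐇 ∣_) (components (𝐇 ∖ᴴ X))

-- An indexing with H₁ < ⋯ < Hₙ is necessarily the one by increasing
-- minimum, i.e. that of "components".
HereditarilyOrdered : Hypergraph → Set
HereditarilyOrdered 𝐇 =
  ∀ X → X ∈ subsets (vertices 𝐇) → X ≢ [] → AllPairs _≺_ (components (𝐇 ∖ᴴ X))

------------------------------------------------------------------------
-- Constructs

data Tree : Set where
  node : VSet → List Tree → Tree

root : Tree → VSet
root (node X _) = X

children : Tree → List Tree
children (node _ Ts) = Ts

mutual
  _≟ᵀ_ : DecidableEquality Tree
  node X Ss ≟ᵀ node Y Ts =
    map′ (λ (p , r) → cong₂ node p r) (λ { refl → refl , refl })
         ((X ≟ˢ Y) ×-dec (Ss ≟ᵀˢ Ts))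

  _≟ᵀˢ_ : DecidableEquality (List Tree)
  []       ≟ᵀˢ []       = yes refl
  []       ≟ᵀˢ (_ ∷ _)  = no λ ()
  (_ ∷ _)  ≟ᵀˢ []       = no λ ()
  (S ∷ Ss) ≟ᵀˢ (T ∷ Ts) =
    map′ (λ (p , r) → cong₂ _∷_ p r) (λ { refl → refl , refl })
         ((S ≟ᵀ T) ×-dec (Ss ≟ᵀˢ Ts))

infix 4 _∶_

-- The subtrees are listed in the order of the components, which gives each
-- non-planar tree exactly one representative: _≡_ is equality of constructs.
data _∶_ : Tree → Hypergraph → Set where
  whole : ∀ {𝐇} → vertices 𝐇 ≢ [] → node (vertices 𝐇) [] ∶ 𝐇
  graft : ∀ {𝐇 Y Ts} →
          Y ∈ subsets (vertices 𝐇) → Y ≢ [] → Y ≢ vertices 𝐇 →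
          Pointwise _∶_ Ts (𝐇 ⤳ Y) → node Y Ts ∶ 𝐇

-- The vertices occurring in a tree (not sorted): for T ∶ 𝐇, those of 𝐇.
mutual
  support : Tree → List ℤ
  support (node X Ts) = X ++ supports Ts

  supports : List Tree → List ℤ
  supports []       = []
  supports (T ∷ Ts) = support T ++ supports Ts

-- S ⊂[ X , Y ] T : T is obtained by contracting the edge of S from X to its
-- child Y.  Over a hereditarily ordered hypergraph the vertices below Y lie
-- between those of the neighbouring siblings of Y, so the concatenation
-- ls ++ ts ++ rs is again listed in the order of the components.
data _⊂[_,_]_ : Tree → VSet → VSet → Tree → Set where
  here  : ∀ {X Y} ls {ts rs} →
          node X (ls ++ node Y ts ∷ rs) ⊂[ X , Y ] node (X ∪ Y) (ls ++ ts ++ rs)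
  below : ∀ {X Y Z S T} ls {rs} → S ⊂[ X , Y ] T →
          node Z (ls ++ S ∷ rs) ⊂[ X , Y ] node Z (ls ++ T ∷ rs)

_⋖[_]_ : Tree → Hypergraph → Tree → Set
S ⋖[ 𝐇 ] S′ = S ∶ 𝐇 × S′ ∶ 𝐇 ×
  ∃₂ λ U V → V ≺ U × (S ⊂[ U , V ] S′ ⊎ S′ ⊂[ V , U ] S)

_≤[_]_ : Tree → Hypergraph → Tree → Set
S ≤[ 𝐇 ] T = Star _⋖[ 𝐇 ]_ S T

-- restrict C 𝐊 is C⌈𝐊; restrictIn Cs 𝐊 restricts the member of Cs whose
-- vertices contain those of 𝐊 (its first clause is never reached when C
-- and 𝐊 are as in the definition of restriction).
mutual
  restrict : Tree → Hypergraph → Tree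
  restrict (node X [])          𝐊 = node (vertices 𝐊) []
  restrict (node X Cs@(_ ∷ _)) 𝐊 =
    if null (X ∩ vertices 𝐊)
    then restrictIn Cs 𝐊
    else node (X ∩ vertices 𝐊) (map (restrictIn Cs) (𝐊 ⤳ (X ∩ vertices 𝐊)))

  restrictIn : List Tree → Hypergraph → Tree
  restrictIn []       𝐊 = node (vertices 𝐊) []
  restrictIn (C ∷ Cs) 𝐊 =
    if does (vertices 𝐊 ⊆? support C) then restrict C 𝐊 else restrictIn Cs 𝐊

------------------------------------------------------------------------
-- Teams and clans

record IsUniverse {u} (𝔘 : Pred Hypergraph u) : Set u where
  field
    isHypergraph        : ∀ {𝐇} → 𝔘 𝐇 → IsHypergraph 𝐇
    connected           : ∀ {𝐇} → 𝔘 𝐇 → Connected 𝐇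
    hereditarilyOrdered : ∀ {𝐇} → 𝔘 𝐇 → HereditarilyOrdered 𝐇

record Team : Set where
  constructor mkTeam
  field
    {arity} : ℕ
    parts   : Vec Hypergraph arity
    coord   : Hypergraph

record IsOrderedStrictTeam {u} (𝔘 : Pred Hypergraph u) (τ : Team) : Set u where
  open Team τ
  field
    parts-in-𝔘 : Vec.All 𝔘 parts
    coord-in-𝔘 : 𝔘 coord
    disjoint   : Vec.AllPairs (λ 𝐇ₐ 𝐇ᵦ → Disjoint (vertices 𝐇ₐ) (vertices 𝐇ᵦ)) parts
    covering   : ∀ {x} → x ∈ vertices coord ⇔ Vec.Any (λ 𝐇ₐ → x ∈ vertices 𝐇ₐ) parts
    ordered    : Vec.AllPairs (λ 𝐇ₐ 𝐇ᵦ → vertices 𝐇ₐ ≺ vertices 𝐇ᵦ) parts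
    strict     : Vec.All (λ 𝐇ₐ → ∀ K → K ∈ subsets (vertices 𝐇ₐ) → K ≢ [] →
                                 ConnectedIn 𝐇ₐ K → ConnectedIn coord K) parts

-- The union X_B of the X_b with b ∈ B; the other entries of Xs are ignored.
⋃[_]_ : ∀ {p} → Subset p → Vec VSet p → VSet
⋃[ [] ]          []       = []
⋃[ inside ∷ B ]  (X ∷ Xs) = X ∪ (⋃[ B ] Xs)
⋃[ outside ∷ B ] (X ∷ Xs) = ⋃[ B ] Xs

-- The hypergraphs 𝐇_ã for ã ∈ Ã = (A ∖ B) ∪ { (b , i) }, in increasing order.
teamPieces : ∀ {p} → Vec Hypergraph p → Subset p → Vec VSet p → List Hypergraph
teamPieces []       []            []       = []
teamPieces (𝐇 ∷ 𝐇s) (inside ∷ B)  (X ∷ Xs) = (𝐇 ⤳ X) ++ teamPieces 𝐇s B Xs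
teamPieces (𝐇 ∷ 𝐇s) (outside ∷ B) (X ∷ Xs) = 𝐇 ∷ teamPieces 𝐇s B Xs

inducedTeams : (τ : Team) → Subset (Team.arity τ) → Vec VSet (Team.arity τ) → List Team
inducedTeams (mkTeam 𝐇s 𝐇) B Xs = map team (𝐇 ⤳ (⋃[ B ] Xs))
  where
  team : Hypergraph → Team
  team 𝐇ᵢ = mkTeam (fromList (filter (λ 𝐊 → vertices 𝐊 ⊆? vertices 𝐇ᵢ)
                                     (teamPieces 𝐇s B Xs)))
                   𝐇ᵢ

record IsOrderedStrictClan {u x} (𝔘 : Pred Hypergraph u) (Ξ : Pred Team x) : Set (u ⊔ x) where
  field
    teams  : ∀ {τ} → Ξ τ → IsOrderedStrictTeam 𝔘 τ
    closed : ∀ {τ} → Ξ τ → let open Team τ in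
             (B : Subset arity) → Sub.Nonempty B → (Xs : Vec VSet arity) →
             (∀ b → b Sub.∈ B → lookup Xs b ∈ subsets (vertices (lookup parts b))
                                × lookup Xs b ≢ []) →
             All Ξ (inducedTeams τ B Xs)

replaceAt : ∀ {p} → Vec Hypergraph p → Fin p → List Hypergraph → List Hypergraph
replaceAt (_ ∷ 𝐇s) zero    𝐊s = 𝐊s ++ toList 𝐇s
replaceAt (𝐇 ∷ 𝐇s) (suc a) 𝐊s = 𝐇 ∷ replaceAt 𝐇s a 𝐊s

substitute : (τ : Team) → Fin (Team.arity τ) → Team → Team
substitute τ a₀ τ′ =
  mkTeam (fromList (replaceAt (Team.parts τ) a₀ (toList (Team.parts τ′)))) (Team.coord τ)

Associative : ∀ {x} → Pred Team x → Set x
Associative Ξ = ∀ {τ τ′} → Ξ τ → (a₀ : Fin (Team.arity τ)) → Ξ τ′ →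
  Team.coord τ′ ≡ lookup (Team.parts τ) a₀ → Ξ (substitute τ a₀ τ′)

-- The number μ^τ(U).
mutual
  μ : Team → Tree → ℕ
  μ τ (node X Us) = (∣ B′ ∣ ∸ 1) + μs (inducedTeams τ B′ Xs) Us
    where
    open Team τ
    B′ : Subset arity
    B′ = Vec.map (λ 𝐇ₐ → not (null (X ∩ vertices 𝐇ₐ))) parts
    Xs : Vec VSet arity
    Xs = Vec.map (λ 𝐇ₐ → X ∩ vertices 𝐇ₐ) parts

  μs : List Team → List Tree → ℕ
  μs (τ ∷ τs) (U ∷ Us) = μ τ U + μs τs Us
  μs _        _        = 0

------------------------------------------------------------------------
-- Delegations

-- The participants are the pairs (𝐇ₐ , Cₐ), with Cₐ ∶ 𝐇ₐ.
record Delegation : Set where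
  constructor mkDelegation
  field
    {arity}      : ℕ
    participants : Vec (Hypergraph × Tree) arity
    coord        : Hypergraph

  team : Team
  team = mkTeam (Vec.map proj₁ participants) coord

  roots : Vec VSet arity
  roots = Vec.map (root ∘ proj₂) participants

record IsDelegation {x} (Ξ : Pred Team x) (δ : Delegation) : Set x where
  open Delegation δ
  field
    team-in-Ξ  : Ξ team
    constructs : Vec.All (λ (𝐇ₐ , Cₐ) → Cₐ ∶ 𝐇ₐ) participants

pieces : ∀ {p} → Vec (Hypergraph × Tree) p → Subset p → List (Hypergraph × Tree)
pieces []             []            = []
pieces ((𝐇 , C) ∷ Ps) (inside ∷ B)  =
  zip (𝐇 ⤳ root C) (children C) ++ pieces Ps B
pieces ((𝐇 , C) ∷ Ps) (outside ∷ B) = (𝐇 , C) ∷ pieces Ps B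

-- δ₁ᴮ , … , δₙᴮ
induced : (δ : Delegation) → Subset (Delegation.arity δ) → List Delegation
induced δ@(mkDelegation Ps 𝐇) B = map delegation (𝐇 ⤳ (⋃[ B ] Delegation.roots δ))
  where
  delegation : Hypergraph → Delegation
  delegation 𝐇ᵢ =
    mkDelegation (fromList (filter (λ (𝐊 , _) → vertices 𝐊 ⊆? vertices 𝐇ᵢ) (pieces Ps B))) 𝐇ᵢ

first last : ∀ {p} → Subset p
first {zero}  = []
first {suc p} = ⁅ zero ⁆
last {zero}   = []
last {suc p}  = ⁅ fromℕ p ⁆

-- The recursions over induced delegations below are run with a bound on
-- their depth.  Each coordinating hypergraph 𝐇ᵢᴮ is non-empty and has
-- strictly fewer vertices than 𝐇, so with the number of vertices of 𝐇 as
-- bound the clauses for bound zero are never reached.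
size : Delegation → ℕ
size = length ∘ vertices ∘ Delegation.coord

mutual
  slashN : ℕ → Delegation → Tree
  slashN n δ = slashBN n δ last

  slashBN : ℕ → (δ : Delegation) → Subset (Delegation.arity δ) → Tree
  slashBN zero    δ B = node [] []
  slashBN (suc n) δ B = node (⋃[ B ] Delegation.roots δ) (map (slashN n) (induced δ B))

mutual
  backslashN : ℕ → Delegation → Tree
  backslashN n δ = backslashBN n δ first

  backslashBN : ℕ → (δ : Delegation) → Subset (Delegation.arity δ) → Tree
  backslashBN zero    δ B = node [] []
  backslashBN (suc n) δ B = node (⋃[ B ] Delegation.roots δ) (map (backslashN n) (induced δ B))

-- /(δ) , \(δ) , /ᴮ(δ) and \_B(δ)
slash backslash : Delegation → Tree
slash     δ = slashN (size δ) δ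
backslash δ = backslashN (size δ) δ

slashB backslashB : (δ : Delegation) → Subset (Delegation.arity δ) → Tree
slashB     δ = slashBN (size δ) δ
backslashB δ = backslashBN (size δ) δ

allSubsets : ∀ p → List (Subset p)
allSubsets zero    = [ [] ]
allSubsets (suc p) = map (inside ∷_) (allSubsets p) ++ map (outside ∷_) (allSubsets p)

nonemptySubsets : ∀ p → List (Subset p)
nonemptySubsets p = filter nonempty? (allSubsets p)

-- The scalars only enter through sums and products, so they may come from
-- any commutative ring; the real numbers are a special case.
module Products {c ℓ} (R : CommutativeRing c ℓ) (q : CommutativeRing.Carrier R) where
  open CommutativeRing R using (Carrier; _≈_; 0#; 1#; semiring)
    renaming (_+_ to _⊕_; _*_ to _⊗_)
  open import Algebra.Properties.Semiring.Exp semiring using (_^_)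

  -- Formal linear combinations of trees; two of them are the same vector
  -- when their coefficients agree.
  FormalSum : Set c
  FormalSum = List (Carrier × Tree)

  coefficient : Tree → FormalSum → Carrier
  coefficient U []            = 0#
  coefficient U ((a , T) ∷ s) = (if does (T ≟ᵀ U) then a else 0#) ⊕ coefficient U s

  infix 4 _≋_

  _≋_ : FormalSum → FormalSum → Set ℓ
  s ≋ t = ∀ U → coefficient U s ≈ coefficient U t

  scale : Carrier → FormalSum → FormalSum
  scale a = map λ (b , T) → a ⊗ b , T

  tensor : List FormalSum → List (Carrier × List Tree)
  tensor []       = [ 1# , [] ]
  tensor (s ∷ ss) =
    cartesianProductWith (λ (a , T) (b , Ts) → a ⊗ b , T ∷ Ts) s (tensor ss)

  -- The multilinear extension of (T₁ , … , Tₙ) ↦ X(T₁ , … , Tₙ).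
  graftSum : VSet → List FormalSum → FormalSum
  graftSum X ss = map (λ (a , Ts) → a , node X Ts) (tensor ss)

  mutual
    starN : ℕ → Delegation → FormalSum
    starN n δ = concatMap (λ B → scale (q ^ (∣ B ∣ ∸ 1)) (starBN n δ B))
                          (nonemptySubsets (Delegation.arity δ))

    starBN : ℕ → (δ : Delegation) → Subset (Delegation.arity δ) → FormalSum
    starBN zero    δ B = []
    starBN (suc n) δ B = graftSum (⋃[ B ] Delegation.roots δ) (map (starN n) (induced δ B))

  -- ∗(δ) and ∗_B(δ)
  star : Delegation → FormalSum
  star δ = starN (size δ) δ

  starB : (δ : Delegation) → Subset (Delegation.arity δ) → FormalSum
  starB δ = starBN (size δ) δ

  -- s is the finite sum of the terms a(U) U over all trees U satisfying P.
  record IsSumOver (P : Tree → Set) (a : Tree → Carrier) (s : FormalSum) : Set (c ⊔ ℓ) where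
    field
      indices  : List Tree
      unique   : Unique indices
      complete : ∀ {U} → U ∈ indices ⇔ P U
      equal    : s ≋ map (λ U → a U , U) indices

  module _ (δ : Delegation) where
    open Delegation δ

    RestrictsTo : Tree → Set
    RestrictsTo U = Vec.All (λ (𝐇ₐ , Cₐ) → restrict U 𝐇ₐ ≡ Cₐ) participants

    -- s is ∗⌈(δ), resp. ∗≤(δ).
    Is-star⌈ Is-star≤ : FormalSum → Set (c ⊔ ℓ)
    Is-star⌈ = IsSumOver (λ U → U ∶ coord × RestrictsTo U) (λ U → q ^ μ team U)
    Is-star≤ = IsSumOver
      (λ U → U ∶ coord × slash δ ≤[ coord ] U × U ≤[ coord ] backslash δ)
      (λ U → q ^ μ team U)

    -- s is ∗_B⌈(δ), resp. ∗_B≤(δ).  If root(U) = X_B then B′ = B in the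
    -- definition of μ, hence ∣ B ∣ ≤ μ^τ(U) + 1 and the subtraction is exact.
    Is-starB⌈ Is-starB≤ : Subset arity → FormalSum → Set (c ⊔ ℓ)
    Is-starB⌈ B = IsSumOver
      (λ U → U ∶ coord × root U ≡ ⋃[ B ] roots × RestrictsTo U)
      (λ U → q ^ ((μ team U + 1) ∸ ∣ B ∣))
    Is-starB≤ B = IsSumOver
      (λ U → U ∶ coord × slashB δ B ≤[ coord ] U × U ≤[ coord ] backslashB δ B)
      (λ U → q ^ ((μ team U + 1) ∸ ∣ B ∣))

{-# OPTIONS --safe #-}

-- For a construct U and a connected set e of vertices, let top U e be the
-- intersection of e with the node of U closest to the root that meets e.  A
-- construct is determined by its values top U e, and the restriction of U to
-- 𝐊 is the construct of 𝐊 with the values top U e for e connected in 𝐊.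
--
-- Hence U restricts to all Cₐ iff its root is some X_B and its subtrees
-- restrict in the same way to the members of the induced delegations δᵢᴮ, so
-- unfolding ∗(δ) lists every such U exactly once, with coefficient q^μ(U).
--
-- A flip upwards replaces top U e = A either by A together with smaller
-- elements, or by A without some of its largest elements.  This generates a
-- partial order on non-empty sets, so top is constant on an interval whose
-- endpoints have the same top, and all U between /(δ) and \(δ) restrict to
-- the Cₐ.
--
-- Conversely, flips that merge or split two nodes with vertices in different
-- 𝐇ₐ do not change the restrictions.  Let U restrict to all Cₐ, with root
-- X_B, and let X₁ be the root of C₁.  If 1 ∉ B, then by induction the subtrees
-- of U can be raised to \(δᵢᴮ); one of these has root X₁, which is merged
-- into X_B.  If 1 ∈ B, the roots X_b with b ∈ B ∖ {1} are split off below the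
-- root by decreasing b, until the root is X₁ and induction raises the subtrees
-- to those of \(δ).  The path down to /(δ) is obtained symmetrically.

module Submission where

open import Defs
open import Algebra.Bundles using (CommutativeRing)
import Data.Bool as Bool
open import Data.Bool using (Bool; true; false; if_then_else_; not)
open import Data.Empty using (⊥; ⊥-elim)
open import Data.Fin using (Fin; zero; suc; fromℕ)
open import Data.Fin.Subset using (Subset; Nonempty; inside; outside; ⁅_⁆)
import Data.Fin.Subset as Sub
import Data.Fin.Subset.Properties as Sub
open import Data.Fin.Subset.Properties using (nonempty?)
import Data.Fin as Fin
import Data.Fin.Properties as Fin
open import Data.Integer as ℤ using (ℤ)
import Data.Integer.Properties as ℤ
open import Data.List using (List; []; _∷_; [_]; _++_; map; filter; length; null;
  concatMap; cartesianProductWith; zip)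
open import Data.List.Membership.DecPropositional ℤ._≟_ using (_∈?_)
open import Data.List.Membership.Propositional using (_∈_; _∉_; find; lose)
open import Data.List.Membership.Propositional.Properties
import Data.List as List
import Data.List.Properties as List
open import Data.List.Relation.Binary.Pointwise as Pointwise using (Pointwise; []; _∷_)
import Data.List.Relation.Binary.Permutation.Propositional as Perm
import Data.List.Relation.Binary.Permutation.Propositional.Properties as Perm
import Data.List.Relation.Binary.Sublist.Propositional as Sublist
import Data.List.Relation.Binary.Sublist.Propositional.Properties as Sublist
import Data.List.Relation.Binary.Sublist.Heterogeneous.Properties as SublistHet
open import Data.List.Relation.Binary.Subset.DecPropositional ℤ._≟_ using (_⊆?_)
open import Data.List.Relation.Binary.Subset.Propositional using (_⊆_)
open import Data.List.Relation.Unary.All as All using (All; []; _∷_; all?)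
import Data.List.Relation.Unary.All.Properties as All
open import Data.List.Relation.Unary.AllPairs as AllPairs using (AllPairs; []; _∷_)
import Data.List.Relation.Unary.AllPairs.Properties as AllPairs
open import Data.List.Relation.Unary.Any using (Any; here; there; any?)
open import Data.List.Relation.Unary.Unique.Propositional using (Unique)
import Data.List.Relation.Unary.Unique.Propositional.Properties as Unique
open import Data.Nat as ℕ using (ℕ; zero; suc; _+_; _∸_; _≤_; _<_; z≤n; s≤s)
import Data.Nat.Properties as ℕ
open import Data.Product using (_×_; _,_; proj₁; proj₂; ∃; ∃₂; map₂; uncurry)
open import Data.Sum as Sum using (_⊎_; inj₁; inj₂; [_,_]′)
open import Data.Vec as Vec using (Vec; []; _∷_; fromList; lookup)
import Data.Vec.Properties as Vec
import Data.Vec.Relation.Unary.All as VecAll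
import Data.Vec.Relation.Unary.All.Properties as VecAll
import Data.Vec.Relation.Unary.AllPairs as VecAllPairs
import Data.Vec.Relation.Unary.Any as VecAny
open import Function using (_∘_; id; case_of_; flip)
open import Function.Bundles using (mk⇔; Equivalence)
open import Level as Level using (Level; 0ℓ)
open import Relation.Binary.Construct.Closure.ReflexiveTransitive as Star
  using (Star; ε; _◅_; _◅◅_)
open import Relation.Binary.Core using (Rel)
open import Relation.Binary.Definitions using (tri<; tri≈; tri>)
open import Relation.Binary.PropositionalEquality hiding ([_])
open import Relation.Nullary using (¬_; Dec; yes; no; does; ¬?; _×-dec_)
open import Relation.Nullary.Decidable using (decidable-stable)
open import Relation.Unary using (Pred; Decidable)

-- `restrict` searches among subtrees and rebuilds its result, so it does not pass readily to
-- subtrees and induced delegations. Agreement of `top` on tubes does, because the tubes of a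
-- component or of a piece are tubes of the larger hypergraph. The proof therefore works with
-- `Agrees` and returns to `restrict` only when the sums are identified.
--
-- Trees list their subtrees in the order of the components, so a contraction is well typed only if
-- the components inside the merged child take its place in that order. This uses the hereditary
-- order of the components themselves, which the clan supplies because each of them is the
-- coordinating hypergraph of an induced team.
--
-- The paths to the two extreme constructs are mirror images. Whatever depends on the direction is
-- collected in `Direction`, and the argument for the paths is given once.

private variable
  ℓa ℓr ℓp : Level
  A : Set ℓa
  R : Rel A ℓr
  x : ℤ
  X Y Z e : VSet
  𝐇 𝐊 𝐋 : Hypergraph
  S T : Tree
  Ss Ts : List Tree
  n : ℕ

-- Finite sets

nonempty-∃ : {xs : List A} → xs ≢ [] → ∃ (_∈ xs)
nonempty-∃ {xs = []}     ne = ⊥-elim (ne refl)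
nonempty-∃ {xs = x ∷ xs} ne = x , here refl

∈⇒≢[] : {y : A} {xs : List A} → y ∈ xs → xs ≢ []
∈⇒≢[] () refl

-- Asymmetry forces the two heads to coincide and excludes repetitions. It is asked of members only,
-- because `_≺_` is asymmetric on non-empty sets but not in general; `⤳-splice` compares lists of
-- components in this way.
AllPairs-ext : {xs ys : List A} → AllPairs R xs → AllPairs R ys →
  (∀ {x y} → x ∈ xs → y ∈ xs → R x y → ¬ R y x) → xs ⊆ ys → ys ⊆ xs → xs ≡ ys
AllPairs-ext []  []       asym ⊆ ⊇ = refl
AllPairs-ext []  (_ ∷ _)  asym ⊆ ⊇ with () ← ⊇ (here refl)
AllPairs-ext (_ ∷ _) []   asym ⊆ ⊇ with () ← ⊆ (here refl)
AllPairs-ext {R = R} {xs = x ∷ xs} {ys = y ∷ ys} (px ∷ pxs) (py ∷ pys) asym ⊆ ⊇ =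
  aux (⊆ (here refl)) (⊇ (here refl))
  where
  irr : ∀ {z} → z ∈ x ∷ xs → ¬ R z z
  irr z∈ r = asym z∈ z∈ r r
  aux : x ∈ y ∷ ys → y ∈ x ∷ xs → x ∷ xs ≡ y ∷ ys
  aux (there x∈ys) (there y∈xs) =
    ⊥-elim (asym (here refl) (there y∈xs) (All.lookup px y∈xs) (All.lookup py x∈ys))
  aux (here refl) _ = tails refl
    where
    tails : x ≡ y → x ∷ xs ≡ y ∷ ys
    tails refl = cong (x ∷_) (AllPairs-ext pxs pys (λ x∈ y∈ → asym (there x∈) (there y∈))
      (λ z∈ → drop (All.lookup px z∈) (there z∈) (⊆ (there z∈)))
      (λ z∈ → drop (All.lookup py z∈) (⊇ (there z∈)) (⊇ (there z∈))))
      where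
      drop : ∀ {z zs} → R x z → z ∈ x ∷ xs → z ∈ x ∷ zs → z ∈ zs
      drop r z∈ (here refl) = ⊥-elim (irr (here refl) r)
      drop r z∈ (there z∈′) = z∈′
  aux (there x∈ys) (here refl) = ⊥-elim (irr (here refl) (All.lookup py x∈ys))

Increasing-ext : Increasing X → Increasing Y → X ⊆ Y → Y ⊆ X → X ≡ Y
Increasing-ext iX iY = AllPairs-ext iX iY (λ _ _ → ℤ.<-asym)

∈-∩⁺ : x ∈ X → x ∈ Y → x ∈ X ∩ Y
∈-∩⁺ {X = X} x∈X x∈Y = ∈-filter⁺ (_∈? X) x∈Y x∈X

∈-∩⁻ : ∀ X Y → x ∈ X ∩ Y → x ∈ X × x ∈ Y
∈-∩⁻ X Y x∈ = let x∈Y , x∈X = ∈-filter⁻ (_∈? X) {xs = Y} x∈ in x∈X , x∈Y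

∩-increasing : ∀ X → Increasing Y → Increasing (X ∩ Y)
∩-increasing X = AllPairs.filter⁺ (_∈? X)

∈-∖⁺ : ∀ X → x ∈ Y → x ∉ X → x ∈ Y ∖ X
∈-∖⁺ X = ∈-filter⁺ (λ x → ¬? (x ∈? X))

∈-∖⁻ : ∀ Y X → x ∈ Y ∖ X → x ∈ Y × x ∉ X
∈-∖⁻ Y X = ∈-filter⁻ (λ x → ¬? (x ∈? X)) {xs = Y}

∖-increasing : ∀ X → Increasing Y → Increasing (Y ∖ X)
∖-increasing X = AllPairs.filter⁺ (λ x → ¬? (x ∈? X))

∩-absorb : Increasing X → Increasing Y → X ⊆ Y → X ∩ Y ≡ X
∩-absorb {X} {Y} iX iY X⊆Y = Increasing-ext (∩-increasing X iY) iX
  (λ x∈ → proj₁ (∈-∩⁻ X Y x∈)) (λ x∈ → ∈-∩⁺ x∈ (X⊆Y x∈))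

∩-[]⁺ : (∀ {x} → x ∈ Y → x ∉ X) → X ∩ Y ≡ []
∩-[]⁺ {Y} {X} dis with X ∩ Y in eq
... | []    = refl
... | z ∷ _ = let z∈X , z∈Y = ∈-∩⁻ X Y (subst (z ∈_) (sym eq) (here refl)) in ⊥-elim (dis z∈Y z∈X)

∩-[]⁻ : X ∩ Y ≡ [] → x ∈ Y → x ∉ X
∩-[]⁻ {x = x} eq x∈Y x∈X with () ← subst (x ∈_) eq (∈-∩⁺ x∈X x∈Y)

subsets⁻ : X ∈ subsets Y → X Sublist.⊆ Y
subsets⁻ {Y = []} (here refl) = Sublist.[]
subsets⁻ {Y = y ∷ Y} X∈ with ∈-++⁻ (map (y ∷_) (subsets Y)) X∈
... | inj₂ X∈Y = y Sublist.∷ʳ subsets⁻ X∈Y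
... | inj₁ X∈m with ∈-map⁻ (y ∷_) X∈m
...   | _ , X∈Y , refl = refl Sublist.∷ subsets⁻ X∈Y

subsets⁺ : X Sublist.⊆ Y → X ∈ subsets Y
subsets⁺ Sublist.[] = here refl
subsets⁺ {Y = y ∷ Y} (_ Sublist.∷ʳ s) = ∈-++⁺ʳ (map (y ∷_) (subsets Y)) (subsets⁺ s)
subsets⁺ (refl Sublist.∷ s) = ∈-++⁺ˡ (∈-map⁺ _ (subsets⁺ s))

subsets-⊆ : X ∈ subsets Y → X ⊆ Y
subsets-⊆ X∈ = Sublist.Any-resp-⊆ (subsets⁻ X∈)

sublist-AllPairs : {xs ys : List A} → xs Sublist.⊆ ys → AllPairs R ys → AllPairs R xs
sublist-AllPairs Sublist.[] [] = []
sublist-AllPairs (_ Sublist.∷ʳ s) (_ ∷ q) = sublist-AllPairs s q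
sublist-AllPairs (refl Sublist.∷ s) (q ∷ qs) = Sublist.All-resp-⊆ s q ∷ sublist-AllPairs s qs

subsets-increasing : Increasing Y → X ∈ subsets Y → Increasing X
subsets-increasing iY X∈ = sublist-AllPairs (subsets⁻ X∈) iY

∈-subsets : Increasing X → Increasing Y → X ⊆ Y → X ∈ subsets Y
∈-subsets {X} {Y} iX iY X⊆Y =
  subst (_∈ subsets Y) (∩-absorb iX iY X⊆Y) (subsets⁺ (Sublist.filter-⊆ (_∈? X) Y))

subsets-unique : Increasing X → Unique (subsets X)
subsets-unique [] = [] ∷ []
subsets-unique {x ∷ X} (px ∷ iX) = Unique.++⁺ (Unique.map⁺ List.∷-injectiveʳ ih) ih dis
  where
  ih = subsets-unique iX
  dis : ∀ {Z} → ¬ (Z ∈ map (x ∷_) (subsets X) × Z ∈ subsets X)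
  dis (Z∈m , Z∈) with ∈-map⁻ (x ∷_) Z∈m
  ... | _ , _ , refl = ℤ.<-irrefl refl (All.lookup px (subsets-⊆ Z∈ (here refl)))

length-⊆ : Increasing X → Increasing Y → X ⊆ Y → length X ≤ length Y
length-⊆ {X} {Y} iX iY X⊆Y =
  SublistHet.length-mono-≤ (subsets⁻ {X} {Y} (∈-subsets iX iY X⊆Y))

length-⊂ : Increasing X → Increasing Y → X ⊆ Y → x ∈ Y → x ∉ X → length X < length Y
length-⊂ {X} {Y} iX iY X⊆Y x∈Y x∉X with ℕ.m≤n⇒m<n∨m≡n (length-⊆ iX iY X⊆Y)
... | inj₁ lt = lt
... | inj₂ eq = ⊥-elim (x∉X (subst (_ ∈_) (sym X≡Y) x∈Y))
  where
  X≡Y : X ≡ Y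
  X≡Y = Pointwise.Pointwise-≡⇒≡ (SublistHet.toPointwise eq (subsets⁻ {X} {Y} (∈-subsets iX iY X⊆Y)))

∈-∪⁻ : ∀ X Y → x ∈ X ∪ Y → x ∈ X ⊎ x ∈ Y
∈-∪⁻ X Y x∈ = ∈-++⁻ X (Perm.∈-resp-↭ (Perm.merge-↭ ℤ._≤?_ X Y) x∈)

∈-∪⁺ : ∀ X Y → x ∈ X ⊎ x ∈ Y → x ∈ X ∪ Y
∈-∪⁺ X Y x∈ = Perm.∈-resp-↭ (Perm.↭-sym (Perm.merge-↭ ℤ._≤?_ X Y)) ([ ∈-++⁺ˡ , ∈-++⁺ʳ X ]′ x∈)

∪-increasing : Increasing X → Increasing Y → (∀ {x} → x ∈ X → x ∉ Y) → Increasing (X ∪ Y)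
∪-increasing [] iY dis = iY
∪-increasing (px ∷ iX) [] dis = px ∷ iX
∪-increasing {x ∷ X} {y ∷ Y} (px ∷ iX) (py ∷ iY) dis = aux (x ℤ.≤? y)
  (∪-increasing iX (py ∷ iY) (dis ∘ there)) (∪-increasing (px ∷ iX) iY (λ q → dis q ∘ there))
  where
  aux : (d : Dec (x ℤ.≤ y)) → Increasing (X ∪ (y ∷ Y)) → Increasing ((x ∷ X) ∪ Y) →
    Increasing (if does d then x ∷ (X ∪ (y ∷ Y)) else y ∷ ((x ∷ X) ∪ Y))
  aux (yes x≤y) i₁ _ = All.tabulate (lower ∘ ∈-∪⁻ X (y ∷ Y)) ∷ i₁
    where
    x<y : x ℤ.< y
    x<y = ℤ.≤∧≢⇒< x≤y λ { refl → dis (here refl) (here refl) }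
    lower : ∀ {z} → z ∈ X ⊎ z ∈ y ∷ Y → x ℤ.< z
    lower (inj₁ q)           = All.lookup px q
    lower (inj₂ (here refl)) = x<y
    lower (inj₂ (there q))   = ℤ.<-trans x<y (All.lookup py q)
  aux (no x≰y) _ i₂ = All.tabulate (lower ∘ ∈-∪⁻ (x ∷ X) Y) ∷ i₂
    where
    y<x : y ℤ.< x
    y<x = ℤ.≰⇒> x≰y
    lower : ∀ {z} → z ∈ x ∷ X ⊎ z ∈ Y → y ℤ.< z
    lower (inj₂ q)           = All.lookup py q
    lower (inj₁ (here refl)) = y<x
    lower (inj₁ (there q))   = ℤ.<-trans y<x (All.lookup px q)

≺-lookup : ∀ {y z} → Y ≺ Z → y ∈ Y → z ∈ Z → y ℤ.< z
≺-lookup Y≺Z y∈ z∈ = All.lookup (All.lookup Y≺Z y∈) z∈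

≺-tabulate : (∀ {y z} → y ∈ Y → z ∈ Z → y ℤ.< z) → Y ≺ Z
≺-tabulate f = All.tabulate (λ y∈ → All.tabulate (f y∈))

≺-mono : ∀ {X′ Y′} → X′ ⊆ X → Y′ ⊆ Y → X ≺ Y → X′ ≺ Y′
≺-mono ⊆X ⊆Y X≺Y = ≺-tabulate (λ y∈ z∈ → ≺-lookup X≺Y (⊆X y∈) (⊆Y z∈))

filter-filter : ∀ {q} {P : Pred A ℓp} {Q : Pred A q} (P? : Decidable P) (Q? : Decidable Q) →
  (∀ {x} → Q x → P x) → ∀ xs → filter Q? (filter P? xs) ≡ filter Q? xs
filter-filter P? Q? Q⇒P [] = refl
filter-filter P? Q? Q⇒P (x ∷ xs) with P? x
... | yes px with does (Q? x)
...   | true  = cong (x ∷_) (filter-filter P? Q? Q⇒P xs)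
...   | false = filter-filter P? Q? Q⇒P xs
filter-filter P? Q? Q⇒P (x ∷ xs) | no ¬px with Q? x
...   | yes qx = ⊥-elim (¬px (Q⇒P qx))
...   | no _   = filter-filter P? Q? Q⇒P xs

-- Connected sets

-- Connectedness of 𝐇_e, a bipartition of e being given by membership in an
-- arbitrary list S.
Linked : Hypergraph → VSet → Set
Linked 𝐇 e = ∀ (S : VSet) →
  (∀ {Z} → Z ∈ edges 𝐇 → Z ⊆ e → Z ⊆ S ⊎ (∀ {x} → x ∈ Z → x ∉ S)) →
  e ⊆ S ⊎ (∀ {x} → x ∈ e → x ∉ S)

linked⁺ : ConnectedIn 𝐇 e → Linked 𝐇 e
linked⁺ {𝐇} {e} conn S split = aux ((S ∩ e) ≟ˢ []) ((e ∖ (S ∩ e)) ≟ˢ [])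
  where
  aux : Dec (S ∩ e ≡ []) → Dec (e ∖ (S ∩ e) ≡ []) → e ⊆ S ⊎ (∀ {x} → x ∈ e → x ∉ S)
  aux (yes eq) _ = inj₂ (∩-[]⁻ eq)
  aux (no _) (yes eq) = inj₁ λ {x} x∈ → decidable-stable (x ∈? S) λ x∉S →
    case subst (x ∈_) eq (∈-∖⁺ (S ∩ e) x∈ (x∉S ∘ proj₁ ∘ ∈-∩⁻ S e)) of λ ()
  aux (no ne₁) (no ne₂) = ⊥-elim (conn (lose {P = Disconnects (𝐇 ∣ e)}
    (subsets⁺ (Sublist.filter-⊆ (_∈? S) e)) (ne₁ , ne₂ , All.tabulate side)))
    where
    side : ∀ {Z} → Z ∈ edges (𝐇 ∣ e) → Z ⊆ S ∩ e ⊎ Z ⊆ e ∖ (S ∩ e)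
    side Z∈ with ∈-filter⁻ (_⊆? e) {xs = edges 𝐇} Z∈
    ... | Z∈𝐇 , Z⊆e with split Z∈𝐇 Z⊆e
    ...   | inj₁ Z⊆S = inj₁ λ x∈ → ∈-∩⁺ (Z⊆S x∈) (Z⊆e x∈)
    ...   | inj₂ Z∉S = inj₂ λ x∈ → ∈-∖⁺ (S ∩ e) (Z⊆e x∈) (Z∉S x∈ ∘ proj₁ ∘ ∈-∩⁻ S e)

linked⁻ : Linked 𝐇 e → ConnectedIn 𝐇 e
linked⁻ {𝐇} {e} link any with find any
... | S , S∈ , S≢[] , S′≢[] , split = aux (link S side)
  where
  side : ∀ {Z} → Z ∈ edges 𝐇 → Z ⊆ e → Z ⊆ S ⊎ (∀ {x} → x ∈ Z → x ∉ S)
  side Z∈ Z⊆e = Sum.map₂ (λ Z⊆ x∈ → proj₂ (∈-∖⁻ e S (Z⊆ x∈)))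
    (All.lookup split (∈-filter⁺ (_⊆? e) Z∈ Z⊆e))
  aux : ¬ (e ⊆ S ⊎ (∀ {x} → x ∈ e → x ∉ S))
  aux (inj₁ e⊆S) = let _ , y∈ = nonempty-∃ S′≢[] ; y∈e , y∉S = ∈-∖⁻ e S y∈ in y∉S (e⊆S y∈e)
  aux (inj₂ dis) = let _ , y∈ = nonempty-∃ S≢[] in dis (subsets-⊆ S∈ y∈) y∈

-- Each of `X` and `Y` falls on one side of the bipartition, and the shared vertex `x` makes it the
-- same side. `W` may be any list with the members of `X ++ Y`, so its increasing enumeration can be
-- used.
linked-∪ : ∀ {W} → W ⊆ (X ++ Y) → X ⊆ W → Y ⊆ W → x ∈ X → x ∈ Y →
  Linked 𝐇 X → Linked 𝐇 Y → Linked 𝐇 W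
linked-∪ {X} {Y} {x} ⊆XY X⊆ Y⊆ x∈X x∈Y linkX linkY S split
  with linkX S (λ Z∈ Z⊆ → split Z∈ (X⊆ ∘ Z⊆)) | linkY S (λ Z∈ Z⊆ → split Z∈ (Y⊆ ∘ Z⊆))
... | inj₁ X⊆S | inj₁ Y⊆S = inj₁ λ u∈ → [ X⊆S , Y⊆S ]′ (∈-++⁻ X (⊆XY u∈))
... | inj₂ X∉S | inj₂ Y∉S = inj₂ λ u∈ → [ X∉S , Y∉S ]′ (∈-++⁻ X (⊆XY u∈))
... | inj₁ X⊆S | inj₂ Y∉S = ⊥-elim (Y∉S x∈Y (X⊆S x∈X))
... | inj₂ X∉S | inj₁ Y⊆S = ⊥-elim (X∉S x∈X (Y⊆S x∈Y))

linked-singleton : Linked 𝐇 [ x ]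
linked-singleton {x = x} S _ with x ∈? S
... | yes x∈S = inj₁ λ { (here refl) → x∈S }
... | no  x∉S = inj₂ λ { (here refl) → x∉S }

∣-∣ : X ⊆ Y → (𝐇 ∣ Y) ∣ X ≡ 𝐇 ∣ X
∣-∣ {X} {Y} {𝐇} X⊆Y =
  cong (hypergraph X) (filter-filter (_⊆? Y) (_⊆? X) (λ Z⊆X → X⊆Y ∘ Z⊆X) (edges 𝐇))

record Sorted (𝐇 : Hypergraph) : Set where
  constructor sorted
  field increasing : Increasing (vertices 𝐇)

-- The name is the usual one for connected sets in the theory of nestohedra; here the whole vertex
-- set is allowed. These are the sets at which constructs are compared through `top`.
record Tube (𝐇 : Hypergraph) (e : VSet) : Set where
  constructor tube
  field
    nonempty   : e ≢ []
    increasing : Increasing e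
    within     : e ⊆ vertices 𝐇
    connected  : ConnectedIn 𝐇 e

singleton-tube : x ∈ vertices 𝐇 → Tube 𝐇 [ x ]
singleton-tube {𝐇 = 𝐇} x∈ =
  tube (λ ()) ([] ∷ []) (λ { (here refl) → x∈ }) (linked⁻ {𝐇} (linked-singleton {𝐇 = 𝐇}))

-- Connected components

-- The working form of membership in `𝐇 ⤳ X`. Maximality is stated for tubes that share one vertex
-- with the component, not only for those that contain it; this is as strong as the definition
-- because the union of two intersecting tubes is a tube.
record Piece (𝐇 : Hypergraph) (X : VSet) (𝐊 : Hypergraph) : Set where
  field
    induced-on : 𝐊 ≡ 𝐇 ∣ vertices 𝐊
    isTube     : Tube 𝐇 (vertices 𝐊)
    avoids     : ∀ {x} → x ∈ vertices 𝐊 → x ∉ X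
    maximal    : ∀ {e x} → Tube 𝐇 e → (∀ {x} → x ∈ e → x ∉ X) → x ∈ vertices 𝐊 → x ∈ e → e ⊆ vertices 𝐊
  open Tube isTube public

  isSorted : Sorted 𝐊
  isSorted = sorted increasing

module _ {𝐇 : Hypergraph} (s𝐇 : Sorted 𝐇) where

  private
    V = vertices 𝐇
    i𝐇 = Sorted.increasing s𝐇

  piece⁻ : 𝐊 ∈ 𝐇 ⤳ X → Piece 𝐇 X 𝐊
  piece⁻ {X = X} 𝐊∈ with ∈-map⁻ (𝐇 ∣_) 𝐊∈
  ... | L , L∈ , refl with ∈-filter⁻ (isComponent? (𝐇 ∖ᴴ X)) {xs = subsets (V ∖ X)} L∈
  ...   | L∈sub , L≢[] , conn , max = record
    { induced-on = refl
    ; isTube     = tube L≢[] (subsets-increasing (∖-increasing X i𝐇) L∈sub)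
                        (proj₁ ∘ ∈-∖⁻ V X ∘ L⊆) connL
    ; avoids     = proj₂ ∘ ∈-∖⁻ V X ∘ L⊆
    ; maximal    = maximal
    }
    where
    L⊆ : L ⊆ V ∖ X
    L⊆ = subsets-⊆ L∈sub
    connL : ConnectedIn 𝐇 L
    connL = subst Connected (∣-∣ {𝐇 = 𝐇} L⊆) conn
    maximal : ∀ {e x} → Tube 𝐇 e → (∀ {x} → x ∈ e → x ∉ X) → x ∈ L → x ∈ e → e ⊆ L
    maximal {e} {x} t avoid x∈L x∈e y∈ = All.lookup max W∈ connW L⊆W (e⊆W y∈)
      where
      W = (L ++ e) ∩ (V ∖ X)
      W∈ : W ∈ subsets (V ∖ X)
      W∈ = subsets⁺ (Sublist.filter-⊆ (_∈? (L ++ e)) (V ∖ X))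
      e⊆W : e ⊆ W
      e⊆W z∈ = ∈-∩⁺ (∈-++⁺ʳ L z∈) (∈-∖⁺ X (Tube.within t z∈) (avoid z∈))
      L⊆W : L ⊆ W
      L⊆W z∈ = ∈-∩⁺ (∈-++⁺ˡ z∈) (L⊆ z∈)
      connW : ConnectedIn (𝐇 ∖ᴴ X) W
      connW = subst Connected (sym (∣-∣ {𝐇 = 𝐇} (subsets-⊆ W∈)))
        (linked⁻ {𝐇} (linked-∪ {𝐇 = 𝐇} (proj₁ ∘ ∈-∩⁻ (L ++ e) (V ∖ X)) L⊆W e⊆W x∈L x∈e
          (linked⁺ {𝐇} connL) (linked⁺ {𝐇} (Tube.connected t))))

  piece⁺ : Piece 𝐇 X 𝐊 → 𝐊 ∈ 𝐇 ⤳ X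
  piece⁺ {X} {𝐊} pc = subst (_∈ 𝐇 ⤳ X) (sym P.induced-on) (∈-map⁺ (𝐇 ∣_)
    (∈-filter⁺ (isComponent? (𝐇 ∖ᴴ X)) (∈-subsets P.increasing (∖-increasing X i𝐇) L⊆)
      (P.nonempty , subst Connected (sym (∣-∣ {𝐇 = 𝐇} L⊆)) P.connected , All.tabulate max)))
    where
    module P = Piece pc
    L = vertices 𝐊
    L⊆ : L ⊆ V ∖ X
    L⊆ x∈ = ∈-∖⁺ X (P.within x∈) (P.avoids x∈)
    max : ∀ {Y} → Y ∈ subsets (V ∖ X) → ConnectedIn (𝐇 ∖ᴴ X) Y → L ⊆ Y → Y ⊆ L
    max {Y} Y∈ conn L⊆Y = P.maximal
      (tube (∈⇒≢[] (L⊆Y z∈)) (subsets-increasing (∖-increasing X i𝐇) Y∈) (proj₁ ∘ ∈-∖⁻ V X ∘ Y⊆)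
            (subst Connected (∣-∣ {𝐇 = 𝐇} Y⊆) conn))
      (proj₂ ∘ ∈-∖⁻ V X ∘ Y⊆) z∈ (L⊆Y z∈)
      where
      Y⊆ : Y ⊆ V ∖ X
      Y⊆ = subsets-⊆ Y∈
      z∈ = proj₂ (nonempty-∃ P.nonempty)

  piece-∣ : Piece 𝐇 X 𝐊 → e ⊆ vertices 𝐊 → 𝐊 ∣ e ≡ 𝐇 ∣ e
  piece-∣ {𝐊 = 𝐊} {e = e} pc e⊆ = trans (cong (_∣ e) (Piece.induced-on pc)) (∣-∣ {𝐇 = 𝐇} e⊆)

  tube-up : Piece 𝐇 X 𝐊 → Tube 𝐊 e → Tube 𝐇 e
  tube-up pc (tube ne inc within conn) =
    tube ne inc (Piece.within pc ∘ within) (subst Connected (piece-∣ pc within) conn)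

  tube-down : Piece 𝐇 X 𝐊 → Tube 𝐇 e → e ⊆ vertices 𝐊 → Tube 𝐊 e
  tube-down pc (tube ne inc _ conn) e⊆ =
    tube ne inc e⊆ (subst Connected (sym (piece-∣ pc e⊆)) conn)

  piece-tube : Piece 𝐇 X 𝐊 → Tube 𝐊 (vertices 𝐊)
  piece-tube pc = tube-down pc (Piece.isTube pc) id

  piece-size : X ≢ [] → X ⊆ V → Piece 𝐇 X 𝐊 → length (vertices 𝐊) < length V
  piece-size ne X⊆ pc = let _ , x∈ = nonempty-∃ ne in
    length-⊂ (Piece.increasing pc) i𝐇 (Piece.within pc) (X⊆ x∈) (λ x∈𝐊 → Piece.avoids pc x∈𝐊 x∈)

  piece-unique : Piece 𝐇 X 𝐊 → Piece 𝐇 X 𝐋 → x ∈ vertices 𝐊 → x ∈ vertices 𝐋 → 𝐊 ≡ 𝐋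
  piece-unique pc qc x∈ x∈′ = trans P.induced-on (trans (cong (𝐇 ∣_) eq) (sym Q.induced-on))
    where
    module P = Piece pc
    module Q = Piece qc
    eq = Increasing-ext P.increasing Q.increasing
      (Q.maximal P.isTube P.avoids x∈′ x∈) (P.maximal Q.isTube Q.avoids x∈ x∈′)

  -- n bounds how often e can still be enlarged before it is maximal.
  private
    grow : ∀ n → length V ≤ length e + n → Tube 𝐇 e → (∀ {x} → x ∈ e → x ∉ X) →
      ∃ λ 𝐊 → 𝐊 ∈ 𝐇 ⤳ X × e ⊆ vertices 𝐊
    grow {e} {X} n bound t avoid = go n bound (any? better? (subsets (V ∖ X)))
      where
      Better : VSet → Set
      Better Y = ConnectedIn 𝐇 Y × e ⊆ Y × ¬ (Y ⊆ e)
      better? : Decidable Better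
      better? Y = connected? (𝐇 ∣ Y) ×-dec (e ⊆? Y) ×-dec ¬? (Y ⊆? e)
      module t = Tube t
      go : ∀ n → length V ≤ length e + n → Dec (Any Better (subsets (V ∖ X))) →
        ∃ λ 𝐊 → 𝐊 ∈ 𝐇 ⤳ X × e ⊆ vertices 𝐊
      go n bound (no none) = 𝐇 ∣ e , ∈-map⁺ (𝐇 ∣_) (∈-filter⁺ (isComponent? (𝐇 ∖ᴴ X))
        (∈-subsets t.increasing (∖-increasing X i𝐇) e⊆)
        (t.nonempty , subst Connected (sym (∣-∣ {𝐇 = 𝐇} e⊆)) t.connected , All.tabulate max)) , id
        where
        e⊆ : e ⊆ V ∖ X
        e⊆ x∈ = ∈-∖⁺ X (t.within x∈) (avoid x∈)
        max : ∀ {Y} → Y ∈ subsets (V ∖ X) → ConnectedIn (𝐇 ∖ᴴ X) Y → e ⊆ Y → Y ⊆ e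
        max {Y} Y∈ conn e⊆Y = decidable-stable (Y ⊆? e) λ Y⊈e →
          none (lose Y∈ (subst Connected (∣-∣ {𝐇 = 𝐇} (subsets-⊆ Y∈)) conn , e⊆Y , Y⊈e))
      go n bound (yes any) with find any
      ... | Y , Y∈ , connY , e⊆Y , Y⊈e = step n bound
        where
        incY = subsets-increasing (∖-increasing X i𝐇) Y∈
        Y⊆ = subsets-⊆ Y∈
        tY : Tube 𝐇 Y
        tY = tube (∈⇒≢[] (e⊆Y (proj₂ (nonempty-∃ t.nonempty)))) incY (proj₁ ∘ ∈-∖⁻ V X ∘ Y⊆) connY
        lt : length e < length Y
        lt with all? (_∈? e) Y
        ... | yes all = ⊥-elim (Y⊈e (All.lookup all))
        ... | no ¬all with find (All.¬All⇒Any¬ (_∈? e) Y ¬all)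
        ...   | y , y∈Y , y∉e = length-⊂ t.increasing incY e⊆Y y∈Y y∉e
        step : ∀ n → length V ≤ length e + n → ∃ λ 𝐊 → 𝐊 ∈ 𝐇 ⤳ X × e ⊆ vertices 𝐊
        step zero bound = ⊥-elim (ℕ.<⇒≱ lt (ℕ.≤-trans (length-⊆ incY i𝐇 (Tube.within tY))
          (subst (length V ≤_) (ℕ.+-identityʳ _) bound)))
        step (suc n) bound =
          let 𝐊 , 𝐊∈ , Y⊆𝐊 = grow n (ℕ.≤-trans (subst (length V ≤_) (ℕ.+-suc _ n) bound)
                                                 (ℕ.+-monoˡ-≤ n lt))
                                  tY (proj₂ ∘ ∈-∖⁻ V X ∘ Y⊆)
          in 𝐊 , 𝐊∈ , Y⊆𝐊 ∘ e⊆Y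

  abstract
   piece-⊇ : Tube 𝐇 e → (∀ {x} → x ∈ e → x ∉ X) → ∃ λ 𝐊 → 𝐊 ∈ 𝐇 ⤳ X × e ⊆ vertices 𝐊
   piece-⊇ {e} = grow (length V) (ℕ.m≤n+m (length V) (length e))

  ∖-nonempty-piece : x ∈ V → x ∉ X → ∃ λ 𝐊 → 𝐊 ∈ 𝐇 ⤳ X × x ∈ vertices 𝐊
  ∖-nonempty-piece x∈V x∉X =
    let 𝐊 , 𝐊∈ , ⊆𝐊 = piece-⊇ (singleton-tube x∈V) (λ { (here refl) → x∉X }) in
    𝐊 , 𝐊∈ , ⊆𝐊 (here refl)

  pieces-disjoint : ∀ X → AllPairs (λ 𝐊 𝐋 → ∀ {x} → x ∈ vertices 𝐊 → x ∉ vertices 𝐋) (𝐇 ⤳ X)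
  pieces-disjoint X = go (𝐇 ⤳ X) piece⁻
    (AllPairs.map⁺ (AllPairs.map (λ ne eq → ne (cong vertices eq))
      (Unique.filter⁺ (isComponent? (𝐇 ∖ᴴ X)) (subsets-unique (∖-increasing X i𝐇)))))
    where
    go : ∀ 𝐊s → (∀ {𝐊} → 𝐊 ∈ 𝐊s → Piece 𝐇 X 𝐊) → Unique 𝐊s →
      AllPairs (λ 𝐊 𝐋 → ∀ {x} → x ∈ vertices 𝐊 → x ∉ vertices 𝐋) 𝐊s
    go [] pc [] = []
    go (𝐊 ∷ 𝐊s) pc (ne ∷ u) =
      All.tabulate (λ 𝐋∈ x∈𝐊 x∈𝐋 →
        All.lookup ne 𝐋∈ (piece-unique (pc (here refl)) (pc (there 𝐋∈)) x∈𝐊 x∈𝐋))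
      ∷ go 𝐊s (pc ∘ there) u

  ⤳-all : (∀ {x} → x ∈ V → x ∈ X) → 𝐇 ⤳ X ≡ []
  ⤳-all {X} all with 𝐇 ⤳ X in eq
  ... | []    = refl
  ... | 𝐊 ∷ _ = ⊥-elim (Piece.avoids pc z∈ (all (Piece.within pc z∈)))
    where
    pc = piece⁻ {𝐊} {X} (subst (𝐊 ∈_) (sym eq) (here refl))
    z∈ = proj₂ (nonempty-∃ (Piece.nonempty pc))

  ⤳-ordered : HereditarilyOrdered 𝐇 → X ⊆ V → Increasing X → X ≢ [] →
    AllPairs (λ 𝐊 𝐋 → vertices 𝐊 ≺ vertices 𝐋) (𝐇 ⤳ X)
  ⤳-ordered ho X⊆ iX ne = AllPairs.map⁺ (ho _ (∈-subsets iX i𝐇 X⊆) ne)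

-- Constructs

private variable
  ℓc : Level
  C : Set ℓc

zip-rel : {Q : A → C → Set ℓr} {ts : List A} {ks : List C} → Pointwise Q ts ks →
  ∀ {k t} → (k , t) ∈ zip ks ts → Q t k
zip-rel (q ∷ qs) (here refl) = q
zip-rel (q ∷ qs) (there m)   = zip-rel qs m

zip-∃ˡ : {Q : A → C → Set ℓr} {ts : List A} {ks : List C} → Pointwise Q ts ks →
  ∀ {k} → k ∈ ks → ∃ λ t → (k , t) ∈ zip ks ts
zip-∃ˡ (q ∷ qs) (here refl) = _ , here refl
zip-∃ˡ (q ∷ qs) (there m)   = map₂ there (zip-∃ˡ qs m)

zip-fst : ∀ {ts : List A} {ks : List C} {k t} → (k , t) ∈ zip ks ts → k ∈ ks
zip-fst {ts = _ ∷ _} {_ ∷ _} (here refl) = here refl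
zip-fst {ts = _ ∷ _} {_ ∷ _} (there m)   = there (zip-fst m)

Pointwise-tabulate : {Q : A → C → Set ℓr} (f : C → A) (ks : List C) →
  (∀ {k} → k ∈ ks → Q (f k) k) → Pointwise Q (map f ks) ks
Pointwise-tabulate f []       h = []
Pointwise-tabulate f (k ∷ ks) h = h (here refl) ∷ Pointwise-tabulate f ks (h ∘ there)

Pointwise-functional : {Q : A → C → Set ℓr} {ss ts : List A} {ks : List C} →
  Pointwise Q ss ks → Pointwise Q ts ks →
  (∀ {k s t} → (k , s) ∈ zip ks ss → (k , t) ∈ zip ks ts → s ≡ t) → ss ≡ ts
Pointwise-functional []       []       h = refl
Pointwise-functional (_ ∷ ss) (_ ∷ ts) h =
  cong₂ _∷_ (h (here refl) (here refl)) (Pointwise-functional ss ts (λ p q → h (there p) (there q)))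

-- A leaf is a graft over the empty list of components, since nothing remains once all vertices are
-- removed. Together with `node⁺` this spares later arguments a separate case for leaves.
node⁻ : Sorted 𝐇 → node Y Ts ∶ 𝐇 →
  Y ∈ subsets (vertices 𝐇) × Y ≢ [] × Pointwise _∶_ Ts (𝐇 ⤳ Y)
node⁻ {𝐇} i (whole ne) = ∈-subsets (Sorted.increasing i) (Sorted.increasing i) id , ne ,
  subst (Pointwise _∶_ []) (sym (⤳-all i {X = vertices 𝐇} id)) []
node⁻ i (graft Y∈ ne _ ts) = Y∈ , ne , ts

node⁺ : Sorted 𝐇 → Y ∈ subsets (vertices 𝐇) → Y ≢ [] →
  Pointwise _∶_ Ts (𝐇 ⤳ Y) → node Y Ts ∶ 𝐇
node⁺ {𝐇} {Y} {Ts} i Y∈ ne ts = aux (Y ≟ˢ vertices 𝐇)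
  where
  leaf : ∀ {Ts} → Pointwise _∶_ Ts [] → vertices 𝐇 ≢ [] → node (vertices 𝐇) Ts ∶ 𝐇
  leaf [] ne = whole ne
  aux : Dec (Y ≡ vertices 𝐇) → node Y Ts ∶ 𝐇
  aux (no Y≢V) = graft Y∈ ne Y≢V ts
  aux (yes refl) = leaf (subst (Pointwise _∶_ Ts) (⤳-all i {X = vertices 𝐇} id) ts) ne

-- Topmost intersections

-- Left-biased choice with `[]` as failure, which turns `top` into a search from the root downwards.
-- Among siblings the bias is immaterial: a connected set that avoids their parent meets only one of
-- them.
pick : List A → List A → List A
pick []         ys = ys
pick xs@(_ ∷ _) _  = xs

pick-[]ʳ : (xs : List A) → pick xs [] ≡ xs
pick-[]ʳ []      = refl
pick-[]ʳ (_ ∷ _) = refl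

pick-≢[] : {xs : List A} (ys : List A) → xs ≢ [] → pick xs ys ≡ xs
pick-≢[] {xs = []}    ys ne = ⊥-elim (ne refl)
pick-≢[] {xs = _ ∷ _} ys ne = refl

pick-assoc : (xs ys zs : List A) → pick (pick xs ys) zs ≡ pick xs (pick ys zs)
pick-assoc []      ys zs = refl
pick-assoc (_ ∷ _) ys zs = refl

-- For e connected, the intersection of e with the node closest to the root
-- that meets e.
mutual
  top : Tree → VSet → VSet
  top (node X Ts) e = pick (X ∩ e) (topIn Ts e)

  topIn : List Tree → VSet → VSet
  topIn []       e = []
  topIn (T ∷ Ts) e = pick (top T e) (topIn Ts e)

topIn-++ : ∀ Ss Ts → topIn (Ss ++ Ts) e ≡ pick (topIn Ss e) (topIn Ts e)
topIn-++ []       Ts = refl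
topIn-++ {e} (S ∷ Ss) Ts =
  trans (cong (pick (top S e)) (topIn-++ Ss Ts)) (sym (pick-assoc (top S e) _ _))

Disjoint-from : VSet → VSet → Set
Disjoint-from e Y = ∀ {x} → x ∈ e → x ∉ Y

mutual
  top-none : Sorted 𝐇 → T ∶ 𝐇 → Disjoint-from e (vertices 𝐇) → top T e ≡ []
  top-none {T = node X Ts} {e = e} i t dis = let X∈ , _ , ts = node⁻ i t in trans
    (cong (λ z → pick z (topIn Ts e)) (∩-[]⁺ {e} {X} (λ x∈e x∈X → dis x∈e (subsets-⊆ X∈ x∈X))))
    (topIn-none Ts ts (λ 𝐊∈ → let p = piece⁻ i {X = X} 𝐊∈ in
      Piece.isSorted p , λ x∈e x∈𝐊 → dis x∈e (Piece.within p x∈𝐊)))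

  topIn-none : ∀ Ts {𝐊s} → Pointwise _∶_ Ts 𝐊s →
    (∀ {𝐊} → 𝐊 ∈ 𝐊s → Sorted 𝐊 × Disjoint-from e (vertices 𝐊)) →
    topIn Ts e ≡ []
  topIn-none []       []       h = refl
  topIn-none {e} (T ∷ Ts) (t ∷ ts) h = trans
    (cong (λ z → pick z (topIn Ts e)) (top-none (proj₁ (h (here refl))) t (λ x∈ → proj₂ (h (here refl)) x∈)))
    (topIn-none Ts ts (h ∘ there))

topIn-select : ∀ {𝐊s} → AllPairs (λ 𝐊 𝐋 → Disjoint-from (vertices 𝐊) (vertices 𝐋)) 𝐊s →
  (∀ {𝐊} → 𝐊 ∈ 𝐊s → Sorted 𝐊) → Pointwise _∶_ Ts 𝐊s →
  (𝐊 , T) ∈ zip 𝐊s Ts → e ⊆ vertices 𝐊 → topIn Ts e ≡ top T e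
topIn-select {T ∷ Ts} {e = e} (d ∷ ds) i (t ∷ ts) (here refl) e⊆ = trans
  (cong (pick (top T e)) (topIn-none Ts ts (λ 𝐊∈ → i (there 𝐊∈) , λ x∈e → All.lookup d 𝐊∈ (e⊆ x∈e))))
  (pick-[]ʳ _)
topIn-select {T ∷ Ts} {e = e} (d ∷ ds) i (t ∷ ts) (there m) e⊆ = trans
  (cong (λ z → pick z (topIn Ts e))
    (top-none (i (here refl)) t (λ x∈e x∈𝐊 → All.lookup d (zip-fst m) x∈𝐊 (e⊆ x∈e))))
  (topIn-select ds (i ∘ there) ts m e⊆)

mutual
  top-some : Sorted 𝐇 → T ∶ 𝐇 → x ∈ e → x ∈ vertices 𝐇 → top T e ≢ []
  top-some {𝐇} {T = node X Ts} {x} {e} i t x∈e x∈V eq = aux (X ∩ e) refl eq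
    where
    aux : ∀ Z → X ∩ e ≡ Z → pick Z (topIn Ts e) ≢ []
    aux [] eq′ =
      let 𝐊 , 𝐊∈ , x∈𝐊 = ∖-nonempty-piece i {X = X} x∈V (∩-[]⁻ {X = X} eq′ x∈e) in
      topIn-some Ts (proj₂ (proj₂ (node⁻ i t)))
        (λ 𝐊∈ → Piece.isSorted (piece⁻ i {X = X} 𝐊∈)) 𝐊∈ x∈e x∈𝐊
    aux (_ ∷ _) _ ()

  topIn-some : ∀ Ts {𝐊s} → Pointwise _∶_ Ts 𝐊s → (∀ {𝐊} → 𝐊 ∈ 𝐊s → Sorted 𝐊) →
    𝐊 ∈ 𝐊s → x ∈ e → x ∈ vertices 𝐊 → topIn Ts e ≢ []
  topIn-some {e = e} (T ∷ Ts) (t ∷ ts) i 𝐊∈ x∈e x∈𝐊 eq with top T e in eq′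
  ... | [] with 𝐊∈
  ...   | here refl = top-some (i (here refl)) t x∈e x∈𝐊 eq′
  ...   | there 𝐊∈′ = topIn-some Ts ts (i ∘ there) 𝐊∈′ x∈e x∈𝐊 eq

mutual
  support⁻ : Sorted 𝐇 → T ∶ 𝐇 → x ∈ support T → x ∈ vertices 𝐇
  support⁻ {𝐇} {T = node X Ts} {x} i t x∈ = [ subsets-⊆ (proj₁ (node⁻ i t)) , lower ]′ (∈-++⁻ X x∈)
    where
    lower : x ∈ supports Ts → x ∈ vertices 𝐇
    lower x∈Ts =
      let 𝐊 , 𝐊∈ , x∈𝐊 = supports⁻ Ts (proj₂ (proj₂ (node⁻ i t)))
                           (λ 𝐊∈ → Piece.isSorted (piece⁻ i {X = X} 𝐊∈)) x∈Ts in
      Piece.within (piece⁻ i {X = X} 𝐊∈) x∈𝐊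

  supports⁻ : ∀ Ts {𝐊s} → Pointwise _∶_ Ts 𝐊s → (∀ {𝐊} → 𝐊 ∈ 𝐊s → Sorted 𝐊) →
    x ∈ supports Ts → ∃ λ 𝐊 → 𝐊 ∈ 𝐊s × x ∈ vertices 𝐊
  supports⁻ (T ∷ Ts) (t ∷ ts) i x∈ with ∈-++⁻ (support T) x∈
  ... | inj₁ x∈T  = _ , here refl , support⁻ (i (here refl)) t x∈T
  ... | inj₂ x∈Ts =
    let 𝐊 , 𝐊∈ , x∈𝐊 = supports⁻ Ts ts (i ∘ there) x∈Ts in 𝐊 , there 𝐊∈ , x∈𝐊

mutual
  support⁺ : Sorted 𝐇 → T ∶ 𝐇 → x ∈ vertices 𝐇 → x ∈ support T
  support⁺ {T = node X Ts} {x} i t x∈ with x ∈? X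
  ... | yes x∈X = ∈-++⁺ˡ x∈X
  ... | no  x∉X =
    let 𝐊 , 𝐊∈ , x∈𝐊 = ∖-nonempty-piece i {X = X} x∈ x∉X in
    ∈-++⁺ʳ X (supports⁺ Ts (proj₂ (proj₂ (node⁻ i t))) (λ 𝐊∈ → Piece.isSorted (piece⁻ i {X = X} 𝐊∈)) 𝐊∈ x∈𝐊)

  supports⁺ : ∀ Ts {𝐊s} → Pointwise _∶_ Ts 𝐊s → (∀ {𝐊} → 𝐊 ∈ 𝐊s → Sorted 𝐊) →
    𝐊 ∈ 𝐊s → x ∈ vertices 𝐊 → x ∈ supports Ts
  supports⁺ (T ∷ Ts) (t ∷ ts) i (here refl) x∈ = ∈-++⁺ˡ (support⁺ (i (here refl)) t x∈)
  supports⁺ (T ∷ Ts) (t ∷ ts) i (there 𝐊∈)  x∈ = ∈-++⁺ʳ (support T) (supports⁺ Ts ts (i ∘ there) 𝐊∈ x∈)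

-- `restrictIn` searches by support, and the support of a construct has exactly the vertices of its
-- hypergraph as members. As `𝐊` has a vertex and the components are disjoint, no earlier subtree
-- passes the test.
restrictIn-select : ∀ {𝐋s} → AllPairs (λ 𝐊 𝐋 → Disjoint-from (vertices 𝐊) (vertices 𝐋)) 𝐋s →
  (∀ {𝐋} → 𝐋 ∈ 𝐋s → Sorted 𝐋) → Pointwise _∶_ Ts 𝐋s →
  (𝐋 , T) ∈ zip 𝐋s Ts → vertices 𝐊 ⊆ vertices 𝐋 → vertices 𝐊 ≢ [] →
  restrictIn Ts 𝐊 ≡ restrict T 𝐊
restrictIn-select {T ∷ Ts} {𝐊 = 𝐊} (d ∷ ds) i (t ∷ ts) m 𝐊⊆ ne with vertices 𝐊 ⊆? support T | m
... | yes _  | here refl = refl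
... | no ¬⊆  | here refl = ⊥-elim (¬⊆ (λ x∈ → support⁺ (i (here refl)) t (𝐊⊆ x∈)))
... | no _   | there m′  = restrictIn-select ds (i ∘ there) ts m′ 𝐊⊆ ne
... | yes 𝐊⊆T | there m′ = let _ , x∈ = nonempty-∃ ne in
  ⊥-elim (All.lookup d (zip-fst m′) (support⁻ (i (here refl)) t (𝐊⊆T x∈)) (𝐊⊆ x∈))

module Node {𝐇 X Ts} (i : Sorted 𝐇) (t : node X Ts ∶ 𝐇) where

  root-∈ : X ∈ subsets (vertices 𝐇)
  root-∈ = proj₁ (node⁻ i t)

  root-⊆ : X ⊆ vertices 𝐇
  root-⊆ = subsets-⊆ root-∈

  root-increasing : Increasing X
  root-increasing = subsets-increasing (Sorted.increasing i) root-∈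

  root-≢[] : X ≢ []
  root-≢[] = proj₁ (proj₂ (node⁻ i t))

  subtrees : Pointwise _∶_ Ts (𝐇 ⤳ X)
  subtrees = proj₂ (proj₂ (node⁻ i t))

  child-piece : (𝐊 , T) ∈ zip (𝐇 ⤳ X) Ts → Piece 𝐇 X 𝐊
  child-piece m = piece⁻ i (zip-fst m)

  child-∶ : (𝐊 , T) ∈ zip (𝐇 ⤳ X) Ts → T ∶ 𝐊
  child-∶ = zip-rel subtrees

  child-size : length (vertices 𝐇) ≤ suc n → (𝐊 , T) ∈ zip (𝐇 ⤳ X) Ts → length (vertices 𝐊) ≤ n
  child-size le m = ℕ.≤-pred (ℕ.≤-trans (piece-size i root-≢[] root-⊆ (child-piece m)) le)

  topIn-child : (𝐊 , T) ∈ zip (𝐇 ⤳ X) Ts → e ⊆ vertices 𝐊 → topIn Ts e ≡ top T e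
  topIn-child m e⊆ =
    topIn-select (pieces-disjoint i X) (λ 𝐊∈ → Piece.isSorted (piece⁻ i {X = X} 𝐊∈)) subtrees m e⊆

  top-avoid : X ∩ e ≡ [] → top (node X Ts) e ≡ topIn Ts e
  top-avoid {e} eq = cong (λ z → pick z (topIn Ts e)) eq

  top-meet : X ∩ e ≢ [] → top (node X Ts) e ≡ X ∩ e
  top-meet ne = pick-≢[] _ ne

  top-child : (𝐊 , T) ∈ zip (𝐇 ⤳ X) Ts → e ⊆ vertices 𝐊 → top (node X Ts) e ≡ top T e
  top-child m e⊆ = trans
    (top-avoid (∩-[]⁺ (λ x∈e → Piece.avoids (child-piece m) (e⊆ x∈e)))) (topIn-child m e⊆)

  restrictIn-child : (𝐋 , T) ∈ zip (𝐇 ⤳ X) Ts → vertices 𝐊 ⊆ vertices 𝐋 → vertices 𝐊 ≢ [] →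
    restrictIn Ts 𝐊 ≡ restrict T 𝐊
  restrictIn-child m 𝐊⊆ ne =
    restrictIn-select (pieces-disjoint i X) (λ 𝐊∈ → Piece.isSorted (piece⁻ i {X = X} 𝐊∈)) subtrees m 𝐊⊆ ne

  child-⊇ : Tube 𝐇 e → X ∩ e ≡ [] → ∃₂ λ 𝐊 T → (𝐊 , T) ∈ zip (𝐇 ⤳ X) Ts × e ⊆ vertices 𝐊
  child-⊇ te eq =
    let 𝐊 , 𝐊∈ , e⊆ = piece-⊇ i te (∩-[]⁻ {X = X} eq)
        T , m = zip-∃ˡ subtrees 𝐊∈ in
    𝐊 , T , m , e⊆

  top-whole : top (node X Ts) (vertices 𝐇) ≡ X
  top-whole = trans (top-meet (subst (_≢ []) (sym absorb) root-≢[])) absorb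
    where absorb = ∩-absorb root-increasing (Sorted.increasing i) root-⊆

-- Agreement of topmost intersections, and restriction

Agree : Hypergraph → Tree → Tree → Set
Agree 𝐊 S T = ∀ e → Tube 𝐊 e → top S e ≡ top T e

length-≰0 : {xs : List A} → xs ≢ [] → ¬ length xs ≤ 0
length-≰0 {xs = []} ne _ = ne refl

-- The value at the whole vertex set is the root, which fixes the components. A tube of a component
-- is a tube of `𝐇`, and the value there is that of the corresponding subtree, so the induction on
-- the number of vertices goes through.
tops-determine : ∀ n → length (vertices 𝐇) ≤ n → Tube 𝐇 (vertices 𝐇) →
  S ∶ 𝐇 → T ∶ 𝐇 → Agree 𝐇 S T → S ≡ T
tops-determine zero le tV s t agree = ⊥-elim (length-≰0 (Tube.nonempty tV) le)
tops-determine {𝐇} {node X Ss} {node Y Ts} (suc n) le tV s t agree = aux s t agree X≡Y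
  where
  i = sorted (Tube.increasing tV)
  module S = Node i s
  module T = Node i t
  X≡Y : X ≡ Y
  X≡Y = trans (sym S.top-whole) (trans (agree (vertices 𝐇) tV) T.top-whole)
  aux : ∀ {Y} → node X Ss ∶ 𝐇 → node Y Ts ∶ 𝐇 → Agree 𝐇 (node X Ss) (node Y Ts) → X ≡ Y →
    node X Ss ≡ node Y Ts
  aux s t agree refl = cong (node X) (Pointwise-functional S′.subtrees T′.subtrees λ {𝐊} p q →
    tops-determine n (S′.child-size le p) (piece-tube i (S′.child-piece p))
      (S′.child-∶ p) (T′.child-∶ q) λ e te →
        trans (sym (S′.top-child p (Tube.within te)))
          (trans (agree e (tube-up i (S′.child-piece p) te)) (T′.top-child q (Tube.within te))))
    where
    module S′ = Node i s
    module T′ = Node i t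

Strict : Hypergraph → Hypergraph → Set
Strict 𝐊 𝐇 = ∀ e → Tube 𝐊 e → Tube 𝐇 e

null-[] : {xs : List A} → xs ≡ [] → null xs ≡ true
null-[] refl = refl

null-≢[] : {xs : List A} → xs ≢ [] → null xs ≡ false
null-≢[] {xs = []}    ne = ⊥-elim (ne refl)
null-≢[] {xs = _ ∷ _} ne = refl

-- The special clause of `restrict` for leaves is an instance of the general one: a leaf carries all
-- vertices, so it contains `𝐊` and leaves no components of `𝐊` to restrict to.
restrict-node : Sorted 𝐇 → node X Ts ∶ 𝐇 → Tube 𝐊 (vertices 𝐊) →
  vertices 𝐊 ⊆ vertices 𝐇 →
  restrict (node X Ts) 𝐊 ≡
    (if null (X ∩ vertices 𝐊) then restrictIn Ts 𝐊
     else node (X ∩ vertices 𝐊) (map (restrictIn Ts) (𝐊 ⤳ (X ∩ vertices 𝐊))))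
restrict-node {Ts = _ ∷ _} i t t𝐊 𝐊⊆ = refl
restrict-node {𝐇} {X} {[]} {𝐊} i t t𝐊 𝐊⊆ = leaf X∩𝐊≡𝐊
  where
  leaf : Y ≡ vertices 𝐊 → node (vertices 𝐊) [] ≡
    (if null Y then restrictIn [] 𝐊 else node Y (map (restrictIn []) (𝐊 ⤳ Y)))
  leaf refl
    rewrite null-≢[] (Tube.nonempty t𝐊)
          | ⤳-all {𝐊} (sorted (Tube.increasing t𝐊)) {vertices 𝐊} id = refl
  none : 𝐇 ⤳ X ≡ []
  none with Node.subtrees i t
  ... | ts with 𝐇 ⤳ X
  none | [] | [] = refl
  V⊆X : vertices 𝐇 ⊆ X
  V⊆X {x} x∈ = decidable-stable (x ∈? X) λ x∉X →
    let 𝐋 , 𝐋∈ , _ = ∖-nonempty-piece i {X = X} x∈ x∉X in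
    case subst (𝐋 ∈_) none 𝐋∈ of λ ()
  X∩𝐊≡𝐊 : X ∩ vertices 𝐊 ≡ vertices 𝐊
  X∩𝐊≡𝐊 = List.filter-all (_∈? X) (All.tabulate (λ x∈ → V⊆X (𝐊⊆ x∈)))

-- A component of `𝐊` without `X` is a tube of `𝐇` by strictness and avoids `X`, hence it lies in a
-- single component of `𝐇` without `X`, where the induction hypothesis applies. This also shows that
-- the search in `restrictIn` succeeds. A tube of `𝐊` that meets `X` does so inside `𝐊`, so both
-- values of `top` are its intersection with `X`.
restrict-spec : ∀ n → length (vertices 𝐇) ≤ n → Sorted 𝐇 → T ∶ 𝐇 →
  Tube 𝐊 (vertices 𝐊) → Strict 𝐊 𝐇 → restrict T 𝐊 ∶ 𝐊 × Agree 𝐊 (restrict T 𝐊) T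
restrict-spec zero le i t t𝐊 strict =
  let _ , x∈ = nonempty-∃ (Tube.nonempty t𝐊) in
  ⊥-elim (length-≰0 (∈⇒≢[] (Tube.within (strict _ t𝐊) x∈)) le)
restrict-spec {𝐇} {node X Ts} {𝐊} (suc n) le i t t𝐊 strict = cases (X∩𝐊 ≟ˢ [])
  where
  module N = Node i t
  i𝐊 = sorted (Tube.increasing t𝐊)
  t𝐊′ = strict _ t𝐊
  X∩𝐊 = X ∩ vertices 𝐊
  R𝐊 = node X∩𝐊 (map (restrictIn Ts) (𝐊 ⤳ X∩𝐊))
  Spec : Hypergraph → Tree → Set
  Spec 𝐋 D = D ∶ 𝐋 × Agree 𝐋 D (node X Ts)
  restrict≡ : restrict (node X Ts) 𝐊 ≡ (if null X∩𝐊 then restrictIn Ts 𝐊 else R𝐊)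
  restrict≡ = restrict-node i t t𝐊 (Tube.within t𝐊′)

  restrictIn-spec : Tube 𝐋 (vertices 𝐋) → Strict 𝐋 𝐇 → X ∩ vertices 𝐋 ≡ [] → Spec 𝐋 (restrictIn Ts 𝐋)
  restrictIn-spec {𝐋} t𝐋 strict𝐋 eq =
    let 𝐌 , C , m , 𝐋⊆𝐌 = N.child-⊇ (strict𝐋 _ t𝐋) eq
        q = N.child-piece m
        C∶ , agree = restrict-spec n (N.child-size le m) (Piece.isSorted q) (N.child-∶ m) t𝐋
          (λ e te → tube-down i q (strict𝐋 e te) (𝐋⊆𝐌 ∘ Tube.within te)) in
    subst (Spec 𝐋) (sym (N.restrictIn-child m 𝐋⊆𝐌 (Tube.nonempty t𝐋)))
      (C∶ , λ e te → trans (agree e te) (sym (N.top-child m (𝐋⊆𝐌 ∘ Tube.within te))))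

  piece-spec : 𝐋 ∈ 𝐊 ⤳ X∩𝐊 → Spec 𝐋 (restrictIn Ts 𝐋)
  piece-spec {𝐋} 𝐋∈ = restrictIn-spec (piece-tube i𝐊 q) (λ e te → strict e (tube-up i𝐊 q te))
    (∩-[]⁺ {vertices 𝐋} {X} (λ x∈𝐋 x∈X → Piece.avoids q x∈𝐋 (∈-∩⁺ x∈X (Piece.within q x∈𝐋))))
    where
    q : Piece 𝐊 X∩𝐊 𝐋
    q = piece⁻ i𝐊 {X = X∩𝐊} 𝐋∈

  module _ (ne : X∩𝐊 ≢ []) where

    R𝐊-∶ : R𝐊 ∶ 𝐊
    R𝐊-∶ = node⁺ i𝐊 (subsets⁺ (Sublist.filter-⊆ (_∈? X) (vertices 𝐊))) ne
      (Pointwise-tabulate (restrictIn Ts) (𝐊 ⤳ X∩𝐊) (proj₁ ∘ piece-spec))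

    module M = Node i𝐊 R𝐊-∶

    agree : ∀ e → Tube 𝐊 e → Dec (X ∩ e ≡ []) → top R𝐊 e ≡ top (node X Ts) e
    agree e te (no ne′) =
      trans (M.top-meet (subst (_≢ []) (sym eq) ne′)) (trans eq (sym (N.top-meet ne′)))
      where
      eq : X∩𝐊 ∩ e ≡ X ∩ e
      eq = Increasing-ext (∩-increasing X∩𝐊 (Tube.increasing te)) (∩-increasing X (Tube.increasing te))
        (λ x∈ → let x∈Y , x∈e = ∈-∩⁻ X∩𝐊 e x∈ in ∈-∩⁺ (proj₁ (∈-∩⁻ X (vertices 𝐊) x∈Y)) x∈e)
        (λ x∈ → let x∈X , x∈e = ∈-∩⁻ X e x∈ in ∈-∩⁺ (∈-∩⁺ x∈X (Tube.within te x∈e)) x∈e)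
    agree e te (yes eq) =
      let 𝐋 , D , m , e⊆𝐋 = M.child-⊇ te (∩-[]⁺ {e} {X∩𝐊}
            λ x∈e x∈Y → ∩-[]⁻ {X = X} eq x∈e (proj₁ (∈-∩⁻ X (vertices 𝐊) x∈Y))) in
      trans (M.top-child m e⊆𝐋)
        (trans (cong (λ D → top D e) (zip-map (𝐊 ⤳ X∩𝐊) m))
               (proj₂ (piece-spec (zip-fst m)) e (tube-down i𝐊 (M.child-piece m) te e⊆𝐋)))
      where
      zip-map : ∀ 𝐊s {𝐋 D} → (𝐋 , D) ∈ zip 𝐊s (map (restrictIn Ts) 𝐊s) → D ≡ restrictIn Ts 𝐋
      zip-map (_ ∷ _)  (here refl) = refl
      zip-map (_ ∷ 𝐊s) (there m)   = zip-map 𝐊s m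

  cases : Dec (X∩𝐊 ≡ []) → Spec 𝐊 (restrict (node X Ts) 𝐊)
  cases (yes eq) = subst (Spec 𝐊)
    (sym (trans restrict≡ (cong (λ b → if b then restrictIn Ts 𝐊 else R𝐊) (null-[] eq))))
    (restrictIn-spec t𝐊 strict eq)
  cases (no ne) = subst (Spec 𝐊)
    (sym (trans restrict≡ (cong (λ b → if b then restrictIn Ts 𝐊 else R𝐊) (null-≢[] ne))))
    (R𝐊-∶ ne , λ e te → agree ne e te ((X ∩ e) ≟ˢ []))

module _ (i : Sorted 𝐇) (t : T ∶ 𝐇) (t𝐊 : Tube 𝐊 (vertices 𝐊)) (strict : Strict 𝐊 𝐇) where

  private spec = restrict-spec {𝐇} {T} {𝐊} _ ℕ.≤-refl i t t𝐊 strict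

  restrict⇒agree : restrict T 𝐊 ≡ S → Agree 𝐊 T S
  restrict⇒agree refl e te = sym (proj₂ spec e te)

  agree⇒restrict : S ∶ 𝐊 → Agree 𝐊 T S → restrict T 𝐊 ≡ S
  agree⇒restrict s agree = tops-determine _ ℕ.≤-refl t𝐊 (proj₁ spec) s
    (λ e te → trans (proj₂ spec e te) (agree e te))

-- Splitting a node of a construct, and merging two nodes

AllPairs-mid : ∀ ls {k} {rs : List A} → AllPairs R (ls ++ k ∷ rs) →
  (∀ {l} → l ∈ ls → R l k) × (∀ {r} → r ∈ rs → R k r)
AllPairs-mid []       (q ∷ _)  = (λ ()) , All.lookup q
AllPairs-mid (l ∷ ls) (q ∷ qs) =
  (λ { (here refl) → All.lookup q (∈-++⁺ʳ ls (here refl))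
     ; (there m)   → proj₁ (AllPairs-mid ls qs) m })
  , proj₂ (AllPairs-mid ls qs)

AllPairs-splice : ∀ ls {k} {ms rs : List A} → AllPairs R (ls ++ k ∷ rs) → AllPairs R ms →
  (∀ {m} → m ∈ ms → (∀ {l} → R l k → R l m) × (∀ {r} → R k r → R m r)) →
  AllPairs R (ls ++ ms ++ rs)
AllPairs-splice [] (q ∷ qs) ps h =
  AllPairs.++⁺ ps qs (All.tabulate (λ m∈ → All.map (proj₂ (h m∈)) q))
AllPairs-splice (l ∷ ls) {k} {ms} {rs} (q ∷ qs) ps h =
  All.++⁺ (All.++⁻ˡ ls q)
    (All.++⁺ (All.tabulate (λ m∈ → proj₁ (h m∈) (All.lookup q (∈-++⁺ʳ ls (here refl)))))
             (All.tail (All.++⁻ʳ ls q)))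
  ∷ AllPairs-splice ls qs ps h

Pointwise-mid : {Q : A → C → Set ℓr} → ∀ ls {t rs} {ks : List C} → Pointwise Q (ls ++ t ∷ rs) ks →
  ∃₂ λ k₁ k → ∃ λ k₂ → ks ≡ k₁ ++ k ∷ k₂ × Pointwise Q ls k₁ × Q t k × Pointwise Q rs k₂
Pointwise-mid []       (q ∷ qs) = [] , _ , _ , refl , [] , q , qs
Pointwise-mid (l ∷ ls) (q ∷ qs) with Pointwise-mid ls qs
... | k₁ , k , k₂ , refl , qs₁ , q′ , qs₂ = _ ∷ k₁ , k , k₂ , refl , q ∷ qs₁ , q′ , qs₂

Pointwise-++⁻ : {Q : A → C → Set ℓr} → ∀ {ts : List A} (k₁ : List C) {k₂} → Pointwise Q ts (k₁ ++ k₂) →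
  ∃₂ λ t₁ t₂ → ts ≡ t₁ ++ t₂ × Pointwise Q t₁ k₁ × Pointwise Q t₂ k₂
Pointwise-++⁻ []       qs       = [] , _ , refl , [] , qs
Pointwise-++⁻ (k ∷ k₁) (q ∷ qs) with Pointwise-++⁻ k₁ qs
... | t₁ , t₂ , refl , qs₁ , qs₂ = _ ∷ t₁ , t₂ , refl , q ∷ qs₁ , qs₂

-- The component at a position depends only on the number of trees before it, so a subtree and its
-- replacement are paired with the same `k`.
zip-mid : {Q : A → C → Set ℓr} → ∀ ls {s rs} {ks : List C} → Pointwise Q (ls ++ s ∷ rs) ks →
  ∃ λ k → ∀ t → (k , t) ∈ zip ks (ls ++ t ∷ rs)
zip-mid []       (q ∷ qs) = _ , λ t → here refl
zip-mid (l ∷ ls) (q ∷ qs) = map₂ (λ f t → there (f t)) (zip-mid ls qs)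

module _ {𝐇 : Hypergraph} (s𝐇 : Sorted 𝐇) where

  piece-shrink : Piece 𝐇 X 𝐊 → X ⊆ Z → Disjoint-from (vertices 𝐊) Z → Piece 𝐇 Z 𝐊
  piece-shrink p X⊆Z dis = record
    { induced-on = P.induced-on
    ; isTube     = P.isTube
    ; avoids     = dis
    ; maximal    = λ te av → P.maximal te (λ x∈e x∈X → av x∈e (X⊆Z x∈X))
    }
    where module P = Piece p

  piece-trans : Piece 𝐇 X 𝐊 → Piece 𝐊 Y 𝐋 → X ⊆ Z → Y ⊆ Z → Disjoint-from (vertices 𝐋) Z → Piece 𝐇 Z 𝐋
  piece-trans p q X⊆Z Y⊆Z dis = record
    { induced-on = trans Q.induced-on (piece-∣ s𝐇 p Q.within)
    ; isTube     = tube-up s𝐇 p Q.isTube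
    ; avoids     = dis
    ; maximal    = λ te av x∈𝐋 x∈e →
        let e⊆𝐊 = P.maximal te (λ x∈e x∈X → av x∈e (X⊆Z x∈X)) (Q.within x∈𝐋) x∈e in
        Q.maximal (tube-down s𝐇 p te e⊆𝐊) (λ x∈e x∈Y → av x∈e (Y⊆Z x∈Y)) x∈𝐋 x∈e
    }
    where
    module P = Piece p
    module Q = Piece q

  -- Both lists are sorted by `_≺_` and have the same members, which makes them equal. The
  -- right-hand list is sorted because the components that replace `𝐊` lie inside it and so keep its
  -- position relative to `ls` and `rs`.
  ⤳-splice : HereditarilyOrdered 𝐇 → X ≢ [] → Increasing X → X ⊆ vertices 𝐇 →
    ∀ ls {rs} → 𝐇 ⤳ X ≡ ls ++ 𝐊 ∷ rs → HereditarilyOrdered 𝐊 →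
    Y ≢ [] → Increasing Y → Y ⊆ vertices 𝐊 →
    𝐇 ⤳ (X ∪ Y) ≡ ls ++ (𝐊 ⤳ Y) ++ rs
  ⤳-splice {X} {𝐊} {Y} ho X≢[] iX X⊆ ls {rs} eq ho𝐊 Y≢[] iY Y⊆ =
    AllPairs-ext ordered-Z ordered-splice asym ⊆-splice splice-⊆
    where
    Z₀ = X ∪ Y
    _◃_ : Hypergraph → Hypergraph → Set
    𝐌 ◃ 𝐍 = vertices 𝐌 ≺ vertices 𝐍
    X⊆Z : X ⊆ Z₀
    X⊆Z = ∈-∪⁺ X Y ∘ inj₁
    Y⊆Z : Y ⊆ Z₀
    Y⊆Z = ∈-∪⁺ X Y ∘ inj₂
    p : Piece 𝐇 X 𝐊
    p = piece⁻ s𝐇 {X = X} (subst (𝐊 ∈_) (sym eq) (∈-++⁺ʳ ls (here refl)))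
    s𝐊 = Piece.isSorted p
    ordered-Z : AllPairs _◃_ (𝐇 ⤳ Z₀)
    ordered-Z = ⤳-ordered s𝐇 ho
      (λ x∈ → [ X⊆ , Piece.within p ∘ Y⊆ ]′ (∈-∪⁻ X Y x∈))
      (∪-increasing iX iY (λ x∈X x∈Y → Piece.avoids p (Y⊆ x∈Y) x∈X))
      (∈⇒≢[] (X⊆Z (proj₂ (nonempty-∃ X≢[]))))
    ordered-splice : AllPairs _◃_ (ls ++ (𝐊 ⤳ Y) ++ rs)
    ordered-splice = AllPairs-splice ls (subst (AllPairs _◃_) eq (⤳-ordered s𝐇 ho X⊆ iX X≢[]))
      (⤳-ordered s𝐊 ho𝐊 Y⊆ iY Y≢[])
      (λ 𝐌∈ → let 𝐌⊆𝐊 = Piece.within (piece⁻ s𝐊 {X = Y} 𝐌∈) in ≺-mono id 𝐌⊆𝐊 , ≺-mono 𝐌⊆𝐊 id)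
    asym : ∀ {𝐌 𝐍} → 𝐌 ∈ 𝐇 ⤳ Z₀ → 𝐍 ∈ 𝐇 ⤳ Z₀ → 𝐌 ◃ 𝐍 → ¬ 𝐍 ◃ 𝐌
    asym 𝐌∈ 𝐍∈ 𝐌◃𝐍 𝐍◃𝐌 =
      let _ , x∈ = nonempty-∃ (Piece.nonempty (piece⁻ s𝐇 {X = Z₀} 𝐌∈))
          _ , y∈ = nonempty-∃ (Piece.nonempty (piece⁻ s𝐇 {X = Z₀} 𝐍∈)) in
      ℤ.<-asym (≺-lookup 𝐌◃𝐍 x∈ y∈) (≺-lookup 𝐍◃𝐌 y∈ x∈)
    disjoint = AllPairs-mid ls (subst (AllPairs _) eq (pieces-disjoint s𝐇 X))
    beside : ∀ {𝐌} → 𝐌 ∈ ls ⊎ 𝐌 ∈ rs → Piece 𝐇 Z₀ 𝐌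
    beside {𝐌} 𝐌∈ = piece-shrink q X⊆Z
      λ x∈𝐌 x∈Z → [ Piece.avoids q x∈𝐌 , apart 𝐌∈ x∈𝐌 ∘ Y⊆ ]′ (∈-∪⁻ X Y x∈Z)
      where
      q : Piece 𝐇 X 𝐌
      q = piece⁻ s𝐇 {X = X} (subst (𝐌 ∈_) (sym eq) ([ ∈-++⁺ˡ , ∈-++⁺ʳ ls ∘ there ]′ 𝐌∈))
      apart : 𝐌 ∈ ls ⊎ 𝐌 ∈ rs → Disjoint-from (vertices 𝐌) (vertices 𝐊)
      apart (inj₁ 𝐌∈) = proj₁ disjoint 𝐌∈
      apart (inj₂ 𝐌∈) x∈𝐌 x∈𝐊 = proj₂ disjoint 𝐌∈ x∈𝐊 x∈𝐌
    inside-𝐊 : ∀ {𝐌} → 𝐌 ∈ 𝐊 ⤳ Y → Piece 𝐇 Z₀ 𝐌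
    inside-𝐊 {𝐌} 𝐌∈ = piece-trans p q X⊆Z Y⊆Z
      λ x∈𝐌 x∈Z → [ Piece.avoids p (Piece.within q x∈𝐌) , Piece.avoids q x∈𝐌 ]′ (∈-∪⁻ X Y x∈Z)
      where
      q : Piece 𝐊 Y 𝐌
      q = piece⁻ s𝐊 {X = Y} 𝐌∈
    splice-piece : ∀ {𝐌} → 𝐌 ∈ ls ++ (𝐊 ⤳ Y) ++ rs → Piece 𝐇 Z₀ 𝐌
    splice-piece 𝐌∈ =
      [ beside ∘ inj₁ , [ inside-𝐊 , beside ∘ inj₂ ]′ ∘ ∈-++⁻ (𝐊 ⤳ Y) ]′ (∈-++⁻ ls 𝐌∈)
    splice-⊆ : (ls ++ (𝐊 ⤳ Y) ++ rs) ⊆ (𝐇 ⤳ Z₀)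
    splice-⊆ 𝐌∈ = piece⁺ s𝐇 {X = Z₀} (splice-piece 𝐌∈)
    covered : x ∈ vertices 𝐇 → x ∉ Z₀ → ∃ λ 𝐌 → 𝐌 ∈ ls ++ (𝐊 ⤳ Y) ++ rs × x ∈ vertices 𝐌
    covered {x} x∈V x∉Z =
      let 𝐌 , 𝐌∈ , x∈𝐌 = ∖-nonempty-piece s𝐇 {X = X} x∈V (x∉Z ∘ X⊆Z) in
      locate x∈𝐌 (∈-++⁻ ls (subst (𝐌 ∈_) eq 𝐌∈))
      where
      locate : ∀ {𝐌} → x ∈ vertices 𝐌 → 𝐌 ∈ ls ⊎ 𝐌 ∈ 𝐊 ∷ rs →
        ∃ λ 𝐌 → 𝐌 ∈ ls ++ (𝐊 ⤳ Y) ++ rs × x ∈ vertices 𝐌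
      locate x∈𝐌 (inj₁ 𝐌∈)         = _ , ∈-++⁺ˡ 𝐌∈ , x∈𝐌
      locate x∈𝐌 (inj₂ (there 𝐌∈)) = _ , ∈-++⁺ʳ ls (∈-++⁺ʳ (𝐊 ⤳ Y) 𝐌∈) , x∈𝐌
      locate x∈𝐊 (inj₂ (here refl)) =
        let 𝐌 , 𝐌∈ , x∈𝐌 = ∖-nonempty-piece s𝐊 {X = Y} x∈𝐊 (x∉Z ∘ Y⊆Z) in
        𝐌 , ∈-++⁺ʳ ls (∈-++⁺ˡ 𝐌∈) , x∈𝐌
    ⊆-splice : (𝐇 ⤳ Z₀) ⊆ (ls ++ (𝐊 ⤳ Y) ++ rs)
    ⊆-splice {𝐌} 𝐌∈ =
      let q = piece⁻ s𝐇 {X = Z₀} 𝐌∈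
          _ , x∈𝐌 = nonempty-∃ (Piece.nonempty q)
          𝐍 , 𝐍∈ , x∈𝐍 = covered (Piece.within q x∈𝐌) (Piece.avoids q x∈𝐌) in
      subst (_∈ ls ++ (𝐊 ⤳ Y) ++ rs) (piece-unique s𝐇 {X = Z₀} (splice-piece 𝐍∈) q x∈𝐍 x∈𝐌) 𝐍∈

  module _ (ho : HereditarilyOrdered 𝐇) where

    contract-∶ : ∀ ls {rs} → (∀ {𝐊} → 𝐊 ∈ 𝐇 ⤳ X → HereditarilyOrdered 𝐊) →
      node X (ls ++ node Y Ts ∷ rs) ∶ 𝐇 → node (X ∪ Y) (ls ++ Ts ++ rs) ∶ 𝐇
    contract-∶ {X} {Y} {Ts} ls {rs} ho𝐊 s = aux (Pointwise-mid ls N.subtrees)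
      where
      module N = Node s𝐇 s
      aux : (∃₂ λ k₁ k → ∃ λ k₂ → 𝐇 ⤳ X ≡ k₁ ++ k ∷ k₂ × Pointwise _∶_ ls k₁ ×
              node Y Ts ∶ k × Pointwise _∶_ rs k₂) →
            node (X ∪ Y) (ls ++ Ts ++ rs) ∶ 𝐇
      aux (k₁ , k , k₂ , eq , l∶ , y∶ , r∶) =
        node⁺ s𝐇 (∈-subsets inc (Sorted.increasing s𝐇) within)
          (∈⇒≢[] (∈-∪⁺ X Y (inj₁ (proj₂ (nonempty-∃ N.root-≢[])))))
          (subst (Pointwise _∶_ (ls ++ Ts ++ rs)) (sym splice)
            (Pointwise.++⁺ l∶ (Pointwise.++⁺ M.subtrees r∶)))
        where
        k∈ : k ∈ 𝐇 ⤳ X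
        k∈ = subst (k ∈_) (sym eq) (∈-++⁺ʳ k₁ (here refl))
        p = piece⁻ s𝐇 {X = X} k∈
        module M = Node (Piece.isSorted p) y∶
        splice : 𝐇 ⤳ (X ∪ Y) ≡ k₁ ++ (k ⤳ Y) ++ k₂
        splice = ⤳-splice ho N.root-≢[] N.root-increasing N.root-⊆ k₁ eq (ho𝐊 k∈)
          M.root-≢[] M.root-increasing M.root-⊆
        inc : Increasing (X ∪ Y)
        inc = ∪-increasing N.root-increasing M.root-increasing
          (λ x∈X x∈Y → Piece.avoids p (M.root-⊆ x∈Y) x∈X)
        within : X ∪ Y ⊆ vertices 𝐇
        within x∈ = [ N.root-⊆ , Piece.within p ∘ M.root-⊆ ]′ (∈-∪⁻ X Y x∈)

    -- By `⤳-splice` the list of subtrees can be cut where the components are cut; the middle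
    -- segment, over `𝐊 ⤳ Y`, is what hangs below the new node `Y`.
    expand-∶ : X ≢ [] → Increasing X → X ⊆ vertices 𝐇 → 𝐊 ∈ 𝐇 ⤳ X → HereditarilyOrdered 𝐊 →
      Y ≢ [] → Increasing Y → Y ⊆ vertices 𝐊 → node (X ∪ Y) Ts ∶ 𝐇 →
      ∃ λ S → S ∶ 𝐇 × root S ≡ X × S ⊂[ X , Y ] node (X ∪ Y) Ts
    expand-∶ {X} {𝐊} {Y} {Ts} X≢[] iX X⊆ 𝐊∈ ho𝐊 Y≢[] iY Y⊆ t = go (∈-∃++ 𝐊∈)
      where
      module N = Node s𝐇 t
      s𝐊 = Piece.isSorted (piece⁻ s𝐇 {X = X} 𝐊∈)
      go : (∃₂ λ ls rs → 𝐇 ⤳ X ≡ ls ++ 𝐊 ∷ rs) →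
        ∃ λ S → S ∶ 𝐇 × root S ≡ X × S ⊂[ X , Y ] node (X ∪ Y) Ts
      go (ls , rs , eq) = split (Pointwise-++⁻ ls (subst (Pointwise _∶_ Ts)
          (⤳-splice ho X≢[] iX X⊆ ls eq ho𝐊 Y≢[] iY Y⊆) N.subtrees))
        where
        split : (∃₂ λ t₁ t₂₃ → Ts ≡ t₁ ++ t₂₃ × Pointwise _∶_ t₁ ls × Pointwise _∶_ t₂₃ ((𝐊 ⤳ Y) ++ rs)) →
          ∃ λ S → S ∶ 𝐇 × root S ≡ X × S ⊂[ X , Y ] node (X ∪ Y) Ts
        split (t₁ , t₂₃ , refl , p₁ , p₂₃) = split′ (Pointwise-++⁻ (𝐊 ⤳ Y) p₂₃)
          where
          split′ : (∃₂ λ t₂ t₃ → t₂₃ ≡ t₂ ++ t₃ × Pointwise _∶_ t₂ (𝐊 ⤳ Y) × Pointwise _∶_ t₃ rs) →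
            ∃ λ S → S ∶ 𝐇 × root S ≡ X × S ⊂[ X , Y ] node (X ∪ Y) (t₁ ++ t₂₃)
          split′ (t₂ , t₃ , refl , p₂ , p₃) =
            node X (t₁ ++ node Y t₂ ∷ t₃)
            , node⁺ s𝐇 (∈-subsets iX (Sorted.increasing s𝐇) X⊆) X≢[]
                (subst (Pointwise _∶_ _) (sym eq) (Pointwise.++⁺ p₁
                  (node⁺ s𝐊 (∈-subsets iY (Sorted.increasing s𝐊) Y⊆) Y≢[] p₂ ∷ p₃)))
            , refl , here t₁

-- Effect of a contraction on topmost intersections

∪-∩-[] : ∀ X Y → X ∩ e ≡ [] → Y ∩ e ≡ [] → (X ∪ Y) ∩ e ≡ []
∪-∩-[] {e} X Y eq₁ eq₂ = ∩-[]⁺ {e} {X ∪ Y} λ x∈e x∈ →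
  [ ∩-[]⁻ {X = X} eq₁ x∈e , ∩-[]⁻ {X = Y} eq₂ x∈e ]′ (∈-∪⁻ X Y x∈)

∪-∩-≢[] : ∀ X Y → X ∩ e ≢ [] ⊎ Y ∩ e ≢ [] → (X ∪ Y) ∩ e ≢ []
∪-∩-≢[] {e} X Y (inj₁ ne) = let _ , x∈ = nonempty-∃ ne ; x∈X , x∈e = ∈-∩⁻ X e x∈ in
  ∈⇒≢[] (∈-∩⁺ (∈-∪⁺ X Y (inj₁ x∈X)) x∈e)
∪-∩-≢[] {e} X Y (inj₂ ne) = let _ , x∈ = nonempty-∃ ne ; x∈Y , x∈e = ∈-∩⁻ Y e x∈ in
  ∈⇒≢[] (∈-∩⁺ (∈-∪⁺ X Y (inj₂ x∈Y)) x∈e)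

∪-∩ˡ : Increasing e → ∀ X Y → Y ∩ e ≡ [] → (X ∪ Y) ∩ e ≡ X ∩ e
∪-∩ˡ {e} ie X Y eq = Increasing-ext (∩-increasing (X ∪ Y) ie) (∩-increasing X ie)
  (λ x∈ → let x∈XY , x∈e = ∈-∩⁻ (X ∪ Y) e x∈ in
    [ (λ x∈X → ∈-∩⁺ x∈X x∈e) , (λ x∈Y → ⊥-elim (∩-[]⁻ {X = Y} eq x∈e x∈Y)) ]′ (∈-∪⁻ X Y x∈XY))
  (λ x∈ → let x∈X , x∈e = ∈-∩⁻ X e x∈ in ∈-∩⁺ (∈-∪⁺ X Y (inj₁ x∈X)) x∈e)

∪-∩ʳ : Increasing e → ∀ X Y → X ∩ e ≡ [] → (X ∪ Y) ∩ e ≡ Y ∩ e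
∪-∩ʳ {e} ie X Y eq = Increasing-ext (∩-increasing (X ∪ Y) ie) (∩-increasing Y ie)
  (λ x∈ → let x∈XY , x∈e = ∈-∩⁻ (X ∪ Y) e x∈ in
    [ (λ x∈X → ⊥-elim (∩-[]⁻ {X = X} eq x∈e x∈X)) , (λ x∈Y → ∈-∩⁺ x∈Y x∈e) ]′ (∈-∪⁻ X Y x∈XY))
  (λ x∈ → let x∈Y , x∈e = ∈-∩⁻ Y e x∈ in ∈-∩⁺ (∈-∪⁺ X Y (inj₂ x∈Y)) x∈e)

TopStep : VSet → VSet → VSet → Tree → Tree → Set
TopStep X Y e S T = top S e ≡ top T e ⊎
  (X ∩ e ≢ [] × Y ∩ e ≢ [] × top S e ≡ X ∩ e × top T e ≡ (X ∪ Y) ∩ e)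

-- A tube that avoids the upper node lies in one component. If it meets `Y`, that is the component
-- with root `Y`, and the value is its intersection with `Y` both before and after the contraction.
-- A tube meeting only `X` is equally unaffected, so just the tubes meeting both nodes notice the
-- merge. Deeper in the tree, a tube avoiding the nodes above is either inside the changed subtree
-- or disjoint from it.
top-⊂ : Sorted 𝐇 → S ∶ 𝐇 → T ∶ 𝐇 → Tube 𝐇 e → S ⊂[ X , Y ] T → TopStep X Y e S T
top-⊂ {𝐇} {e = e} s𝐇 s t te (here {X} {Y} ls {ts} {rs}) = aux ((X ∩ e) ≟ˢ []) ((Y ∩ e) ≟ˢ [])
  where
  module N = Node s𝐇 s
  module M = Node s𝐇 t
  ie = Tube.increasing te
  aux : Dec (X ∩ e ≡ []) → Dec (Y ∩ e ≡ []) →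
    TopStep X Y e (node X (ls ++ node Y ts ∷ rs)) (node (X ∪ Y) (ls ++ ts ++ rs))
  aux (yes eq₁) (yes eq₂) = inj₁ (begin
    top (node X (ls ++ node Y ts ∷ rs)) e
      ≡⟨ N.top-avoid eq₁ ⟩
    topIn (ls ++ node Y ts ∷ rs) e
      ≡⟨ topIn-++ ls (node Y ts ∷ rs) ⟩
    pick (topIn ls e) (pick (pick (Y ∩ e) (topIn ts e)) (topIn rs e))
      ≡⟨ cong (λ z → pick (topIn ls e) (pick (pick z (topIn ts e)) (topIn rs e))) eq₂ ⟩
    pick (topIn ls e) (pick (topIn ts e) (topIn rs e))
      ≡⟨ cong (pick (topIn ls e)) (topIn-++ ts rs) ⟨
    pick (topIn ls e) (topIn (ts ++ rs) e)
      ≡⟨ topIn-++ ls (ts ++ rs) ⟨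
    topIn (ls ++ ts ++ rs) e
      ≡⟨ M.top-avoid (∪-∩-[] {e} X Y eq₁ eq₂) ⟨
    top (node (X ∪ Y) (ls ++ ts ++ rs)) e ∎)
    where open ≡-Reasoning
  aux (yes eq₁) (no ne₂) = inj₁ (begin
    top (node X (ls ++ node Y ts ∷ rs)) e
      ≡⟨ N.top-child k,y∈ e⊆k ⟩
    top (node Y ts) e
      ≡⟨ K.top-meet ne₂ ⟩
    Y ∩ e
      ≡⟨ ∪-∩ʳ ie X Y eq₁ ⟨
    (X ∪ Y) ∩ e
      ≡⟨ M.top-meet (∪-∩-≢[] {e} X Y (inj₂ ne₂)) ⟨
    top (node (X ∪ Y) (ls ++ ts ++ rs)) e ∎)
    where
    open ≡-Reasoning
    k = proj₁ (zip-mid ls N.subtrees)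
    k,y∈ = proj₂ (zip-mid ls N.subtrees) (node Y ts)
    module K = Node (Piece.isSorted (N.child-piece k,y∈)) (N.child-∶ k,y∈)
    e⊆k : e ⊆ vertices k
    e⊆k = let _ , _ , m , e⊆ = N.child-⊇ te eq₁
              _ , y∈ = nonempty-∃ ne₂
              y∈Y , y∈e = ∈-∩⁻ Y e y∈ in
      subst (λ 𝐊 → e ⊆ vertices 𝐊)
        (piece-unique s𝐇 (N.child-piece m) (N.child-piece k,y∈) (e⊆ y∈e) (K.root-⊆ y∈Y)) e⊆
  aux (no ne₁) (yes eq₂) = inj₁
    (trans (N.top-meet ne₁) (trans (sym (∪-∩ˡ ie X Y eq₂)) (sym (M.top-meet (∪-∩-≢[] {e} X Y (inj₁ ne₁))))))
  aux (no ne₁) (no ne₂) =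
    inj₂ (ne₁ , ne₂ , N.top-meet ne₁ , M.top-meet (∪-∩-≢[] {e} X Y (inj₁ ne₁)))
top-⊂ {𝐇} {e = e} {X = X} {Y} s𝐇 s t te (below {Z = Z} {S} {T} ls {rs} S⊂T) = aux ((Z ∩ e) ≟ˢ [])
  where
  module N = Node s𝐇 s
  module M = Node s𝐇 t
  k = proj₁ (zip-mid ls N.subtrees)
  mS = proj₂ (zip-mid ls N.subtrees) S
  mT = proj₂ (zip-mid ls N.subtrees) T
  sk = Piece.isSorted (N.child-piece mS)
  aux : Dec (Z ∩ e ≡ []) → TopStep X Y e (node Z (ls ++ S ∷ rs)) (node Z (ls ++ T ∷ rs))
  aux (no ne) = inj₁ (trans (N.top-meet ne) (sym (M.top-meet ne)))
  aux (yes eq) = side (proj₁ z∈ ∈? vertices k)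
    where
    z∈ = nonempty-∃ (Tube.nonempty te)
    found = N.child-⊇ te eq
    same : ∀ {x} → x ∈ e → x ∈ vertices k → e ⊆ vertices k
    same x∈e x∈k = let _ , _ , m , e⊆ = found in
      subst (λ 𝐊 → e ⊆ vertices 𝐊)
        (piece-unique s𝐇 (N.child-piece m) (N.child-piece mS) (e⊆ x∈e) x∈k) e⊆
    side : Dec (proj₁ z∈ ∈ vertices k) → TopStep X Y e (node Z (ls ++ S ∷ rs)) (node Z (ls ++ T ∷ rs))
    side (yes z∈k) = subst₂ (λ A B → A ≡ B ⊎ (X ∩ e ≢ [] × Y ∩ e ≢ [] × A ≡ X ∩ e × B ≡ (X ∪ Y) ∩ e))
      (sym (N.top-child mS e⊆k)) (sym (M.top-child mT e⊆k))
      (top-⊂ sk (N.child-∶ mS) (M.child-∶ mT) (tube-down s𝐇 (N.child-piece mS) te e⊆k) S⊂T)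
      where
      e⊆k : e ⊆ vertices k
      e⊆k = same (proj₂ z∈) z∈k
    side (no z∉k) = inj₁ (trans (trans (N.top-avoid eq) (topIn-++ ls (S ∷ rs)))
      (trans (cong (λ z → pick (topIn ls e) (pick z (topIn rs e)))
        (trans (top-none sk (N.child-∶ mS) dis) (sym (top-none sk (M.child-∶ mT) dis))))
      (sym (trans (M.top-avoid eq) (topIn-++ ls (T ∷ rs))))))
      where
      dis : Disjoint-from e (vertices k)
      dis x∈e x∈k = z∉k (same x∈e x∈k (proj₂ z∈))

-- The flip order and topmost intersections

infix 4 _⊒_

-- From `Y` to `Z`, the removed elements exceed all of `Z` and the added elements are smaller than
-- all of `Y`. This closed form contains both kinds of flip step, and antisymmetry can be read off
-- from it.
_⊒_ : VSet → VSet → Set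
Y ⊒ Z = (∀ {y z} → y ∈ Y → y ∉ Z → z ∈ Z → z ℤ.< y) ×
        (∀ {y z} → z ∈ Z → z ∉ Y → y ∈ Y → z ℤ.< y)

⊒-refl : X ⊒ X
⊒-refl = (λ y∈ y∉ → ⊥-elim (y∉ y∈)) , (λ z∈ z∉ → ⊥-elim (z∉ z∈))

-- When neither `x` nor `z` lies in `Y`, an element of `Y` separates them. For empty `Y` both
-- hypotheses would be vacuous, hence the care taken that `top` is non-empty on tubes.
⊒-trans : Y ≢ [] → X ⊒ Y → Y ⊒ Z → X ⊒ Z
⊒-trans {Y} {X} {Z} ne (XY₁ , XY₂) (YZ₁ , YZ₂) = above , under
  where
  y = proj₁ (nonempty-∃ ne)
  y∈ = proj₂ (nonempty-∃ ne)
  above : ∀ {x z} → x ∈ X → x ∉ Z → z ∈ Z → z ℤ.< x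
  above {x} {z} x∈X x∉Z z∈Z with x ∈? Y | z ∈? Y
  ... | yes x∈Y | _       = YZ₁ x∈Y x∉Z z∈Z
  ... | no  x∉Y | yes z∈Y = XY₁ x∈X x∉Y z∈Y
  ... | no  x∉Y | no  z∉Y = ℤ.<-trans (YZ₂ z∈Z z∉Y y∈) (XY₁ x∈X x∉Y y∈)
  under : ∀ {x z} → z ∈ Z → z ∉ X → x ∈ X → z ℤ.< x
  under {x} {z} z∈Z z∉X x∈X with z ∈? Y | x ∈? Y
  ... | yes z∈Y | _       = XY₂ z∈Y z∉X x∈X
  ... | no  z∉Y | yes x∈Y = YZ₂ z∈Z z∉Y x∈Y
  ... | no  z∉Y | no  x∉Y = ℤ.<-trans (YZ₂ z∈Z z∉Y y∈) (XY₁ x∈X x∉Y y∈)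

-- An element of one set outside the other would be both above and below every element of that other
-- set.
⊒-antisym : X ≢ [] → Y ≢ [] → Increasing X → Increasing Y → X ⊒ Y → Y ⊒ X → X ≡ Y
⊒-antisym {X} {Y} X≢[] Y≢[] iX iY XY YX = Increasing-ext iX iY (sub Y≢[] XY YX) (sub X≢[] YX XY)
  where
  sub : ∀ {X Y} → Y ≢ [] → X ⊒ Y → Y ⊒ X → X ⊆ Y
  sub {X} {Y} ne XY YX {x} x∈ = decidable-stable (x ∈? Y) λ x∉ →
    let _ , y∈ = nonempty-∃ ne in ℤ.<-asym (proj₁ XY x∈ x∉ y∈) (proj₂ YX x∈ x∉ y∈)

pick-increasing : Increasing X → Increasing Y → Increasing (pick X Y)
pick-increasing {[]}    iX iY = iY
pick-increasing {_ ∷ _} iX iY = iX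

mutual
  top-increasing : ∀ T → Increasing e → Increasing (top T e)
  top-increasing (node X Ts) ie = pick-increasing (∩-increasing X ie) (topIn-increasing Ts ie)

  topIn-increasing : ∀ Ts → Increasing e → Increasing (topIn Ts e)
  topIn-increasing []       ie = []
  topIn-increasing (T ∷ Ts) ie = pick-increasing (top-increasing T ie) (topIn-increasing Ts ie)

top-tube-≢[] : Sorted 𝐇 → T ∶ 𝐇 → Tube 𝐇 e → top T e ≢ []
top-tube-≢[] s𝐇 t te = let _ , x∈ = nonempty-∃ (Tube.nonempty te) in
  top-some s𝐇 t x∈ (Tube.within te x∈)

⋖⇒⊒ : Sorted 𝐇 → S ⋖[ 𝐇 ] T → Tube 𝐇 e → top S e ⊒ top T e
⋖⇒⊒ {𝐇} {S} {T} {e} s𝐇 (s , t , U , V , V≺U , inj₁ S⊂T) te with top-⊂ s𝐇 s t te S⊂T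
... | inj₁ eq = subst (top S e ⊒_) eq ⊒-refl
... | inj₂ (_ , _ , eqS , eqT) = subst₂ _⊒_ (sym eqS) (sym eqT)
  ( (λ y∈ y∉ → let y∈U , y∈e = ∈-∩⁻ U e y∈ in ⊥-elim (y∉ (∈-∩⁺ (∈-∪⁺ U V (inj₁ y∈U)) y∈e)))
  , (λ z∈ z∉ y∈ → let z∈UV , z∈e = ∈-∩⁻ (U ∪ V) e z∈ in
       [ (λ z∈U → ⊥-elim (z∉ (∈-∩⁺ z∈U z∈e))) , (λ z∈V → ≺-lookup V≺U z∈V (proj₁ (∈-∩⁻ U e y∈))) ]′
       (∈-∪⁻ U V z∈UV)))
⋖⇒⊒ {𝐇} {S} {T} {e} s𝐇 (s , t , U , V , V≺U , inj₂ T⊂S) te with top-⊂ s𝐇 t s te T⊂S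
... | inj₁ eq = subst (top S e ⊒_) (sym eq) ⊒-refl
... | inj₂ (_ , _ , eqT , eqS) = subst₂ _⊒_ (sym eqS) (sym eqT)
  ( (λ y∈ y∉ z∈ → let y∈VU , y∈e = ∈-∩⁻ (V ∪ U) e y∈ in
       [ (λ y∈V → ⊥-elim (y∉ (∈-∩⁺ y∈V y∈e))) , (λ y∈U → ≺-lookup V≺U (proj₁ (∈-∩⁻ V e z∈)) y∈U) ]′
       (∈-∪⁻ V U y∈VU))
  , (λ z∈ z∉ → let z∈V , z∈e = ∈-∩⁻ V e z∈ in ⊥-elim (z∉ (∈-∩⁺ (∈-∪⁺ V U (inj₁ z∈V)) z∈e))))

≤⇒⊒ : Sorted 𝐇 → Tube 𝐇 e → S ≤[ 𝐇 ] T → top S e ⊒ top T e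
≤⇒⊒ s𝐇 te ε = ⊒-refl
≤⇒⊒ s𝐇 te (step ◅ rest) =
  ⊒-trans (top-tube-≢[] s𝐇 (proj₁ (proj₂ step)) te) (⋖⇒⊒ s𝐇 step te) (≤⇒⊒ s𝐇 te rest)

squeeze : ∀ {U} → Sorted 𝐇 → S ∶ 𝐇 → U ∶ 𝐇 → S ≤[ 𝐇 ] U → U ≤[ 𝐇 ] T →
  Tube 𝐇 e → top S e ≡ top T e → top U e ≡ top S e
squeeze {S = S} {e = e} {U} s𝐇 s u S≤U U≤T te eq = sym (⊒-antisym
  (top-tube-≢[] s𝐇 s te) (top-tube-≢[] s𝐇 u te)
  (top-increasing S (Tube.increasing te)) (top-increasing U (Tube.increasing te))
  (≤⇒⊒ s𝐇 te S≤U) (subst (top U e ⊒_) (sym eq) (≤⇒⊒ s𝐇 te U≤T)))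

-- For _◁_ = _≺_ these are the covering steps of the flip order, for
-- _◁_ = flip _≺_ those of its converse.
Flip : Rel VSet 0ℓ → Hypergraph → Rel Tree 0ℓ
Flip _◁_ 𝐇 S T = S ∶ 𝐇 × T ∶ 𝐇 × ∃₂ λ U V → V ◁ U × (S ⊂[ U , V ] T ⊎ T ⊂[ V , U ] S)

module _ {_◁_ : Rel VSet 0ℓ} where

  Flips-∶ : S ∶ 𝐇 → Star (Flip _◁_ 𝐇) S T → T ∶ 𝐇
  Flips-∶ s ε                       = s
  Flips-∶ s ((_ , t , _) ◅ flips) = Flips-∶ t flips

  module _ {𝐇 X} (s𝐇 : Sorted 𝐇) (X∈ : X ∈ subsets (vertices 𝐇)) (X≢[] : X ≢ []) where

    flips-at : ∀ ls {rs k₁ k₂ S T} → 𝐇 ⤳ X ≡ k₁ ++ 𝐊 ∷ k₂ →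
      Pointwise _∶_ ls k₁ → Pointwise _∶_ rs k₂ → Star (Flip _◁_ 𝐊) S T →
      Star (Flip _◁_ 𝐇) (node X (ls ++ S ∷ rs)) (node X (ls ++ T ∷ rs))
    flips-at ls eq l∶ r∶ ε = ε
    flips-at {𝐊} ls {rs} eq l∶ r∶ ((s , t , U , V , V◁U , S⊂T) ◅ flips) =
      (typed s , typed t , U , V , V◁U , Sum.map (below ls) (below ls) S⊂T) ◅ flips-at ls eq l∶ r∶ flips
      where
      typed : ∀ {T} → T ∶ 𝐊 → node X (ls ++ T ∷ rs) ∶ 𝐇
      typed t = node⁺ s𝐇 X∈ X≢[] (subst (Pointwise _∶_ _) (sym eq) (Pointwise.++⁺ l∶ (t ∷ r∶)))

    private
      flips-from : ∀ (g : Hypergraph → Tree) ls {ts k₁ k₂} → 𝐇 ⤳ X ≡ k₁ ++ k₂ →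
        Pointwise _∶_ ls k₁ → Pointwise _∶_ ts k₂ →
        (∀ {𝐊 T} → (𝐊 , T) ∈ zip k₂ ts → Star (Flip _◁_ 𝐊) T (g 𝐊)) →
        Star (Flip _◁_ 𝐇) (node X (ls ++ ts)) (node X (ls ++ map g k₂))
      flips-from g ls eq l∶ [] h = ε
      flips-from g ls {t ∷ ts} {k₁} {k ∷ k₂} eq l∶ (t∶ ∷ ts∶) h =
        flips-at ls eq l∶ ts∶ (h (here refl)) ◅◅
        subst₂ (λ ss us → Star (Flip _◁_ 𝐇) (node X ss) (node X us))
          (List.++-assoc ls _ _) (List.++-assoc ls _ _)
          (flips-from g (ls ++ g k ∷ []) (trans eq (sym (List.++-assoc k₁ _ _)))
            (Pointwise.++⁺ l∶ (Flips-∶ t∶ (h (here refl)) ∷ [])) ts∶ (h ∘ there))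

    -- Flips in different subtrees are independent, so the subtrees are replaced one at a time from
    -- the left; in `flips-from` the list `ls` holds those already treated.
    flips-children : ∀ (g : Hypergraph → Tree) → Pointwise _∶_ Ts (𝐇 ⤳ X) →
      (∀ {𝐊 T} → (𝐊 , T) ∈ zip (𝐇 ⤳ X) Ts → Star (Flip _◁_ 𝐊) T (g 𝐊)) →
      Star (Flip _◁_ 𝐇) (node X Ts) (node X (map g (𝐇 ⤳ X)))
    flips-children g = flips-from g [] refl []

-- Teams and delegations

private variable
  m : ℕ

module _ {H : Hypergraph} where

  isHypergraph⇒Sorted : IsHypergraph H → Sorted H
  isHypergraph⇒Sorted h = sorted (IsHypergraph.increasing h)

  whole-tube : IsHypergraph H → Connected H → vertices H ≢ [] → Tube H (vertices H)
  whole-tube h conn ne = tube ne (IsHypergraph.increasing h) id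
    (subst Connected (sym (cong (hypergraph (vertices H))
      (List.filter-all (_⊆? vertices H) (All.tabulate edge⊆)))) conn)
    where
    edge⊆ : ∀ {Z} → Z ∈ edges H → Z ⊆ vertices H
    edge⊆ Z∈ = subsets-⊆ (Sublist.Any-resp-⊆ (IsHypergraph.canonical h) Z∈)

∈-⋃⁻ : ∀ (B : Subset m) Xs → x ∈ ⋃[ B ] Xs → ∃ λ a → lookup B a ≡ inside × x ∈ lookup Xs a
∈-⋃⁻ [] [] ()
∈-⋃⁻ (inside ∷ B) (X ∷ Xs) x∈ with ∈-∪⁻ X (⋃[ B ] Xs) x∈
... | inj₁ x∈X = zero , refl , x∈X
... | inj₂ x∈⋃ = let a , a∈B , x∈a = ∈-⋃⁻ B Xs x∈⋃ in suc a , a∈B , x∈a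
∈-⋃⁻ (outside ∷ B) (X ∷ Xs) x∈ = let a , a∈B , x∈a = ∈-⋃⁻ B Xs x∈ in suc a , a∈B , x∈a

∈-⋃⁺ : ∀ (B : Subset m) Xs a → lookup B a ≡ inside → x ∈ lookup Xs a → x ∈ ⋃[ B ] Xs
∈-⋃⁺ (inside ∷ B)  (X ∷ Xs) zero    a∈B x∈ = ∈-∪⁺ X (⋃[ B ] Xs) (inj₁ x∈)
∈-⋃⁺ (inside ∷ B)  (X ∷ Xs) (suc a) a∈B x∈ = ∈-∪⁺ X (⋃[ B ] Xs) (inj₂ (∈-⋃⁺ B Xs a a∈B x∈))
∈-⋃⁺ (outside ∷ B) (X ∷ Xs) (suc a) a∈B x∈ = ∈-⋃⁺ B Xs a a∈B x∈

⋃-increasing : ∀ (B : Subset m) Xs → (∀ a → Increasing (lookup Xs a)) →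
  (∀ {a b} → a ≢ b → Disjoint-from (lookup Xs a) (lookup Xs b)) → Increasing (⋃[ B ] Xs)
⋃-increasing []            []       iXs dis = []
⋃-increasing (inside ∷ B)  (X ∷ Xs) iXs dis =
  ∪-increasing (iXs zero) (⋃-increasing B Xs (iXs ∘ suc) (λ a≢b → dis (a≢b ∘ Fin.suc-injective)))
    (λ x∈X x∈⋃ → let a , _ , x∈a = ∈-⋃⁻ B Xs x∈⋃ in dis {zero} {suc a} (λ ()) x∈X x∈a)
⋃-increasing (outside ∷ B) (X ∷ Xs) iXs dis =
  ⋃-increasing B Xs (iXs ∘ suc) (λ a≢b → dis (a≢b ∘ Fin.suc-injective))

⋃-cong : ∀ (B : Subset m) Xs Ys → (∀ a → lookup B a ≡ inside → lookup Xs a ≡ lookup Ys a) →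
  ⋃[ B ] Xs ≡ ⋃[ B ] Ys
⋃-cong []            []       []       eq = refl
⋃-cong (inside ∷ B)  (X ∷ Xs) (Y ∷ Ys) eq = cong₂ _∪_ (eq zero refl) (⋃-cong B Xs Ys (eq ∘ suc))
⋃-cong (outside ∷ B) (X ∷ Xs) (Y ∷ Ys) eq = ⋃-cong B Xs Ys (eq ∘ suc)

Vec-ext : {us vs : Vec A m} → (∀ a → lookup us a ≡ lookup vs a) → us ≡ vs
Vec-ext {us = []}    {[]}    eq = refl
Vec-ext {us = _ ∷ _} {_ ∷ _} eq = cong₂ _∷_ (eq zero) (Vec-ext (eq ∘ suc))

Participant : Set
Participant = Hypergraph × Tree

-- (b , i) with b ∈ B, or an element of A ∖ B.
PieceOf : Vec Participant m → Subset m → Participant → Set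
PieceOf Ps B P =
  (∃ λ a → lookup B a ≡ outside × P ≡ lookup Ps a) ⊎
  (∃ λ b → lookup B b ≡ inside ×
     (let (𝐇 , C) = lookup Ps b in P ∈ zip (𝐇 ⤳ root C) (children C)))

pieces⁻ : ∀ (Ps : Vec Participant m) B {P} → P ∈ pieces Ps B → PieceOf Ps B P
pieces⁻ [] [] ()
pieces⁻ ((𝐇 , C) ∷ Ps) (inside ∷ B) P∈ with ∈-++⁻ (zip (𝐇 ⤳ root C) (children C)) P∈
... | inj₁ P∈zip = inj₂ (zero , refl , P∈zip)
... | inj₂ P∈Ps  = Sum.map (λ (a , r) → suc a , r) (λ (a , r) → suc a , r) (pieces⁻ Ps B P∈Ps)
pieces⁻ ((𝐇 , C) ∷ Ps) (outside ∷ B) (here refl) = inj₁ (zero , refl , refl)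
pieces⁻ ((𝐇 , C) ∷ Ps) (outside ∷ B) (there P∈)  =
  Sum.map (λ (a , r) → suc a , r) (λ (a , r) → suc a , r) (pieces⁻ Ps B P∈)

pieces⁺ˡ : ∀ (Ps : Vec Participant m) B a → lookup B a ≡ outside → lookup Ps a ∈ pieces Ps B
pieces⁺ˡ (_ ∷ Ps)       (outside ∷ B) zero    a∉B = here refl
pieces⁺ˡ (_ ∷ Ps)       (outside ∷ B) (suc a) a∉B = there (pieces⁺ˡ Ps B a a∉B)
pieces⁺ˡ ((𝐇 , C) ∷ Ps) (inside ∷ B)  (suc a) a∉B =
  ∈-++⁺ʳ (zip (𝐇 ⤳ root C) (children C)) (pieces⁺ˡ Ps B a a∉B)

pieces⁺ʳ : ∀ (Ps : Vec Participant m) B b {P} → lookup B b ≡ inside →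
  (let (𝐇 , C) = lookup Ps b in P ∈ zip (𝐇 ⤳ root C) (children C)) → P ∈ pieces Ps B
pieces⁺ʳ (_ ∷ Ps)       (inside ∷ B)  zero    b∈B P∈ = ∈-++⁺ˡ P∈
pieces⁺ʳ ((𝐇 , C) ∷ Ps) (inside ∷ B)  (suc b) b∈B P∈ =
  ∈-++⁺ʳ (zip (𝐇 ⤳ root C) (children C)) (pieces⁺ʳ Ps B b b∈B P∈)
pieces⁺ʳ (_ ∷ Ps)       (outside ∷ B) (suc b) b∈B P∈ = there (pieces⁺ʳ Ps B b b∈B P∈)

-- δᵢᴮ for 𝐊 = 𝐇ᵢᴮ.
inducedOn : (δ : Delegation) → Subset (Delegation.arity δ) → Hypergraph → Delegation
inducedOn (mkDelegation Ps 𝐇) B 𝐊 =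
  mkDelegation (fromList (filter (λ P → vertices (proj₁ P) ⊆? vertices 𝐊) (pieces Ps B))) 𝐊

map-filter : ∀ {A : Set ℓa} {C : Set ℓc} {P : Pred C ℓp} (P? : Decidable P) (f : A → C) xs →
  map f (filter (P? ∘ f) xs) ≡ filter P? (map f xs)
map-filter P? f [] = refl
map-filter P? f (x ∷ xs) with does (P? (f x))
... | true  = cong (f x ∷_) (map-filter P? f xs)
... | false = map-filter P? f xs

map-zip : {Q : A → C → Set ℓr} {ts : List A} {ks : List C} → Pointwise Q ts ks → map proj₁ (zip ks ts) ≡ ks
map-zip []       = refl
map-zip (_ ∷ qs) = cong (_ ∷_) (map-zip qs)

fromList-team : ∀ (Ps : List Participant) 𝐊 →
  mkTeam (Vec.map proj₁ (fromList Ps)) 𝐊 ≡ mkTeam (fromList (map proj₁ Ps)) 𝐊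
fromList-team []       𝐊 = refl
fromList-team (P ∷ Ps) 𝐊 = cong (λ τ → mkTeam (proj₁ P ∷ Team.parts τ) (Team.coord τ)) (fromList-team Ps 𝐊)

teamPieces≡ : ∀ (Ps : Vec Participant m) B Xs →
  (∀ b → lookup B b ≡ inside → let (𝐇 , C) = lookup Ps b in
     lookup Xs b ≡ root C × Pointwise _∶_ (children C) (𝐇 ⤳ root C)) →
  teamPieces (Vec.map proj₁ Ps) B Xs ≡ map proj₁ (pieces Ps B)
teamPieces≡ [] [] [] h = refl
teamPieces≡ ((𝐇 , C) ∷ Ps) (inside ∷ B) (X ∷ Xs) h =
  trans (cong₂ _++_ (trans (cong (𝐇 ⤳_) (proj₁ (h zero refl))) (sym (map-zip (proj₂ (h zero refl)))))
                    (teamPieces≡ Ps B Xs (h ∘ suc)))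
        (sym (List.map-++ proj₁ (zip (𝐇 ⤳ root C) (children C)) (pieces Ps B)))
teamPieces≡ (_ ∷ Ps) (outside ∷ B) (X ∷ Xs) h = cong (_ ∷_) (teamPieces≡ Ps B Xs (h ∘ suc))

-- `Xs` need only agree with the roots on `B`: the induced teams in `μ` are formed from
-- intersections with a node, and these are empty outside `B`.
inducedTeams≡ : ∀ δ (let open Delegation δ) B Xs →
  (∀ b → lookup B b ≡ inside → let (𝐇 , C) = lookup participants b in
     lookup Xs b ≡ root C × Pointwise _∶_ (children C) (𝐇 ⤳ root C)) →
  inducedTeams team B Xs ≡ map Delegation.team (induced δ B)
inducedTeams≡ δ@(mkDelegation Ps 𝐇) B Xs h =
  trans (cong (λ Z → inducedTeamsOn (𝐇 ⤳ Z)) (⋃-cong B Xs _ λ b b∈B →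
          trans (proj₁ (h b b∈B)) (sym (Vec.lookup-map b (root ∘ proj₂) Ps))))
  (trans (List.map-cong team≡ (𝐇 ⤳ (⋃[ B ] Delegation.roots δ))) (List.map-∘ _))
  where
  teamOn : Hypergraph → Team
  teamOn 𝐊 = mkTeam (fromList (filter (λ 𝐋 → vertices 𝐋 ⊆? vertices 𝐊)
    (teamPieces (Vec.map proj₁ Ps) B Xs))) 𝐊
  inducedTeamsOn : List Hypergraph → List Team
  inducedTeamsOn = map teamOn
  team≡ : ∀ 𝐊 → teamOn 𝐊 ≡ Delegation.team (inducedOn δ B 𝐊)
  team≡ 𝐊 = sym (trans (fromList-team _ 𝐊) (cong (λ 𝐋s → mkTeam (fromList 𝐋s) 𝐊)
    (trans (map-filter (λ 𝐋 → vertices 𝐋 ⊆? vertices 𝐊) proj₁ (pieces Ps B))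
      (cong (filter (λ 𝐋 → vertices 𝐋 ⊆? vertices 𝐊)) (sym (teamPieces≡ Ps B Xs h))))))

VecAllPairs-lookup : {xs : Vec A m} → VecAllPairs.AllPairs R xs →
  ∀ {i j} → i Fin.< j → R (lookup xs i) (lookup xs j)
VecAllPairs-lookup (q VecAllPairs.∷ qs) {zero}  {suc j} lt       = VecAll.lookup⁺ q j
VecAllPairs-lookup (q VecAllPairs.∷ qs) {suc i} {suc j} (s≤s lt) = VecAllPairs-lookup qs lt

fromList-find : {xs : List A} {y : A} → y ∈ xs → ∃ λ i → lookup (fromList xs) i ≡ y
fromList-find (here refl) = zero , refl
fromList-find (there y∈)  = let i , eq = fromList-find y∈ in suc i , eq

fromList-lookup : ∀ (xs : List A) i → lookup (fromList xs) i ∈ xs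
fromList-lookup (x ∷ xs) zero    = here refl
fromList-lookup (x ∷ xs) (suc i) = there (fromList-lookup xs i)

module _ (δ : Delegation) (B : Subset (Delegation.arity δ)) (𝐊 : Hypergraph) where

  private
    within? : (P : Participant) → Dec (vertices (proj₁ P) ⊆ vertices 𝐊)
    within? P = vertices (proj₁ P) ⊆? vertices 𝐊

  inducedOn-lookup : ∀ i → let P = lookup (Delegation.participants (inducedOn δ B 𝐊)) i in
    PieceOf (Delegation.participants δ) B P × vertices (proj₁ P) ⊆ vertices 𝐊
  inducedOn-lookup i =
    let P∈ , ⊆𝐊 = ∈-filter⁻ within? {xs = pieces Ps B} (fromList-lookup (filter within? (pieces Ps B)) i) in
    pieces⁻ Ps B P∈ , ⊆𝐊
    where Ps = Delegation.participants δ

  inducedOn-find : ∀ {P} → P ∈ pieces (Delegation.participants δ) B → vertices (proj₁ P) ⊆ vertices 𝐊 →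
    ∃ λ i → lookup (Delegation.participants (inducedOn δ B 𝐊)) i ≡ P
  inducedOn-find P∈ ⊆𝐊 = fromList-find (∈-filter⁺ within? P∈ ⊆𝐊)

tree-children : Sorted 𝐇 → T ∶ 𝐇 → Pointwise _∶_ (children T) (𝐇 ⤳ root T)
tree-children {T = node X Ts} s t = Node.subtrees s t

tree-top-child : Sorted 𝐇 → T ∶ 𝐇 → (𝐊 , S) ∈ zip (𝐇 ⤳ root T) (children T) →
  e ⊆ vertices 𝐊 → top T e ≡ top S e
tree-top-child {T = node X Ts} s t m = Node.top-child s t m

tree-top-meet : Sorted 𝐇 → T ∶ 𝐇 → root T ∩ e ≢ [] → top T e ≡ root T ∩ e
tree-top-meet {T = node X Ts} s t = Node.top-meet s t

tree-top-whole : Sorted 𝐇 → T ∶ 𝐇 → top T (vertices 𝐇) ≡ root T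
tree-top-whole {T = node X Ts} s t = Node.top-whole s t

tree-root-∈ : Sorted 𝐇 → T ∶ 𝐇 → root T ∈ subsets (vertices 𝐇)
tree-root-∈ {T = node X Ts} s t = Node.root-∈ s t

tree-root-≢[] : Sorted 𝐇 → T ∶ 𝐇 → root T ≢ []
tree-root-≢[] {T = node X Ts} s t = Node.root-≢[] s t

tree-child-⊇ : Sorted 𝐇 → T ∶ 𝐇 → Tube 𝐇 e → root T ∩ e ≡ [] →
  ∃₂ λ 𝐊 S → (𝐊 , S) ∈ zip (𝐇 ⤳ root T) (children T) × e ⊆ vertices 𝐊
tree-child-⊇ {T = node X Ts} s t = Node.child-⊇ s t

tree-child-piece : Sorted 𝐇 → T ∶ 𝐇 → (𝐊 , S) ∈ zip (𝐇 ⤳ root T) (children T) → Piece 𝐇 (root T) 𝐊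
tree-child-piece {T = node X Ts} s t m = Node.child-piece s t m

-- U ⌈ 𝐇ₐ = Cₐ for all a, in terms of topmost intersections.
Agrees : Delegation → Tree → Set
Agrees δ U = ∀ a → let (𝐇 , C) = lookup (Delegation.participants δ) a in Agree 𝐇 U C

-- Delegations of a clan and the trees that agree with them

module Clan {u x} {𝔘 : Pred Hypergraph u} (isU : IsUniverse 𝔘)
            {Ξ : Pred Team x} (isC : IsOrderedStrictClan 𝔘 Ξ) where

  private
    module U = IsUniverse isU
    module C = IsOrderedStrictClan isC

  module Facts (δ : Delegation) (isD : IsDelegation Ξ δ) where

    open Delegation δ public
    open IsDelegation isD

    private
      module T = IsOrderedStrictTeam (C.teams team-in-Ξ)

    part : Fin arity → Hypergraph
    part a = proj₁ (lookup participants a)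

    con : Fin arity → Tree
    con a = proj₂ (lookup participants a)

    private
      part≡ : ∀ a → lookup (Team.parts team) a ≡ part a
      part≡ a = Vec.lookup-map a proj₁ participants

    coord-sorted : Sorted coord
    coord-sorted = isHypergraph⇒Sorted (U.isHypergraph T.coord-in-𝔘)

    coord-ordered : HereditarilyOrdered coord
    coord-ordered = U.hereditarilyOrdered T.coord-in-𝔘

    part-𝔘 : ∀ a → 𝔘 (part a)
    part-𝔘 a = VecAll.lookup⁺ (VecAll.map⁻ T.parts-in-𝔘) a

    part-sorted : ∀ a → Sorted (part a)
    part-sorted a = isHypergraph⇒Sorted (U.isHypergraph (part-𝔘 a))

    con-∶ : ∀ a → con a ∶ part a
    con-∶ a = VecAll.lookup⁺ constructs a

    root-⊆ : ∀ a → root (con a) ⊆ vertices (part a)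
    root-⊆ a = subsets-⊆ (tree-root-∈ (part-sorted a) (con-∶ a))

    root-≢[] : ∀ a → root (con a) ≢ []
    root-≢[] a = tree-root-≢[] (part-sorted a) (con-∶ a)

    root-increasing : ∀ a → Increasing (root (con a))
    root-increasing a =
      subsets-increasing (Sorted.increasing (part-sorted a)) (tree-root-∈ (part-sorted a) (con-∶ a))

    part-≢[] : ∀ a → vertices (part a) ≢ []
    part-≢[] a = ∈⇒≢[] (root-⊆ a (proj₂ (nonempty-∃ (root-≢[] a))))

    part-tube : ∀ a → Tube (part a) (vertices (part a))
    part-tube a = whole-tube (U.isHypergraph (part-𝔘 a)) (U.connected (part-𝔘 a)) (part-≢[] a)

    part-⊆ : ∀ a → vertices (part a) ⊆ vertices coord
    part-⊆ a {x} x∈ = Equivalence.from T.covering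
      (any-at (Vec.map proj₁ participants) a (subst (λ 𝐇 → x ∈ vertices 𝐇) (sym (part≡ a)) x∈))
      where
      any-at : ∀ {n} (𝐇s : Vec Hypergraph n) i → x ∈ vertices (lookup 𝐇s i) →
        VecAny.Any (λ 𝐇 → x ∈ vertices 𝐇) 𝐇s
      any-at (_ ∷ _)  zero    x∈ = VecAny.here x∈
      any-at (_ ∷ 𝐇s) (suc i) x∈ = VecAny.there (any-at 𝐇s i x∈)

    part-of : ∀ {x} → x ∈ vertices coord → ∃ λ a → x ∈ vertices (part a)
    part-of x∈ = at participants (Equivalence.to T.covering x∈)
      where
      at : ∀ {n x} (Ps : Vec Participant n) → VecAny.Any (λ 𝐇 → x ∈ vertices 𝐇) (Vec.map proj₁ Ps) →
        ∃ λ a → x ∈ vertices (proj₁ (lookup Ps a))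
      at (_ ∷ Ps) (VecAny.here x∈)  = zero , x∈
      at (_ ∷ Ps) (VecAny.there x∈) = let a , x∈a = at Ps x∈ in suc a , x∈a

    part-strict : ∀ a → Strict (part a) coord
    part-strict a e te = tube (Tube.nonempty te) (Tube.increasing te) (part-⊆ a ∘ Tube.within te)
      (VecAll.lookup⁺ (VecAll.map⁻ T.strict) a e
        (∈-subsets (Tube.increasing te) (Sorted.increasing (part-sorted a)) (Tube.within te))
        (Tube.nonempty te) (Tube.connected te))

    part-ordered : ∀ {a b} → a Fin.< b → vertices (part a) ≺ vertices (part b)
    part-ordered {a} {b} a<b = subst₂ (λ 𝐊 𝐋 → vertices 𝐊 ≺ vertices 𝐋) (part≡ a) (part≡ b)
      (VecAllPairs-lookup T.ordered a<b)

    part-disjoint : ∀ {a b} → a ≢ b → Disjoint-from (vertices (part a)) (vertices (part b))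
    part-disjoint {a} {b} a≢b x∈a x∈b with Fin.<-cmp a b
    ... | tri< a<b _ _ = ℤ.<-irrefl refl (≺-lookup (part-ordered a<b) x∈a x∈b)
    ... | tri≈ _ a≡b _ = a≢b a≡b
    ... | tri> _ _ b<a = ℤ.<-irrefl refl (≺-lookup (part-ordered b<a) x∈b x∈a)

    part-unique : ∀ {a b x} → x ∈ vertices (part a) → x ∈ vertices (part b) → a ≡ b
    part-unique {a} {b} x∈a x∈b with a Fin.≟ b
    ... | yes a≡b = a≡b
    ... | no  a≢b = ⊥-elim (part-disjoint a≢b x∈a x∈b)

    coord-tube : Fin arity → Tube coord (vertices coord)
    coord-tube a = whole-tube (U.isHypergraph T.coord-in-𝔘) (U.connected T.coord-in-𝔘)
      (∈⇒≢[] (part-⊆ a (proj₂ (nonempty-∃ (part-≢[] a)))))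

    roots≡ : ∀ a → lookup roots a ≡ root (con a)
    roots≡ a = Vec.lookup-map a (root ∘ proj₂) participants

    ⋃roots : Subset arity → VSet
    ⋃roots B = ⋃[ B ] roots

    ∈-⋃roots⁻ : ∀ B {x} → x ∈ ⋃roots B → ∃ λ a → lookup B a ≡ inside × x ∈ root (con a)
    ∈-⋃roots⁻ B x∈ = let a , a∈B , x∈a = ∈-⋃⁻ B roots x∈ in a , a∈B , subst (_ ∈_) (roots≡ a) x∈a

    ∈-⋃roots⁺ : ∀ B {a x} → lookup B a ≡ inside → x ∈ root (con a) → x ∈ ⋃roots B
    ∈-⋃roots⁺ B {a} a∈B x∈ = ∈-⋃⁺ B roots a a∈B (subst (_ ∈_) (sym (roots≡ a)) x∈)

    ⋃roots-increasing : ∀ B → Increasing (⋃roots B)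
    ⋃roots-increasing B = ⋃-increasing B roots
      (λ a → subst Increasing (sym (roots≡ a)) (root-increasing a))
      (λ {a} {b} a≢b x∈a x∈b → part-disjoint a≢b
        (root-⊆ a (subst (_ ∈_) (roots≡ a) x∈a)) (root-⊆ b (subst (_ ∈_) (roots≡ b) x∈b)))

    ⋃roots-⊆ : ∀ B → ⋃roots B ⊆ vertices coord
    ⋃roots-⊆ B x∈ = let a , _ , x∈a = ∈-⋃roots⁻ B x∈ in part-⊆ a (root-⊆ a x∈a)

    ⋃roots-∈ : ∀ B → ⋃roots B ∈ subsets (vertices coord)
    ⋃roots-∈ B = ∈-subsets (⋃roots-increasing B) (Sorted.increasing coord-sorted) (⋃roots-⊆ B)

    ⋃roots-≢[] : ∀ B {b} → lookup B b ≡ inside → ⋃roots B ≢ []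
    ⋃roots-≢[] B {b} b∈B = ∈⇒≢[] (∈-⋃roots⁺ B b∈B (proj₂ (nonempty-∃ (root-≢[] b))))

    ∈-⋃roots-part : ∀ B {a x} → x ∈ ⋃roots B → x ∈ vertices (part a) →
      lookup B a ≡ inside × x ∈ root (con a)
    ∈-⋃roots-part B x∈ x∈a with ∈-⋃roots⁻ B x∈
    ... | b , b∈B , x∈b with part-unique x∈a (root-⊆ b x∈b)
    ...   | refl = b∈B , x∈b

    ⋃roots-∩-inside : ∀ B {a} → lookup B a ≡ inside → ⋃roots B ∩ vertices (part a) ≡ root (con a)
    ⋃roots-∩-inside B {a} a∈B = Increasing-ext
      (∩-increasing (⋃roots B) (Sorted.increasing (part-sorted a))) (root-increasing a)
      (λ x∈ → let x∈⋃ , x∈a = ∈-∩⁻ (⋃roots B) (vertices (part a)) x∈ in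
        proj₂ (∈-⋃roots-part B x∈⋃ x∈a))
      (λ x∈ → ∈-∩⁺ (∈-⋃roots⁺ B a∈B x∈) (root-⊆ a x∈))

    ⋃roots-outside : ∀ B {a} → lookup B a ≡ outside → Disjoint-from (vertices (part a)) (⋃roots B)
    ⋃roots-outside B a∉B x∈a x∈⋃ with () ← trans (sym a∉B) (proj₁ (∈-⋃roots-part B x∈⋃ x∈a))

    ⋃roots-∩-outside : ∀ B {a} → lookup B a ≡ outside → ⋃roots B ∩ vertices (part a) ≡ []
    ⋃roots-∩-outside B {a} a∉B = ∩-[]⁺ {vertices (part a)} {⋃roots B} (⋃roots-outside B a∉B)

    -- The index set `B′` from the definition of `μ`, for a tree with root `X`.
    meeting : VSet → Subset arity
    meeting X = Vec.map (λ P → not (null (X ∩ vertices (proj₁ P)))) participants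

    meeting-lookup : ∀ X a → lookup (meeting X) a ≡ not (null (X ∩ vertices (part a)))
    meeting-lookup X a = Vec.lookup-map a (λ P → not (null (X ∩ vertices (proj₁ P)))) participants

    meeting-⋃roots : ∀ B → meeting (⋃roots B) ≡ B
    meeting-⋃roots B = Vec-ext λ a → trans (meeting-lookup (⋃roots B) a) (aux a (lookup B a) refl)
      where
      aux : ∀ a b → lookup B a ≡ b → not (null (⋃roots B ∩ vertices (part a))) ≡ lookup B a
      aux a true  eq = trans
        (cong not (null-≢[] (subst (_≢ []) (sym (⋃roots-∩-inside B eq)) (root-≢[] a)))) (sym eq)
      aux a false eq = trans (cong not (null-[] (⋃roots-∩-outside B eq))) (sym eq)

    meeting-inside : ∀ X {a} → lookup (meeting X) a ≡ inside → X ∩ vertices (part a) ≢ []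
    meeting-inside X {a} a∈ eq with () ←
      trans (sym a∈) (trans (meeting-lookup X a) (cong not (null-[] eq)))

    inside-meeting : ∀ X {a x} → x ∈ X → x ∈ vertices (part a) → lookup (meeting X) a ≡ inside
    inside-meeting X {a} x∈X x∈a =
      trans (meeting-lookup X a) (cong not (null-≢[] (∈⇒≢[] (∈-∩⁺ x∈X x∈a))))

    inducedTeams-roots : ∀ B Xs → (∀ b → lookup B b ≡ inside → lookup Xs b ≡ root (con b)) →
      inducedTeams team B Xs ≡ map Delegation.team (induced δ B)
    inducedTeams-roots B Xs eq =
      inducedTeams≡ δ B Xs (λ b b∈B → eq b b∈B , tree-children {part b} {con b} (part-sorted b) (con-∶ b))

    induced-IsDelegation : ∀ B {b} → lookup B b ≡ inside → ∀ {𝐊} → 𝐊 ∈ coord ⤳ ⋃roots B →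
      IsDelegation Ξ (inducedOn δ B 𝐊)
    induced-IsDelegation B {b} b∈B {𝐊} 𝐊∈ = record
      { team-in-Ξ  = All.lookup teams-in-Ξ
          (∈-map⁺ Delegation.team (∈-map⁺ (inducedOn δ B) 𝐊∈))
      ; constructs = VecAll.lookup⁻ λ i → typed (proj₁ (inducedOn-lookup δ B 𝐊 i))
      }
      where
      teams-in-Ξ : All Ξ (map Delegation.team (induced δ B))
      teams-in-Ξ = subst (All Ξ) (inducedTeams-roots B roots (λ b _ → roots≡ b))
        (C.closed team-in-Ξ B (b , Vec.lookup⇒[]= b B b∈B) roots λ b _ →
          subst₂ (λ X 𝐇 → X ∈ subsets (vertices 𝐇) × X ≢ []) (sym (roots≡ b)) (sym (part≡ b))
            (tree-root-∈ (part-sorted b) (con-∶ b) , root-≢[] b))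
      typed : ∀ {P} → PieceOf participants B P → proj₂ P ∶ proj₁ P
      typed (inj₁ (a , _ , refl)) = con-∶ a
      typed (inj₂ (a , _ , P∈))   = zip-rel (tree-children (part-sorted a) (con-∶ a)) P∈

    module Root {X Us} (t : node X Us ∶ coord) where

      private module N = Node coord-sorted t

      module _ (agrees : Agrees δ (node X Us)) where

        -- Both sides are the topmost intersection with the whole part, one computed in the tree and
        -- the other in `con a`.
        root-part : ∀ a → X ∩ vertices (part a) ≢ [] → X ∩ vertices (part a) ≡ root (con a)
        root-part a ne = trans (sym (N.top-meet ne))
          (trans (agrees a _ (part-tube a)) (tree-top-whole (part-sorted a) (con-∶ a)))

        root≡⋃roots : X ≡ ⋃roots (meeting X)
        root≡⋃roots = Increasing-ext N.root-increasing (⋃roots-increasing (meeting X))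
          (λ x∈X → let a , x∈a = part-of (N.root-⊆ x∈X) in
            ∈-⋃roots⁺ (meeting X) (inside-meeting X x∈X x∈a)
              (subst (_ ∈_) (root-part a (∈⇒≢[] (∈-∩⁺ x∈X x∈a))) (∈-∩⁺ x∈X x∈a)))
          (λ x∈⋃ → let a , a∈ , x∈a = ∈-⋃roots⁻ (meeting X) x∈⋃ in
            proj₁ (∈-∩⁻ X (vertices (part a))
              (subst (_ ∈_) (sym (root-part a (meeting-inside X a∈))) x∈a)))

        -- The tubes of an induced participant are tubes of the part it comes from, and on tubes
        -- inside `𝐊` the subtree `T` has the same topmost intersections as the whole tree.
        children-agree : ∀ B {𝐊 T} → (𝐊 , T) ∈ zip (coord ⤳ X) Us → Agrees (inducedOn δ B 𝐊) T
        children-agree B {𝐊} {T} m i = let P , 𝐋⊆𝐊 = inducedOn-lookup δ B 𝐊 i in agree P 𝐋⊆𝐊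
          where
          agree : ∀ {P} → PieceOf participants B P → vertices (proj₁ P) ⊆ vertices 𝐊 →
            Agree (proj₁ P) T (proj₂ P)
          agree (inj₁ (a , _ , refl)) ⊆𝐊 e te =
            trans (sym (N.top-child m (⊆𝐊 ∘ Tube.within te))) (agrees a e te)
          agree (inj₂ (a , _ , P∈)) ⊆𝐊 e te =
            trans (sym (N.top-child m (⊆𝐊 ∘ Tube.within te)))
              (trans (agrees a e (tube-up (part-sorted a) (tree-child-piece (part-sorted a) (con-∶ a) P∈) te))
                     (tree-top-child (part-sorted a) (con-∶ a) P∈ (Tube.within te)))

      -- If `a` is in `B` and the tube meets `root (con a)`, then `X` cuts out the same
      -- intersection. Otherwise the tube lies in a single piece, either the part itself or a
      -- component of it. That piece is a tube of `coord` disjoint from `X`, so it sits in one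
      -- component and is a participant of the delegation induced there.
      agrees⁺ : ∀ B → X ≡ ⋃roots B →
        (∀ {𝐊 T} → (𝐊 , T) ∈ zip (coord ⤳ X) Us → Agrees (inducedOn δ B 𝐊) T) →
        Agrees δ (node X Us)
      agrees⁺ B refl h a e te = aux (lookup B a) refl ((root (con a) ∩ e) ≟ˢ [])
        where
        s𝐇 = part-sorted a
        through : ∀ {P} → P ∈ pieces participants B → e ⊆ vertices (proj₁ P) → Tube (proj₁ P) e →
          Tube coord (vertices (proj₁ P)) → Disjoint-from (vertices (proj₁ P)) X →
          top (node X Us) e ≡ top (proj₂ P) e
        through {P} P∈ e⊆ te tP dis =
          let 𝐊 , T , m , P⊆𝐊 = N.child-⊇ tP (∩-[]⁺ {vertices (proj₁ P)} {X} dis)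
              i , eq = inducedOn-find δ B 𝐊 P∈ P⊆𝐊 in
          trans (N.top-child m (P⊆𝐊 ∘ e⊆))
            (subst (λ Q → Agree (proj₁ Q) T (proj₂ Q)) eq (h m i) e te)
        aux : ∀ b → lookup B a ≡ b → Dec (root (con a) ∩ e ≡ []) → top (node X Us) e ≡ top (con a) e
        aux false a∉B _ = through (pieces⁺ˡ participants B a a∉B) (Tube.within te) te
          (part-strict a _ (part-tube a)) (⋃roots-outside B a∉B)
        aux true a∈B (no ne) = trans (N.top-meet (subst (_≢ []) (sym eq) ne))
          (trans eq (sym (tree-top-meet s𝐇 (con-∶ a) ne)))
          where
          eq : X ∩ e ≡ root (con a) ∩ e
          eq = Increasing-ext (∩-increasing X (Tube.increasing te))
            (∩-increasing (root (con a)) (Tube.increasing te))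
            (λ x∈ → let x∈X , x∈e = ∈-∩⁻ X e x∈ in
              ∈-∩⁺ (proj₂ (∈-⋃roots-part B x∈X (Tube.within te x∈e))) x∈e)
            (λ x∈ → let x∈r , x∈e = ∈-∩⁻ (root (con a)) e x∈ in ∈-∩⁺ (∈-⋃roots⁺ B a∈B x∈r) x∈e)
        aux true a∈B (yes eq) =
          let 𝐋 , D , m , e⊆𝐋 = tree-child-⊇ s𝐇 (con-∶ a) te eq
              p = tree-child-piece s𝐇 (con-∶ a) m in
          trans (through (pieces⁺ʳ participants B a a∈B m) e⊆𝐋 (tube-down s𝐇 p te e⊆𝐋)
            (part-strict a _ (Piece.isTube p))
            (λ x∈𝐋 x∈X → Piece.avoids p x∈𝐋 (proj₂ (∈-⋃roots-part B x∈X (Piece.within p x∈𝐋)))))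
            (sym (tree-top-child s𝐇 (con-∶ a) m e⊆𝐋))

-- Enumeration of the constructs restricting to a delegation

∈-allSubsets : (B : Subset m) → B ∈ allSubsets m
∈-allSubsets [] = here refl
∈-allSubsets (inside ∷ B)  = ∈-++⁺ˡ (∈-map⁺ (inside ∷_) (∈-allSubsets B))
∈-allSubsets (outside ∷ B) = ∈-++⁺ʳ (map (inside ∷_) (allSubsets _)) (∈-map⁺ (outside ∷_) (∈-allSubsets B))

allSubsets-unique : ∀ m → Unique (allSubsets m)
allSubsets-unique zero    = [] ∷ []
allSubsets-unique (suc m) =
  Unique.++⁺ (Unique.map⁺ Vec.∷-injectiveʳ ih) (Unique.map⁺ Vec.∷-injectiveʳ ih) disjoint
  where
  ih = allSubsets-unique m
  disjoint : ∀ {B} → ¬ (B ∈ map (inside ∷_) (allSubsets m) × B ∈ map (outside ∷_) (allSubsets m))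
  disjoint (B∈₁ , B∈₂) with ∈-map⁻ (inside ∷_) B∈₁ | ∈-map⁻ (outside ∷_) B∈₂
  ... | _ , _ , refl | _ , _ , ()

∈-nonemptySubsets⁺ : ∀ (B : Subset m) {b} → lookup B b ≡ inside → B ∈ nonemptySubsets m
∈-nonemptySubsets⁺ B {b} b∈B = ∈-filter⁺ nonempty? (∈-allSubsets B) (b , Vec.lookup⇒[]= b B b∈B)

∈-nonemptySubsets⁻ : ∀ {B : Subset m} → B ∈ nonemptySubsets m → ∃ λ b → lookup B b ≡ inside
∈-nonemptySubsets⁻ {m} B∈ =
  let b , b∈B = proj₂ (∈-filter⁻ nonempty? {xs = allSubsets m} B∈) in b , Vec.[]=⇒lookup b∈B

Unique-concatMap : ∀ {A : Set ℓa} {C : Set ℓc} (f : A → List C) {xs} → Unique xs →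
  (∀ {x} → x ∈ xs → Unique (f x)) →
  (∀ {x y u} → x ∈ xs → y ∈ xs → u ∈ f x → u ∈ f y → x ≡ y) → Unique (concatMap f xs)
Unique-concatMap f {[]}     []      us inj = []
Unique-concatMap f {x ∷ xs} (n ∷ u) us inj =
  Unique.++⁺ (us (here refl)) (Unique-concatMap f u (us ∘ there) (λ p q → inj (there p) (there q)))
    λ { (v∈x , v∈xs) → let y , y∈ , v∈y = find (∈-concatMap⁻ f {xs = xs} v∈xs) in
        All.lookup n y∈ (inj (here refl) (there y∈) v∈x v∈y) }

choices : List (List A) → List (List A)
choices []         = [ [] ]
choices (xs ∷ xss) = cartesianProductWith _∷_ xs (choices xss)

∈-choices⁻ : ∀ (xss : List (List A)) {ys} → ys ∈ choices xss → Pointwise _∈_ ys xss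
∈-choices⁻ []         (here refl) = []
∈-choices⁻ (xs ∷ xss) ys∈ with ∈-cartesianProductWith⁻ _∷_ xs (choices xss) ys∈
... | _ , _ , y∈ , ys∈′ , refl = y∈ ∷ ∈-choices⁻ xss ys∈′

∈-choices⁺ : {xss : List (List A)} {ys : List A} → Pointwise _∈_ ys xss → ys ∈ choices xss
∈-choices⁺ []        = here refl
∈-choices⁺ (y∈ ∷ ys) = ∈-cartesianProductWith⁺ _∷_ y∈ (∈-choices⁺ ys)

choices-unique : {xss : List (List A)} → All Unique xss → Unique (choices xss)
choices-unique []       = [] ∷ []
choices-unique (u ∷ us) = Unique.cartesianProductWith⁺ _∷_ List.∷-injective u (choices-unique us)

mutual
  -- The recursion of `starN` with the coefficients left out. Both lists run through the same trees
  -- in the same order, so the coefficients can be computed entry by entry.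
  fibreN : ℕ → Delegation → List Tree
  fibreN n δ = concatMap (fibreBN n δ) (nonemptySubsets (Delegation.arity δ))

  fibreBN : ℕ → (δ : Delegation) → Subset (Delegation.arity δ) → List Tree
  fibreBN zero    δ B = []
  fibreBN (suc n) δ B =
    map (node (⋃[ B ] Delegation.roots δ)) (choices (map (fibreN n) (induced δ B)))

root-fibreB : ∀ n δ B → T ∈ fibreBN n δ B → root T ≡ ⋃[ B ] Delegation.roots δ
root-fibreB (suc n) δ B T∈ with ∈-map⁻ (node (⋃[ B ] Delegation.roots δ)) T∈
... | _ , _ , refl = refl

Pointwise-mapʳ⁻ : ∀ {D : Set ℓp} {Q : A → C → Set ℓr} (f : D → C) {ts : List A} ks →
  Pointwise Q ts (map f ks) → Pointwise (λ t k → Q t (f k)) ts ks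
Pointwise-mapʳ⁻ f []       []       = []
Pointwise-mapʳ⁻ f (k ∷ ks) (q ∷ qs) = q ∷ Pointwise-mapʳ⁻ f ks qs

Pointwise-mapʳ⁺ : ∀ {D : Set ℓp} {Q : A → C → Set ℓr} (f : D → C) {ts : List A} {ks} →
  Pointwise (λ t k → Q t (f k)) ts ks → Pointwise Q ts (map f ks)
Pointwise-mapʳ⁺ f []       = []
Pointwise-mapʳ⁺ f (q ∷ qs) = q ∷ Pointwise-mapʳ⁺ f qs

Pointwise-zip : ∀ {Q S : A → C → Set ℓr} {ts : List A} {ks : List C} → Pointwise Q ts ks →
  (∀ {k t} → (k , t) ∈ zip ks ts → Q t k → S t k) → Pointwise S ts ks
Pointwise-zip []       h = []
Pointwise-zip (q ∷ qs) h = h (here refl) q ∷ Pointwise-zip qs (h ∘ there)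

module Fibre {u x} {𝔘 : Pred Hypergraph u} (isU : IsUniverse 𝔘)
             {Ξ : Pred Team x} (isC : IsOrderedStrictClan 𝔘 Ξ) where

  open Clan isU isC

  induced-size : ∀ {δ} (isD : IsDelegation Ξ δ) B {b} → lookup B b ≡ inside → size δ ≤ suc n →
    𝐊 ∈ Delegation.coord δ ⤳ (⋃[ B ] Delegation.roots δ) → size (inducedOn δ B 𝐊) ≤ n
  induced-size {δ = δ} isD B b∈B le 𝐊∈ = ℕ.≤-pred (ℕ.≤-trans
    (piece-size coord-sorted (⋃roots-≢[] B b∈B) (⋃roots-⊆ B) (piece⁻ coord-sorted {X = ⋃roots B} 𝐊∈)) le)
    where open Facts δ isD

  size-≰0 : ∀ {δ} → IsDelegation Ξ δ → Fin (Delegation.arity δ) → ¬ size δ ≤ 0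
  size-≰0 {δ} isD a = length-≰0 (Tube.nonempty (coord-tube a))
    where open Facts δ isD

  mutual
    fibreB⁻ : ∀ n δ → IsDelegation Ξ δ → size δ ≤ n → ∀ B {b} → lookup B b ≡ inside →
      T ∈ fibreBN n δ B → T ∶ Delegation.coord δ × Agrees δ T
    fibreB⁻ (suc n) δ isD le B {b} b∈B T∈ = aux (∈-map⁻ (node X′) T∈)
      where
      open Facts δ isD
      X′ = ⋃roots B
      aux : (∃ λ Us → Us ∈ choices (map (fibreN n) (map (inducedOn δ B) (coord ⤳ X′))) × T ≡ node X′ Us) →
        T ∶ coord × Agrees δ T
      aux (Us , Us∈ , refl) = t , Root.agrees⁺ t B refl (λ m → proj₂ (child m (zip-rel subtrees m)))
        where
        subtrees : Pointwise (λ U 𝐊 → U ∈ fibreN n (inducedOn δ B 𝐊)) Us (coord ⤳ X′)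
        subtrees = Pointwise-mapʳ⁻ (inducedOn δ B) (coord ⤳ X′)
          (Pointwise-mapʳ⁻ (fibreN n) _ (∈-choices⁻ _ Us∈))
        child : ∀ {𝐊 U} → (𝐊 , U) ∈ zip (coord ⤳ X′) Us → U ∈ fibreN n (inducedOn δ B 𝐊) →
          U ∶ 𝐊 × Agrees (inducedOn δ B 𝐊) U
        child {𝐊} m U∈ = fibre⁻ n (inducedOn δ B 𝐊) (induced-IsDelegation B b∈B (zip-fst m))
          (induced-size isD B b∈B le (zip-fst m)) U∈
        t : node X′ Us ∶ coord
        t = node⁺ coord-sorted (⋃roots-∈ B) (⋃roots-≢[] B b∈B)
          (Pointwise-zip subtrees (λ m U∈ → proj₁ (child m U∈)))

    fibre⁻ : ∀ n δ → IsDelegation Ξ δ → size δ ≤ n → T ∈ fibreN n δ →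
      T ∶ Delegation.coord δ × Agrees δ T
    fibre⁻ n δ isD le T∈ =
      let B , B∈ , T∈B = find (∈-concatMap⁻ (fibreBN n δ) {xs = nonemptySubsets _} T∈)
          b , b∈B = ∈-nonemptySubsets⁻ B∈ in
      fibreB⁻ n δ isD le B b∈B T∈B

  mutual
    fibreB⁺ : ∀ n δ → IsDelegation Ξ δ → size δ ≤ n → ∀ B {b} → lookup B b ≡ inside →
      T ∶ Delegation.coord δ → root T ≡ ⋃[ B ] Delegation.roots δ → Agrees δ T → T ∈ fibreBN n δ B
    fibreB⁺ zero δ isD le B {b} b∈B t eq agrees = ⊥-elim (size-≰0 isD b le)
    fibreB⁺ {node X Us} (suc n) δ isD le B {b} b∈B t refl agrees =
      ∈-map⁺ (node X) (∈-choices⁺ (Pointwise-mapʳ⁺ (fibreN n) (Pointwise-mapʳ⁺ (inducedOn δ B)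
        (Pointwise-zip (Node.subtrees coord-sorted t) child))))
      where
      open Facts δ isD
      child : ∀ {𝐊 U} → (𝐊 , U) ∈ zip (coord ⤳ X) Us → U ∶ 𝐊 → U ∈ fibreN n (inducedOn δ B 𝐊)
      child {𝐊} m u = fibre⁺ n (inducedOn δ B 𝐊) (induced-IsDelegation B b∈B (zip-fst m))
        (induced-size isD B b∈B le (zip-fst m)) u (Root.children-agree t agrees B m)

    fibre⁺ : ∀ n δ → IsDelegation Ξ δ → size δ ≤ n →
      T ∶ Delegation.coord δ → Agrees δ T → T ∈ fibreN n δ
    fibre⁺ {node X Us} n δ isD le t agrees =
      ∈-concatMap⁺ (fibreBN n δ) (lose (∈-nonemptySubsets⁺ (meeting X) b∈)
        (fibreB⁺ n δ isD le (meeting X) b∈ t (Root.root≡⋃roots t agrees) agrees))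
      where
      open Facts δ isD
      x∈X = proj₂ (nonempty-∃ (Node.root-≢[] coord-sorted t))
      b,x∈b = part-of (Node.root-⊆ coord-sorted t x∈X)
      b∈ : lookup (meeting X) (proj₁ b,x∈b) ≡ inside
      b∈ = inside-meeting X x∈X (proj₂ b,x∈b)

  mutual
    fibreB-unique : ∀ n δ → IsDelegation Ξ δ → ∀ B {b} → lookup B b ≡ inside → Unique (fibreBN n δ B)
    fibreB-unique zero    δ isD B b∈B = []
    fibreB-unique (suc n) δ isD B b∈B = Unique.map⁺ (λ { refl → refl })
      (choices-unique (All.map⁺ (All.map⁺ (All.tabulate λ {𝐊} 𝐊∈ →
        fibre-unique n (inducedOn δ B 𝐊) (induced-IsDelegation B b∈B 𝐊∈)))))
      where open Facts δ isD

    fibre-unique : ∀ n δ → IsDelegation Ξ δ → Unique (fibreN n δ)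
    fibre-unique n δ isD = Unique-concatMap (fibreBN n δ)
      (Unique.filter⁺ nonempty? (allSubsets-unique _))
      (λ B∈ → fibreB-unique n δ isD _ (proj₂ (∈-nonemptySubsets⁻ B∈)))
      -- `meeting` recovers the index set from the root, so no tree is listed for two different
      -- index sets.
      (λ {B} {B′} _ _ T∈B T∈B′ → trans (sym (meeting-⋃roots B)) (trans
        (cong meeting (trans (sym (root-fibreB n δ B T∈B)) (root-fibreB n δ B′ T∈B′)))
        (meeting-⋃roots B′)))
      where open Facts δ isD

  -- The union of the roots meets exactly the parts in `B`, each in its own root, so the teams that
  -- `μ` recurses on are those of the induced delegations.
  μ-node : ∀ {δ} → IsDelegation Ξ δ → ∀ B Us →
    μ (Delegation.team δ) (node (⋃[ B ] Delegation.roots δ) Us) ≡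
      (Sub.∣ B ∣ ∸ 1) + μs (map Delegation.team (induced δ B)) Us
  μ-node {δ} isD B Us =
    trans (cong (λ B → (Sub.∣ B ∣ ∸ 1) + μs (inducedTeams team B Xs) Us) B′≡B)
          (cong (λ τs → (Sub.∣ B ∣ ∸ 1) + μs τs Us) (inducedTeams-roots B Xs Xs≡))
    where
    open Facts δ isD
    X′ = ⋃roots B
    Xs = Vec.map (λ 𝐇 → X′ ∩ vertices 𝐇) (Team.parts team)
    B′≡B : Vec.map (λ 𝐇 → not (null (X′ ∩ vertices 𝐇))) (Team.parts team) ≡ B
    B′≡B = trans (sym (Vec.map-∘ (λ 𝐇 → not (null (X′ ∩ vertices 𝐇))) proj₁ participants)) (meeting-⋃roots B)
    Xs≡ : ∀ b → lookup B b ≡ inside → lookup Xs b ≡ root (con b)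
    Xs≡ b b∈B = trans (Vec.lookup-map b (λ 𝐇 → X′ ∩ vertices 𝐇) (Team.parts team))
      (trans (cong (λ 𝐇 → X′ ∩ vertices 𝐇) (Vec.lookup-map b proj₁ participants)) (⋃roots-∩-inside B b∈B))

  -- Coefficients of the products

  module Sums {c ℓ} (R : CommutativeRing c ℓ) (q : CommutativeRing.Carrier R) where

    open Products R q
    open CommutativeRing R using (Carrier; _≈_; 0#; semiring; +-cong; *-cong)
      renaming (_+_ to _⊕_; _*_ to _⊗_;
        refl to ≈-refl; sym to ≈-sym; trans to ≈-trans; reflexive to ≈-reflexive)
    open import Algebra.Properties.Semiring.Exp semiring using (_^_; ^-homo-*)

    -- The exponent is specified by a relation so that the one for `starBN` can be given by an
    -- equation between sums; truncated subtraction enters only in `μ-exponent`.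
    Represents : (Tree → ℕ → Set) → FormalSum → List Tree → Set (c Level.⊔ ℓ)
    Represents W = Pointwise λ ((a , T) : Carrier × Tree) (U : Tree) → T ≡ U × ∃ λ k → W U k × a ≈ q ^ k

    RepresentsForests : List Team → List (Carrier × List Tree) → List (List Tree) → Set (c Level.⊔ ℓ)
    RepresentsForests τs =
      Pointwise λ ((a , Ts) : Carrier × List Tree) (Us : List Tree) → Ts ≡ Us × a ≈ q ^ μs τs Us

    represents-≋ : ∀ {W} {w : Tree → ℕ} {s Us} → (∀ {U k} → W U k → k ≡ w U) → Represents W s Us →
      s ≋ map (λ U → q ^ w U , U) Us
    represents-≋ {W} {w} W⇒w [] V = ≈-refl
    represents-≋ {W} {w} {(a , T) ∷ _} W⇒w ((refl , k , Wk , a≈) ∷ rs) V =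
      +-cong (term (does (T ≟ᵀ V))) (represents-≋ {W} {w} W⇒w rs V)
      where
      term : (b : Bool) → (if b then a else 0#) ≈ (if b then q ^ w T else 0#)
      term true  = ≈-trans a≈ (≈-reflexive (cong (q ^_) (W⇒w Wk)))
      term false = ≈-refl

    -- Along a forest the coefficients multiply and the exponents add, as in `μs`; `tensor` and
    -- `choices` run through the forests in the same order.
    tensor-represents : ∀ n δs →
      (∀ {δ} → δ ∈ δs → Represents (λ U k → k ≡ μ (Delegation.team δ) U) (starN n δ) (fibreN n δ)) →
      RepresentsForests (map Delegation.team δs)
        (tensor (map (starN n) δs)) (choices (map (fibreN n) δs))
    tensor-represents n []       h = (refl , ≈-refl) ∷ []
    tensor-represents n (δ ∷ δs) h = product (h (here refl))
      where
      τs = map Delegation.team (δ ∷ δs)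
      rest = tensor-represents n δs (h ∘ there)
      row : ∀ {a U ts uss} → a ≈ q ^ μ (Delegation.team δ) U →
        RepresentsForests (map Delegation.team δs) ts uss →
        RepresentsForests τs
          (map (λ (b , Ts) → a ⊗ b , U ∷ Ts) ts) (map (U ∷_) uss)
      row a≈ []                 = []
      row {U = U} {(_ , Ts) ∷ _} a≈ ((refl , b≈) ∷ rs) =
        (refl , ≈-trans (*-cong a≈ b≈)
          (≈-sym (^-homo-* q (μ (Delegation.team δ) U) (μs (map Delegation.team δs) Ts))))
        ∷ row a≈ rs
      product : ∀ {s us} → Represents (λ U k → k ≡ μ (Delegation.team δ) U) s us →
        RepresentsForests τs
          (cartesianProductWith (λ (a , T) (b , Ts) → a ⊗ b , T ∷ Ts) s (tensor (map (starN n) δs)))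
          (cartesianProductWith _∷_ us (choices (map (fibreN n) δs)))
      product [] = []
      product ((refl , k , refl , a≈) ∷ rs) = Pointwise.++⁺ (row a≈ rest) (product rs)

    mutual
      starB-represents : ∀ n δ → IsDelegation Ξ δ → ∀ B {b} → lookup B b ≡ inside →
        Represents (λ U k → μ (Delegation.team δ) U ≡ (Sub.∣ B ∣ ∸ 1) + k) (starBN n δ B) (fibreBN n δ B)
      starB-represents zero    δ isD B b∈B = []
      starB-represents (suc n) δ isD B b∈B = Pointwise.map⁺ _ _ (Pointwise.map
        (λ { {_} {Us} (refl , a≈) → refl , _ , μ-node isD B Us , a≈ })
        (tensor-represents n (induced δ B) λ δ′∈ →
          let 𝐊 , 𝐊∈ , eq = ∈-map⁻ (inducedOn δ B) δ′∈ in
          star-represents n _ (subst (IsDelegation Ξ) (sym eq) (induced-IsDelegation B b∈B 𝐊∈))))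
        where open Facts δ isD

      star-represents : ∀ n δ → IsDelegation Ξ δ →
        Represents (λ U k → k ≡ μ (Delegation.team δ) U) (starN n δ) (fibreN n δ)
      star-represents n δ isD = go (nonemptySubsets (Delegation.arity δ)) ∈-nonemptySubsets⁻
        where
        scaled : ∀ B {s us} →
          Represents (λ U k → μ (Delegation.team δ) U ≡ (Sub.∣ B ∣ ∸ 1) + k) s us →
          Represents (λ U k → k ≡ μ (Delegation.team δ) U) (scale (q ^ (Sub.∣ B ∣ ∸ 1)) s) us
        scaled B [] = []
        scaled B ((refl , k , eq , a≈) ∷ rs) =
          (refl , _ , sym eq , ≈-trans (*-cong ≈-refl a≈) (≈-sym (^-homo-* q (Sub.∣ B ∣ ∸ 1) k)))
          ∷ scaled B rs
        go : ∀ Bs → (∀ {B} → B ∈ Bs → ∃ λ b → lookup B b ≡ inside) →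
          Represents (λ U k → k ≡ μ (Delegation.team δ) U)
            (concatMap (λ B → scale (q ^ (Sub.∣ B ∣ ∸ 1)) (starBN n δ B)) Bs) (concatMap (fibreBN n δ) Bs)
        go []       h = []
        go (B ∷ Bs) h = Pointwise.++⁺
          (scaled B (starB-represents n δ isD B (proj₂ (h (here refl))))) (go Bs (h ∘ there))

-- Flips towards the extreme constructs

-- Up is the flip order with \(δ) on top; down is its converse with /(δ) on top.
record Direction : Set₁ where
  field
    _≪_   : Rel ℤ 0ℓ
    ≪-asym : ∀ {x y} → x ≪ y → ¬ y ≪ x
    _◁_   : Rel VSet 0ℓ
    ◁⁻    : ∀ {Y Z y z} → Y ◁ Z → y ∈ Y → z ∈ Z → y ≪ z
    ◁⁺    : ∀ {Y Z} → (∀ {y z} → y ∈ Y → z ∈ Z → y ≪ z) → Y ◁ Z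
    _⊏_   : ∀ {p} → Rel (Fin p) 0ℓ
    ⊏-cmp : ∀ {p} {a b : Fin p} → a ≢ b → a ⊏ b ⊎ b ⊏ a
    ⊏-trans : ∀ {p} {a b c : Fin p} → a ⊏ b → b ⊏ c → a ⊏ c
    ⊏⇒◁   : ∀ {p} {X : Fin p → VSet} → (∀ {a b} → a Fin.< b → X a ≺ X b) → ∀ {a b} → a ⊏ b → X a ◁ X b
    sel   : ∀ {p} → Subset p
    -- The given index only ensures that there is a participant at all; without one, `sel` is empty.
    sel-extreme : ∀ {p} → Fin p → ∃ λ (i : Fin p) → lookup sel i ≡ inside ×
                    (∀ j → j ≢ i → lookup sel j ≡ outside × i ⊏ j)
    extN  : ℕ → Delegation → Tree
    extBN : ℕ → (δ : Delegation) → Subset (Delegation.arity δ) → Tree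
    -- `slashN` and `backslashN` are separate recursions; these two equations are the interface
    -- through which either is unfolded.
    extN≡ : ∀ n δ → extN n δ ≡ extBN n δ sel
    extBN≡ : ∀ n δ B → extBN (suc n) δ B ≡ node (⋃[ B ] Delegation.roots δ) (map (extN n) (induced δ B))

Fin-<-cmp : ∀ {p} {a b : Fin p} → a ≢ b → a Fin.< b ⊎ b Fin.< a
Fin-<-cmp {a = a} {b} a≢b with Fin.<-cmp a b
... | tri< a<b _ _ = inj₁ a<b
... | tri≈ _ a≡b _ = ⊥-elim (a≢b a≡b)
... | tri> _ _ b<a = inj₂ b<a

lookup-⁅⁆-≢ : ∀ {p} {i j : Fin p} → j ≢ i → lookup ⁅ i ⁆ j ≡ outside
lookup-⁅⁆-≢ {i = i} {j} j≢i with lookup ⁅ i ⁆ j in eq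
... | outside = refl
... | inside  = ⊥-elim (j≢i (Sub.x∈⁅y⁆⇒x≡y i (Vec.lookup⇒[]= j ⁅ i ⁆ eq)))

lookup-⁅⁆ : ∀ {p} (i : Fin p) → lookup ⁅ i ⁆ i ≡ inside
lookup-⁅⁆ i = Vec.[]=⇒lookup (Sub.x∈⁅x⁆ i)

up down : Direction
up = record
  { _≪_ = ℤ._<_ ; ≪-asym = ℤ.<-asym ; _◁_ = _≺_ ; ◁⁻ = ≺-lookup ; ◁⁺ = ≺-tabulate
  ; _⊏_ = Fin._<_ ; ⊏-cmp = Fin-<-cmp ; ⊏-trans = Fin.<-trans ; ⊏⇒◁ = λ h → h
  ; sel = first ; sel-extreme = λ { {suc p} _ → zero , refl , λ j j≢0 → lookup-⁅⁆-≢ j≢0 , 0<j j j≢0 }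
  ; extN = backslashN ; extBN = backslashBN ; extN≡ = λ _ _ → refl ; extBN≡ = λ _ _ _ → refl
  }
  where
  0<j : ∀ {p} (j : Fin (suc p)) → j ≢ zero → zero {p} Fin.< j
  0<j zero    j≢0 = ⊥-elim (j≢0 refl)
  0<j (suc j) j≢0 = s≤s z≤n
down = record
  { _≪_ = flip ℤ._<_ ; ≪-asym = ℤ.<-asym ; _◁_ = flip _≺_ ; ◁⁻ = λ Z≺Y y∈ z∈ → ≺-lookup Z≺Y z∈ y∈
  ; ◁⁺ = λ f → ≺-tabulate (λ z∈ y∈ → f y∈ z∈)
  ; _⊏_ = flip Fin._<_ ; ⊏-cmp = Fin-<-cmp ∘ (_∘ sym) ; ⊏-trans = flip Fin.<-trans ; ⊏⇒◁ = λ h → h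
  ; sel = last
  ; sel-extreme = λ { {suc p} _ → fromℕ p , lookup-⁅⁆ (fromℕ p) , λ j j≢p →
      lookup-⁅⁆-≢ j≢p , Fin.≤∧≢⇒< (Fin.≤fromℕ j) j≢p }
  ; extN = slashN ; extBN = slashBN ; extN≡ = λ _ _ → refl ; extBN≡ = λ _ _ _ → refl
  }

module Extreme {u x} {𝔘 : Pred Hypergraph u} (isU : IsUniverse 𝔘)
               {Ξ : Pred Team x} (isC : IsOrderedStrictClan 𝔘 Ξ) (dir : Direction) where

  open Clan isU isC
  open Fibre isU isC
  open Direction dir

  ◁-asym : ∀ {Y Z} → Y ≢ [] → Z ≢ [] → Y ◁ Z → ¬ Z ◁ Y
  ◁-asym Y≢[] Z≢[] Y◁Z Z◁Y = let _ , y∈ = nonempty-∃ Y≢[] ; _ , z∈ = nonempty-∃ Z≢[] in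
    ≪-asym (◁⁻ Y◁Z y∈ z∈) (◁⁻ Z◁Y z∈ y∈)

  ◁-mono : ∀ {Y Y′ Z Z′} → Y′ ⊆ Y → Z′ ⊆ Z → Y ◁ Z → Y′ ◁ Z′
  ◁-mono Y′⊆ Z′⊆ Y◁Z = ◁⁺ (λ y∈ z∈ → ◁⁻ Y◁Z (Y′⊆ y∈) (Z′⊆ z∈))

  greatest : ∀ {p} (xs : List (Fin p)) → xs ≢ [] →
    ∃ λ m → m ∈ xs × (∀ {y} → y ∈ xs → y ≢ m → y ⊏ m)
  greatest []       ne = ⊥-elim (ne refl)
  greatest (x ∷ []) ne = x , here refl , λ { (here y≡x) y≢x → ⊥-elim (y≢x y≡x) }
  greatest (x ∷ xs@(_ ∷ _)) ne with greatest xs (λ ())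
  ... | m , m∈ , max with x Fin.≟ m
  ...   | yes refl = x , here refl , λ { (here y≡x) y≢x → ⊥-elim (y≢x y≡x) ; (there y∈) y≢x → max y∈ y≢x }
  ...   | no x≢m with ⊏-cmp x≢m
  ...     | inj₁ x⊏m = m , there m∈ , λ { (here refl) _ → x⊏m ; (there y∈) y≢m → max y∈ y≢m }
  ...     | inj₂ m⊏x = x , here refl , λ { (here y≡x) y≢x → ⊥-elim (y≢x y≡x)
                                         ; (there y∈) y≢x → below-x y∈ }
    where
    below-x : ∀ {y} → y ∈ xs → y ⊏ x
    below-x {y} y∈ with y Fin.≟ m
    ... | yes refl = m⊏x
    ... | no  y≢m  = ⊏-trans (max y∈ y≢m) m⊏x

  mutual
    -- An extreme construct makes one particular choice of index set at every level, so it occurs in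
    -- the enumeration. That it is a construct and agrees with the participants then comes from
    -- `fibreB⁻`.
    extB-∈-fibreB : ∀ n δ → IsDelegation Ξ δ → size δ ≤ n → ∀ B {b} → lookup B b ≡ inside →
      extBN n δ B ∈ fibreBN n δ B
    extB-∈-fibreB zero δ isD le B {b} b∈B = ⊥-elim (size-≰0 isD b le)
    extB-∈-fibreB (suc n) δ isD le B {b} b∈B = subst (_∈ fibreBN (suc n) δ B) (sym (extBN≡ n δ B))
      (∈-map⁺ (node (⋃roots B)) (∈-choices⁺ (Pointwise.map⁺ (extN n) (fibreN n)
        (Pointwise.map⁺ (inducedOn δ B) (inducedOn δ B) (diagonal (coord ⤳ ⋃roots B) λ {𝐊} 𝐊∈ →
          ext-∈-fibre n (inducedOn δ B 𝐊) (induced-IsDelegation B b∈B 𝐊∈)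
            (induced-size isD B b∈B le 𝐊∈)
            (Piece.nonempty (piece⁻ coord-sorted {X = ⋃roots B} 𝐊∈)))))))
      where
      open Facts δ isD
      diagonal : ∀ {S : Rel Hypergraph 0ℓ} (𝐊s : List Hypergraph) →
        (∀ {𝐊} → 𝐊 ∈ 𝐊s → S 𝐊 𝐊) → Pointwise S 𝐊s 𝐊s
      diagonal []       h = []
      diagonal (𝐊 ∷ 𝐊s) h = h (here refl) ∷ diagonal 𝐊s (h ∘ there)

    ext-∈-fibre : ∀ n δ → IsDelegation Ξ δ → size δ ≤ n → vertices (Delegation.coord δ) ≢ [] →
      extN n δ ∈ fibreN n δ
    ext-∈-fibre n δ isD le ne =
      let a , _ = part-of (proj₂ (nonempty-∃ ne))
          i , i∈ , _ = sel-extreme a in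
      subst (_∈ fibreN n δ) (sym (extN≡ n δ))
        (∈-concatMap⁺ (fibreBN n δ) (lose (∈-nonemptySubsets⁺ sel i∈) (extB-∈-fibreB n δ isD le sel i∈)))
      where open Facts δ isD

  module Step (n : ℕ) (δ : Delegation) (isD : IsDelegation Ξ δ) (le : size δ ≤ suc n)
    (ih : ∀ {δ′ U} → IsDelegation Ξ δ′ → size δ′ ≤ n → U ∶ Delegation.coord δ′ → Agrees δ′ U →
      Star (Flip _◁_ (Delegation.coord δ′)) U (extN n δ′)) where

    open Facts δ isD

    Flips : Rel Tree 0ℓ
    Flips = Star (Flip _◁_ coord)

    flips-extB : ∀ {U} B {b} → lookup B b ≡ inside → U ∶ coord → root U ≡ ⋃roots B → Agrees δ U →
      Flips U (extBN (suc n) δ B)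
    flips-extB {node X Us} B b∈B t refl agrees =
      subst (Flips (node X Us)) (trans (cong (node X) (List.map-∘ (coord ⤳ X))) (sym (extBN≡ n δ B)))
        (flips-children coord-sorted (Node.root-∈ coord-sorted t) (Node.root-≢[] coord-sorted t)
          (extN n ∘ inducedOn δ B) (Node.subtrees coord-sorted t)
          λ {𝐊} m → ih (induced-IsDelegation B b∈B (zip-fst m)) (induced-size isD B b∈B le (zip-fst m))
            (Node.child-∶ coord-sorted t m) (Root.children-agree t agrees B m))

    -- A contraction changes the topmost intersection only with connected sets
    -- meeting both merged nodes, which no connected set of a part does.
    agrees-⊂ : ∀ {S T X Y} → S ∶ coord → T ∶ coord → S ⊂[ X , Y ] T →
      (∀ {a x y} → x ∈ X → y ∈ Y → x ∈ vertices (part a) → ¬ y ∈ vertices (part a)) →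
      ∀ a e → Tube (part a) e → top S e ≡ top T e
    agrees-⊂ {X = X} {Y} s t S⊂T apart a e te with top-⊂ coord-sorted s t (part-strict a e te) S⊂T
    ... | inj₁ eq = eq
    ... | inj₂ (X≢ , Y≢ , _) =
      let _ , x∈ = nonempty-∃ X≢ ; x∈X , x∈e = ∈-∩⁻ X e x∈
          _ , y∈ = nonempty-∃ Y≢ ; y∈Y , y∈e = ∈-∩⁻ Y e y∈ in
      ⊥-elim (apart {a} x∈X y∈Y (Tube.within te x∈e) (Tube.within te y∈e))

    module _ (i : Fin arity) (i∈sel : lookup sel i ≡ inside)
             (extreme : ∀ j → j ≢ i → lookup sel j ≡ outside × i ⊏ j) where

      i◁ : ∀ {j} → j ≢ i → vertices (part i) ◁ vertices (part j)
      i◁ j≢i = ⊏⇒◁ {X = vertices ∘ part} part-ordered (proj₂ (extreme _ j≢i))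

      -- Each round removes one `root (con b)` from the root, so the bound `k` on its length
      -- decreases; when only `i` is left, `B` is `sel`. The subtrees need no care in between:
      -- agreement is preserved, and `flips-extB` moves whatever subtrees result to the extreme
      -- ones.
      flips-inside : ∀ k {U} B → length (root U) ≤ k → U ∶ coord → root U ≡ ⋃roots B →
        lookup B i ≡ inside → Agrees δ U → Flips U (extN (suc n) δ)
      flips-inside zero {node X Us} B len t eq i∈B agrees =
        ⊥-elim (length-≰0 (Node.root-≢[] coord-sorted t) len)
      flips-inside (suc k) {node X Us} B len t refl i∈B agrees =
        cases (List.filter others? (List.allFin arity)) refl
        where
        Other : Fin arity → Set
        Other b = lookup B b ≡ inside × b ≢ i
        others? : Decidable Other
        others? b = (lookup B b Bool.≟ inside) ×-dec ¬? (b Fin.≟ i)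
        cases : ∀ bs → List.filter others? (List.allFin arity) ≡ bs → Flips (node X Us) (extN (suc n) δ)
        cases [] none = subst (Flips (node X Us))
            (trans (cong (extBN (suc n) δ) B≡sel) (sym (extN≡ (suc n) δ)))
            (flips-extB B i∈B t refl agrees)
          where
          B≡sel : B ≡ sel
          B≡sel = Vec-ext λ b → same b (b Fin.≟ i)
            where
            same : ∀ b → Dec (b ≡ i) → lookup B b ≡ lookup sel b
            same b (yes refl) = trans i∈B (sym i∈sel)
            same b (no b≢i) with lookup B b in eq
            ... | outside = sym (proj₁ (extreme b b≢i))
            ... | inside with () ← subst (b ∈_) none (∈-filter⁺ others? (∈-allFin b) (eq , b≢i))
        -- The part furthest from `i` is split off, so that everything remaining in the root
        -- precedes it and the new edge is a flip in the right direction.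
        cases bs@(_ ∷ _) eq = step (greatest bs (λ ()))
          where
          step : (∃ λ b → b ∈ bs × (∀ {b′} → b′ ∈ bs → b′ ≢ b → b′ ⊏ b)) →
            Flips (node X Us) (extN (suc n) δ)
          step (b , b∈bs , max) = go expanded
            where
            b-other : Other b
            b-other = proj₂ (∈-filter⁻ others? {xs = List.allFin arity} (subst (b ∈_) (sym eq) b∈bs))
            B₀ = B Vec.[ b ]≔ outside
            X₀ = ⋃roots B₀
            Y₀ = root (con b)
            B₀-b : lookup B₀ b ≡ outside
            B₀-b = Vec.lookup∘updateAt b B
            B₀-≢ : ∀ {a} → a ≢ b → lookup B₀ a ≡ lookup B a
            B₀-≢ {a} a≢b = Vec.lookup∘updateAt′ a b a≢b B
            ∈B₀⁻ : ∀ {a} → lookup B₀ a ≡ inside → a ≢ b × lookup B a ≡ inside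
            ∈B₀⁻ {a} a∈B₀ = a≢b , trans (sym (B₀-≢ a≢b)) a∈B₀
              where
              a≢b : a ≢ b
              a≢b refl with () ← trans (sym a∈B₀) B₀-b
            i∈B₀ : lookup B₀ i ≡ inside
            i∈B₀ = trans (B₀-≢ (proj₂ b-other ∘ sym)) i∈B
            dis : Disjoint-from (vertices (part b)) X₀
            dis = ⋃roots-outside B₀ B₀-b
            X≡ : X ≡ X₀ ∪ Y₀
            X≡ = Increasing-ext (⋃roots-increasing B)
              (∪-increasing (⋃roots-increasing B₀) (root-increasing b)
                (λ x∈X₀ x∈Y → dis (root-⊆ b x∈Y) x∈X₀))
              (λ x∈ → let a , a∈B , x∈a = ∈-⋃roots⁻ B x∈ in ∈-∪⁺ X₀ Y₀ (sort a a∈B x∈a (a Fin.≟ b)))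
              (λ x∈ → [ (λ x∈X₀ → let a , a∈B₀ , x∈a = ∈-⋃roots⁻ B₀ x∈X₀ in
                                   ∈-⋃roots⁺ B (proj₂ (∈B₀⁻ a∈B₀)) x∈a)
                      , ∈-⋃roots⁺ B (proj₁ b-other) ]′ (∈-∪⁻ X₀ Y₀ x∈))
              where
              sort : ∀ a {x} → lookup B a ≡ inside → x ∈ root (con a) → Dec (a ≡ b) → x ∈ X₀ ⊎ x ∈ Y₀
              sort a a∈B x∈a (yes refl) = inj₂ x∈a
              sort a a∈B x∈a (no a≢b)   = inj₁ (∈-⋃roots⁺ B₀ (trans (B₀-≢ a≢b) a∈B) x∈a)
            X₀◁Y₀ : X₀ ◁ Y₀
            X₀◁Y₀ = ◁⁺ λ x∈X₀ y∈Y₀ →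
              let a , a∈B₀ , x∈a = ∈-⋃roots⁻ B₀ x∈X₀ ; a≢b , a∈B = ∈B₀⁻ a∈B₀ in
              ◁⁻ (before a a∈B a≢b (a Fin.≟ i)) (root-⊆ a x∈a) (root-⊆ b y∈Y₀)
              where
              before : ∀ a → lookup B a ≡ inside → a ≢ b → Dec (a ≡ i) →
                vertices (part a) ◁ vertices (part b)
              before a a∈B a≢b (yes refl) = i◁ (a≢b ∘ sym)
              before a a∈B a≢b (no a≢i)   = ⊏⇒◁ {X = vertices ∘ part} part-ordered
                (max (subst (a ∈_) eq (∈-filter⁺ others? (∈-allFin a) (a∈B , a≢i))) a≢b)
            component : ∃ λ 𝐊 → 𝐊 ∈ coord ⤳ X₀ × vertices (part b) ⊆ vertices 𝐊
            component = piece-⊇ coord-sorted {X = X₀} (part-strict b _ (part-tube b)) dis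
            expanded : ∃ λ S → S ∶ coord × root S ≡ X₀ × S ⊂[ X₀ , Y₀ ] node (X₀ ∪ Y₀) Us
            expanded = let 𝐊 , 𝐊∈ , b⊆𝐊 = component in
              expand-∶ coord-sorted coord-ordered (⋃roots-≢[] B₀ i∈B₀) (⋃roots-increasing B₀) (⋃roots-⊆ B₀)
                𝐊∈ (Facts.coord-ordered (inducedOn δ B₀ 𝐊) (induced-IsDelegation B₀ i∈B₀ 𝐊∈))
                (root-≢[] b) (root-increasing b) (b⊆𝐊 ∘ root-⊆ b)
                (subst (λ X → node X Us ∶ coord) X≡ t)
            go : (∃ λ S → S ∶ coord × root S ≡ X₀ × S ⊂[ X₀ , Y₀ ] node (X₀ ∪ Y₀) Us) →
              Flips (node X Us) (extN (suc n) δ)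
            go (S , s , rootS , S⊂′) =
              (t , s , Y₀ , X₀ , X₀◁Y₀ , inj₂ S⊂) ◅
              flips-inside k B₀ (subst (λ Z → length Z ≤ k) (sym rootS) smaller) s rootS i∈B₀
                (λ a e te → trans (agrees-⊂ s t S⊂ apart a e te) (agrees a e te))
              where
              S⊂ : S ⊂[ X₀ , Y₀ ] node X Us
              S⊂ = subst (λ X → S ⊂[ X₀ , Y₀ ] node X Us) (sym X≡) S⊂′
              apart : ∀ {a x y} → x ∈ X₀ → y ∈ Y₀ → x ∈ vertices (part a) → ¬ y ∈ vertices (part a)
              apart x∈X₀ y∈Y₀ x∈a y∈a with part-unique y∈a (root-⊆ b y∈Y₀)
              ... | refl = dis x∈a x∈X₀
              smaller : length X₀ ≤ k
              smaller = let _ , y∈ = nonempty-∃ (root-≢[] b) in ℕ.≤-pred (ℕ.≤-trans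
                (length-⊂ (⋃roots-increasing B₀) (⋃roots-increasing B)
                  (λ x∈ → subst (_ ∈_) (sym X≡) (∈-∪⁺ X₀ Y₀ (inj₁ x∈)))
                  (∈-⋃roots⁺ B (proj₁ b-other) y∈) (λ y∈X₀ → dis (root-⊆ b y∈) y∈X₀)) len)

      -- The part i is the extreme one also among the participants of an
      -- induced delegation.
      module _ B {b} (b∈B : lookup B b ≡ inside) (i∉B : lookup B i ≡ outside)
               {𝐊} (𝐊∈ : 𝐊 ∈ coord ⤳ ⋃roots B) where

        private
          δ′ = inducedOn δ B 𝐊
          module F′ = Facts δ′ (induced-IsDelegation B b∈B 𝐊∈)

        -- The participant `i′` is contained in some part `a`. If it came strictly before part `i`,
        -- then `a` could not be `i`; nor could it be another part, as all of those come after part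
        -- `i`.
        extreme-unique : ∀ i′ j → (i′ ≢ j → vertices (F′.part i′) ◁ vertices (F′.part j)) →
          lookup (Delegation.participants δ′) j ≡ lookup participants i → i′ ≡ j
        extreme-unique i′ j i′◁j j≡ with i′ Fin.≟ j
        ... | yes eq = eq
        ... | no i′≢j = ⊥-elim (refute (proj₁ (inducedOn-lookup δ B 𝐊 i′)))
          where
          i′◁i : vertices (F′.part i′) ◁ vertices (part i)
          i′◁i = subst (λ P → vertices (F′.part i′) ◁ vertices (proj₁ P)) j≡ (i′◁j i′≢j)
          inside-part : ∀ a → vertices (F′.part i′) ⊆ vertices (part a) → ⊥
          inside-part a ⊆a with a Fin.≟ i
          ... | no a≢i = ◁-asym (F′.part-≢[] i′) (part-≢[] i) i′◁i (◁-mono id ⊆a (i◁ a≢i))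
          ... | yes refl = let _ , x∈ = nonempty-∃ (F′.part-≢[] i′) in
            ≪-asym (◁⁻ i′◁i x∈ (⊆a x∈)) (◁⁻ i′◁i x∈ (⊆a x∈))
          refute : PieceOf participants B (lookup (Delegation.participants δ′) i′) → ⊥
          refute (inj₁ (a , _ , eq)) =
            inside-part a (λ {x} x∈ → subst (λ P → x ∈ vertices (proj₁ P)) eq x∈)
          refute (inj₂ (a , _ , P∈)) =
            inside-part a (Piece.within (tree-child-piece (part-sorted a) (con-∶ a) P∈))

        ⋃roots-child : ∀ j → lookup (Delegation.participants δ′) j ≡ lookup participants i →
          F′.⋃roots sel ≡ root (con i)
        ⋃roots-child j j≡ = aux (sel-extreme j)
          where
          aux : (∃ λ i′ → lookup sel i′ ≡ inside × (∀ k → k ≢ i′ → lookup sel k ≡ outside × i′ ⊏ k)) →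
            F′.⋃roots sel ≡ root (con i)
          aux (i′ , i′∈ , extreme′) = Increasing-ext (F′.⋃roots-increasing sel) (root-increasing i)
            (λ {x} x∈ → let a , a∈ , x∈a = F′.∈-⋃roots⁻ sel x∈ in
              subst (x ∈_) (trans (cong (root ∘ F′.con) (only a a∈ (a Fin.≟ i′))) root-i′) x∈a)
            (λ {x} x∈ → F′.∈-⋃roots⁺ sel i′∈ (subst (x ∈_) (sym root-i′) x∈))
            where
            i′≡j : i′ ≡ j
            i′≡j = extreme-unique i′ j (λ i′≢j → ⊏⇒◁ {X = vertices ∘ F′.part} F′.part-ordered
              (proj₂ (extreme′ j (i′≢j ∘ sym)))) j≡
            root-i′ : root (F′.con i′) ≡ root (con i)
            root-i′ = trans (cong (root ∘ F′.con) i′≡j) (cong (root ∘ proj₂) j≡)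
            only : ∀ a → lookup sel a ≡ inside → Dec (a ≡ i′) → a ≡ i′
            only a a∈ (yes a≡) = a≡
            only a a∈ (no a≢) with () ← trans (sym a∈) (proj₁ (extreme′ a a≢))

      -- The subtrees are moved first because `root (con i)` need not label a child of the root of
      -- `U`, whereas it is the root of the extreme construct over the component containing part
      -- `i`. One merge then brings `i` into the index set, and `flips-inside` takes over.
      flips-outside : ∀ {U} B {b} → lookup B b ≡ inside → U ∶ coord → root U ≡ ⋃roots B →
        lookup B i ≡ outside → Agrees δ U → Flips U (extN (suc n) δ)
      flips-outside {U} B {b} b∈B t eq i∉B agrees = flips-extB B b∈B t eq agrees ◅◅
        merge-i (piece-⊇ coord-sorted {X = X₀} (part-strict i _ (part-tube i)) (⋃roots-outside B i∉B))
        where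
        X₀ = ⋃roots B
        Y₀ = root (con i)
        g = extN n ∘ inducedOn δ B
        W = extBN (suc n) δ B
        w : W ∶ coord × Agrees δ W
        w = fibreB⁻ (suc n) δ isD le B b∈B (extB-∈-fibreB (suc n) δ isD le B b∈B)
        W≡ : W ≡ node X₀ (map g (coord ⤳ X₀))
        W≡ = trans (extBN≡ n δ B) (cong (node X₀) (sym (List.map-∘ (coord ⤳ X₀))))
        Y₀◁X₀ : Y₀ ◁ X₀
        Y₀◁X₀ = ◁⁺ λ y∈ x∈ → let a , a∈B , x∈a = ∈-⋃roots⁻ B x∈ in
          ◁⁻ (i◁ (λ { refl → case trans (sym a∈B) i∉B of λ () })) (root-⊆ i y∈) (root-⊆ a x∈a)
        apart : ∀ {a x y} → x ∈ X₀ → y ∈ Y₀ → x ∈ vertices (part a) → ¬ y ∈ vertices (part a)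
        apart x∈X₀ y∈Y₀ x∈a y∈a with part-unique y∈a (root-⊆ i y∈Y₀)
        ... | refl = ⋃roots-outside B i∉B x∈a x∈X₀
        i-meets : lookup (meeting (X₀ ∪ Y₀)) i ≡ inside
        i-meets = let _ , y∈ = nonempty-∃ (root-≢[] i) in
          inside-meeting (X₀ ∪ Y₀) (∈-∪⁺ X₀ Y₀ (inj₂ y∈)) (root-⊆ i y∈)

        merged : ∀ ls {ts rs} → W ≡ node X₀ (ls ++ node Y₀ ts ∷ rs) → Flips W (extN (suc n) δ)
        merged ls {ts} {rs} eq = (proj₁ w , w′ , X₀ , Y₀ , Y₀◁X₀ , inj₁ W⊂) ◅
          -- The new index set consists of the parts that the merged root meets; agreement shows
          -- that this root is the union of their roots.
          flips-inside (length (X₀ ∪ Y₀)) (meeting (X₀ ∪ Y₀)) ℕ.≤-refl w′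
            (Root.root≡⋃roots w′ w′-agrees) i-meets w′-agrees
          where
          W′ = node (X₀ ∪ Y₀) (ls ++ ts ++ rs)
          W⊂ : W ⊂[ X₀ , Y₀ ] W′
          W⊂ = subst (_⊂[ X₀ , Y₀ ] W′) (sym eq) (here ls)
          w′ : W′ ∶ coord
          w′ = contract-∶ coord-sorted coord-ordered ls
            (λ {𝐊} 𝐊∈ → Facts.coord-ordered (inducedOn δ B 𝐊) (induced-IsDelegation B b∈B 𝐊∈))
            (subst (_∶ coord) eq (proj₁ w))
          w′-agrees : Agrees δ W′
          w′-agrees a e te = trans (sym (agrees-⊂ (proj₁ w) w′ W⊂ apart a e te)) (proj₂ w a e te)

        merge-i : (∃ λ 𝐊 → 𝐊 ∈ coord ⤳ X₀ × vertices (part i) ⊆ vertices 𝐊) → Flips W (extN (suc n) δ)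
        merge-i (𝐊 , 𝐊∈ , i⊆𝐊) = split (inducedOn-find δ B 𝐊 (pieces⁺ˡ participants B i i∉B) i⊆𝐊) (∈-∃++ 𝐊∈)
          where
          δ′ = inducedOn δ B 𝐊
          le′ : size δ′ ≤ n
          le′ = induced-size isD B b∈B le 𝐊∈
          split : (∃ λ j → lookup (Delegation.participants δ′) j ≡ lookup participants i) →
            (∃₂ λ ls rs → coord ⤳ X₀ ≡ ls ++ 𝐊 ∷ rs) → Flips W (extN (suc n) δ)
          split (j , j≡) (ls , rs , eq) = by-fuel n refl
            where
            -- `extN n` displays a root only for positive `n`, and `n` is positive because the
            -- component containing part `i` has a vertex.
            by-fuel : ∀ m → n ≡ m → Flips W (extN (suc n) δ)
            by-fuel zero n≡ =
              ⊥-elim (size-≰0 (induced-IsDelegation B b∈B 𝐊∈) j (subst (size δ′ ≤_) n≡ le′))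
            by-fuel (suc m) n≡ = merged (map g ls) (trans W≡ (cong (node X₀)
              (trans (cong (map g) eq) (trans (List.map-++ g ls (𝐊 ∷ rs))
                (cong (λ V → map g ls ++ V ∷ map g rs) child≡)))))
              where
              child≡ : g 𝐊 ≡ node Y₀ (map (extN m) (induced δ′ sel))
              child≡ = trans (cong (λ k → extN k δ′) n≡) (trans (extN≡ (suc m) δ′) (trans (extBN≡ m δ′ sel)
                (cong (λ Z → node Z (map (extN m) (induced δ′ sel))) (⋃roots-child B b∈B i∉B 𝐊∈ j j≡))))

    flips-ext-step : ∀ {U} → U ∶ coord → Agrees δ U → Flips U (extN (suc n) δ)
    flips-ext-step {node X Us} t agrees = by-i (lookup (meeting X) i) refl
      where
      x∈X = proj₂ (nonempty-∃ (Node.root-≢[] coord-sorted t))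
      a,x∈a = part-of (Node.root-⊆ coord-sorted t x∈X)
      a∈ : lookup (meeting X) (proj₁ a,x∈a) ≡ inside
      a∈ = inside-meeting X x∈X (proj₂ a,x∈a)
      found = sel-extreme (proj₁ a,x∈a)
      i = proj₁ found
      by-i : ∀ b → lookup (meeting X) i ≡ b → Flips (node X Us) (extN (suc n) δ)
      by-i true  i∈ = flips-inside i (proj₁ (proj₂ found)) (proj₂ (proj₂ found)) (length X) (meeting X)
        ℕ.≤-refl t (Root.root≡⋃roots t agrees) i∈ agrees
      by-i false i∉ = flips-outside i (proj₁ (proj₂ found)) (proj₂ (proj₂ found)) (meeting X) a∈ t
        (Root.root≡⋃roots t agrees) i∉ agrees

  flips-ext : ∀ n {δ U} → IsDelegation Ξ δ → size δ ≤ n → U ∶ Delegation.coord δ → Agrees δ U →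
    Star (Flip _◁_ (Delegation.coord δ)) U (extN n δ)
  flips-ext zero {δ} {node X Us} isD le t agrees = ⊥-elim (length-≰0
      (∈⇒≢[] (Node.root-⊆ coord-sorted t (proj₂ (nonempty-∃ (Node.root-≢[] coord-sorted t))))) le)
    where open Facts δ isD
  flips-ext (suc n) {δ} isD le t agrees = Step.flips-ext-step n δ isD le (flips-ext n) t agrees

  flips-extB : ∀ n {δ U} → IsDelegation Ξ δ → size δ ≤ n → ∀ B {b} → lookup B b ≡ inside →
    U ∶ Delegation.coord δ → root U ≡ ⋃[ B ] Delegation.roots δ → Agrees δ U →
    Star (Flip _◁_ (Delegation.coord δ)) U (extBN n δ B)
  flips-extB zero    isD le B {b} b∈B t eq agrees = ⊥-elim (size-≰0 isD b le)
  flips-extB (suc n) {δ} isD le B b∈B t eq agrees =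
    Step.flips-extB n δ isD le (flips-ext n) B b∈B t eq agrees

-- Assembly of the equalities

∣∣-inside : ∀ (B : Subset m) {b} → lookup B b ≡ inside → ∃ λ k → Sub.∣ B ∣ ≡ suc k
∣∣-inside (inside ∷ B)              b∈B = Sub.∣ B ∣ , refl
∣∣-inside (outside ∷ B) {b = suc b} b∈B = ∣∣-inside B b∈B

-- Here `c` is the cardinality of `B`; being positive, it makes both truncated subtractions exact.
μ-exponent : ∀ {j k w} c → c ≡ suc j → w ≡ (c ∸ 1) + k → k ≡ (w + 1) ∸ c
μ-exponent {j} {k} c refl refl =
  sym (trans (cong (_∸ suc j) (ℕ.+-comm (j + k) 1)) (ℕ.m+n∸m≡n j k))

flips⇒≤ : ∀ {𝐇 S T} → Star (Flip (flip _≺_) 𝐇) S T → T ≤[ 𝐇 ] S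
flips⇒≤ = Star.reverse λ (s , t , U , V , U≺V , S⊂T) → t , s , V , U , U≺V , Sum.swap S⊂T

module _ {c ℓ u x} (R : CommutativeRing c ℓ) (q : CommutativeRing.Carrier R)
  {𝔘 : Pred Hypergraph u} (isU : IsUniverse 𝔘)
  {Ξ : Pred Team x} (isC : IsOrderedStrictClan 𝔘 Ξ)
  (δ : Delegation) (isD : IsDelegation Ξ δ)
  (B : Subset (Delegation.arity δ)) {b} (b∈B : lookup B b ≡ inside) where

  private
    open Products R q
    open Clan isU isC
    open Fibre isU isC
    open Sums R q
    open Facts δ isD
    module Up   = Extreme isU isC up
    module Down = Extreme isU isC down

    N = size δ

    coord-≢[] : vertices coord ≢ []
    coord-≢[] = Tube.nonempty (coord-tube b)

    restricts⇒agrees : ∀ {U} → U ∶ coord → RestrictsTo δ U → Agrees δ U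
    restricts⇒agrees u restricts a =
      restrict⇒agree coord-sorted u (part-tube a) (part-strict a) (VecAll.lookup⁺ restricts a)

    agrees⇒restricts : ∀ {U} → U ∶ coord → Agrees δ U → RestrictsTo δ U
    agrees⇒restricts u agrees = VecAll.lookup⁻ λ a →
      agree⇒restrict coord-sorted u (part-tube a) (part-strict a) (con-∶ a) (agrees a)

    squeeze-agrees : ∀ {S T U} → S ∶ coord × Agrees δ S → Agrees δ T →
      U ∶ coord → S ≤[ coord ] U → U ≤[ coord ] T → Agrees δ U
    squeeze-agrees (s , S-agrees) T-agrees u S≤U U≤T a e te = trans
      (squeeze coord-sorted s u S≤U U≤T (part-strict a e te)
        (trans (S-agrees a e te) (sym (T-agrees a e te))))
      (S-agrees a e te)

    slash-spec : slash δ ∶ coord × Agrees δ (slash δ)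
    slash-spec = fibre⁻ N δ isD ℕ.≤-refl (Down.ext-∈-fibre N δ isD ℕ.≤-refl coord-≢[])

    backslash-spec : backslash δ ∶ coord × Agrees δ (backslash δ)
    backslash-spec = fibre⁻ N δ isD ℕ.≤-refl (Up.ext-∈-fibre N δ isD ℕ.≤-refl coord-≢[])

    slashB-∈ : slashB δ B ∈ fibreBN N δ B
    slashB-∈ = Down.extB-∈-fibreB N δ isD ℕ.≤-refl B b∈B

    backslashB-∈ : backslashB δ B ∈ fibreBN N δ B
    backslashB-∈ = Up.extB-∈-fibreB N δ isD ℕ.≤-refl B b∈B

    fibreB-spec : ∀ {U} → U ∈ fibreBN N δ B → U ∶ coord × Agrees δ U
    fibreB-spec = fibreB⁻ N δ isD ℕ.≤-refl B b∈B

    -- The root is the topmost intersection with the whole vertex set, which is a tube as well, and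
    -- both endpoints have the same value there.
    squeeze-root : ∀ {U} → U ∶ coord → slashB δ B ≤[ coord ] U → U ≤[ coord ] backslashB δ B →
      root U ≡ ⋃roots B
    squeeze-root {U} u S≤U U≤T = trans (sym (tree-top-whole coord-sorted u))
      (trans (squeeze coord-sorted s u S≤U U≤T (coord-tube b) (trans slash≡ (sym backslash≡))) slash≡)
      where
      s = proj₁ (fibreB-spec slashB-∈)
      slash≡ : top (slashB δ B) (vertices coord) ≡ ⋃roots B
      slash≡ = trans (tree-top-whole coord-sorted s) (root-fibreB N δ B slashB-∈)
      backslash≡ : top (backslashB δ B) (vertices coord) ≡ ⋃roots B
      backslash≡ = trans (tree-top-whole coord-sorted (proj₁ (fibreB-spec backslashB-∈)))
        (root-fibreB N δ B backslashB-∈)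

    open CommutativeRing R using (semiring)
    open import Algebra.Properties.Semiring.Exp semiring using (_^_)

    -- `P` stands for either description of the summation range. Each is equivalent to agreement
    -- with the participants, so a single enumeration with its coefficients serves both sums.
    fibre-sum : ∀ {P : Tree → Set} → (∀ {U} → P U → U ∶ coord × Agrees δ U) →
      (∀ {U} → U ∶ coord → Agrees δ U → P U) → IsSumOver P (λ U → q ^ μ team U) (star δ)
    fibre-sum P⇒ ⇒P = record
      { indices  = fibreN N δ
      ; unique   = fibre-unique N δ isD
      ; complete = mk⇔ (λ U∈ → uncurry ⇒P (fibre⁻ N δ isD ℕ.≤-refl U∈))
                       (λ PU → let u , agrees = P⇒ PU in fibre⁺ N δ isD ℕ.≤-refl u agrees)
      ; equal    = represents-≋ id (star-represents N δ isD)
      }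

    fibreB-sum : ∀ {P : Tree → Set} → (∀ {U} → P U → U ∶ coord × root U ≡ ⋃roots B × Agrees δ U) →
      (∀ {U} → U ∶ coord → root U ≡ ⋃roots B → Agrees δ U → P U) →
      IsSumOver P (λ U → q ^ ((μ team U + 1) ∸ Sub.∣ B ∣)) (starB δ B)
    fibreB-sum P⇒ ⇒P = record
      { indices  = fibreBN N δ B
      ; unique   = fibreB-unique N δ isD B b∈B
      ; complete = mk⇔ (λ U∈ → let u , agrees = fibreB-spec U∈ in ⇒P u (root-fibreB N δ B U∈) agrees)
                       (λ PU → let u , r , agrees = P⇒ PU in fibreB⁺ N δ isD ℕ.≤-refl B b∈B u r agrees)
      ; equal    = represents-≋ (μ-exponent Sub.∣ B ∣ (proj₂ (∣∣-inside B b∈B)))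
                               (starB-represents N δ isD B b∈B)
      }

  star-equalities : (Is-star⌈ δ (star δ) × Is-star≤ δ (star δ)) ×
    (Is-starB⌈ δ B (starB δ B) × Is-starB≤ δ B (starB δ B))
  star-equalities =
    ( fibre-sum (λ (u , restricts) → u , restricts⇒agrees u restricts)
                (λ u agrees → u , agrees⇒restricts u agrees)
    , fibre-sum (λ (u , S≤U , U≤T) → u , squeeze-agrees slash-spec (proj₂ backslash-spec) u S≤U U≤T)
                (λ u agrees → u , flips⇒≤ (Down.flips-ext N isD ℕ.≤-refl u agrees)
                                , Up.flips-ext N isD ℕ.≤-refl u agrees))
    , ( fibreB-sum (λ (u , r , restricts) → u , r , restricts⇒agrees u restricts)
                   (λ u r agrees → u , r , agrees⇒restricts u agrees)
      , fibreB-sum (λ (u , S≤U , U≤T) → u , squeeze-root u S≤U U≤T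
                     , squeeze-agrees (fibreB-spec slashB-∈) (proj₂ (fibreB-spec backslashB-∈)) u S≤U U≤T)
                   (λ u r agrees → u , flips⇒≤ (Down.flips-extB N isD ℕ.≤-refl B b∈B u r agrees)
                                     , Up.flips-extB N isD ℕ.≤-refl B b∈B u r agrees))

theorem4p5 : ∀ {c ℓ u x} (R : CommutativeRing c ℓ) (q : CommutativeRing.Carrier R) →
    let open Products R q in
    (𝔘 : Pred Hypergraph u) → IsUniverse 𝔘 →
    (Ξ : Pred Team x) → IsOrderedStrictClan 𝔘 Ξ → Associative Ξ →
    (δ : Delegation) → IsDelegation Ξ δ →
    (B : Subset (Delegation.arity δ)) → Nonempty B →
    (Is-star⌈ δ (star δ) × Is-star≤ δ (star δ)) ×
    (Is-starB⌈ δ B (starB δ B) × Is-starB≤ δ B (starB δ B))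
theorem4p5 R q 𝔘 isU Ξ isC _ δ isD B (b , b∈B) =
  star-equalities R q isU isC δ isD B (Vec.[]=⇒lookup b∈B)
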